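{- Let $C=\langle a,b\rangle$ be an HFP-code of type Q of length $4n$ whose kernel has dimension $2$. Let $H$ be the $4n\times 4n$ binary matrix whose rows are the codewords of $C$ having a $0$ in the first coordinate (in any order), and let $C^T$ (the transpose code of $C$) be the code consisting of the columns of $H$ together with their complements. Then the kernel of $C^T$ has dimension $1$.
   Context: Let $\mathbb{F}=\mathbb{Z}_2$. $\mathbf 0,\mathbf 1$ denote the all-zero and all-one vectors; for a permutation $\pi$ of $\{1,\dots,m\}$ and $v\in\mathbb{F}^m$, $\pi(v)=(v_{\pi^{ -1}(1)},\dots,v_{\pi^{ -1}(m)})$. A binary Hadamard matrix of order $4n$ is obtained from a $4n\times4n$ matrix with entries $\pm1$ and $HH^T=4nI$ by replacing $+1$ by $0$ and $-1$ by $1$; the binary Hadamard code it defines is the set of its rows together with their complements. A code $C\subseteq\mathbb{F}^m$ with $\mathbf 0\in C$ is propelinear if to each $x\in C$ a coordinate permutation $\pi_x$ is assigned such that for all $x,y\in C$: $x+\pi_x(y)\in C$ and $\pi_x\pi_y=\pi_{x+\pi_x(y)}$; then $x\cdot y:=x+\pi_x(y)$ makes $(C,\cdot)$ a group with identity $\mathbf 0$. An HFP-code of length $4n$ is a propelinear code that is also a binary Hadamard code of length $4n$, with $\pi_{\mathbf 0}=\pi_{\mathbf 1}=\mathrm{id}$ and such that for every $a\in C\setminus\{\mathbf 0,\mathbf 1\}$, $\pi_a$ has no fixed coordinate. An HFP-code $C$ of length $4n$ is of type Q, written $C=\langle a,b\rangle$, if there are $a,b\in C$ generating $(C,\cdot)$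 with $(C,\cdot)$ having presentation $\langle a,b: a^{4n}=\mathbf 0,\ a^{2n}=b^2,\ b^{ -1}ab=a^{ -1}\rangle$. The kernel of a code $C\subseteq\mathbb{F}^m$ is $K(C)=\{z\in\mathbb{F}^m: C+z=C\}$, a linear subspace. -}

module Defs where

open import Data.Nat using (ℕ; zero; suc; _*_)
open import Data.Bool using (Bool; true; false; not; _xor_; if_then_else_)
open import Data.Fin using (Fin; zero; suc; _≟_; toℕ)
open import Data.Vec using (Vec; []; _∷_; lookup; tabulate; replicate; zipWith; head)
open import Data.Integer as ℤ using (ℤ; +_; -_)
open import Data.Fin.Permutation using (Permutation′; _⟨$⟩ʳ_; _⟨$⟩ˡ_)
open import Data.Product using (Σ; ∃; _×_; _,_)
open import Data.Sum using (_⊎_)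
open import Relation.Binary.PropositionalEquality using (_≡_; _≢_)
open import Relation.Nullary using (does)
open import Function.Bundles using (_⇔_)

-- Binary words of length m : elements of 𝔽^m, 𝔽 = ℤ₂ (true = 1, false = 0)
Word : ℕ → Set
Word m = Vec Bool m

𝟎 : ∀ {m} → Word m
𝟎 = replicate _ false

𝟏 : ∀ {m} → Word m
𝟏 = replicate _ true

_⊕_ : ∀ {m} → Word m → Word m → Word m
_⊕_ = zipWith _xor_

compl : ∀ {m} → Word m → Word m
compl x = x ⊕ 𝟏

act : ∀ {m} → Permutation′ m → Word m → Word m
act π v = tabulate (λ i → lookup v (π ⟨$⟩ˡ i))

Code : ℕ → Set₁
Code m = Word m → Set

sgn : Bool → ℤ
sgn false = + 1
sgn true  = - (+ 1)

sumFin : (m : ℕ) → (Fin m → ℤ) → ℤ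
sumFin zero    f = + 0
sumFin (suc m) f = f zero ℤ.+ sumFin m (λ i → f (suc i))

IsBinaryHadamard : (N : ℕ) → (Fin N → Word N) → Set
IsBinaryHadamard N H =
  ∀ i j → sumFin N (λ k → sgn (lookup (H i) k) ℤ.* sgn (lookup (H j) k))
          ≡ (if does (i ≟ j) then + N else + 0)

IsHadamardCodeOf : (N : ℕ) → (Fin N → Word N) → Code N → Set
IsHadamardCodeOf N H C = ∀ x → C x ⇔ ((∃ λ i → x ≡ H i) ⊎ (∃ λ i → x ≡ compl (H i)))

IsBinaryHadamardCode : (N : ℕ) → Code N → Set
IsBinaryHadamardCode N C =
  Σ (Fin N → Word N) λ H → IsBinaryHadamard N H × IsHadamardCodeOf N H C

-- an assignment x ↦ π_x (only its values on codewords matter)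
Assignment : ℕ → Set
Assignment m = Word m → Permutation′ m

mul : ∀ {m} → Assignment m → Word m → Word m → Word m
mul π x y = x ⊕ act (π x) y

IsPropelinear : ∀ {m} → Code m → Assignment m → Set
IsPropelinear C π =
  C 𝟎 ×
  (∀ x y → C x → C y →
     C (mul π x y) ×
     (∀ i → π x ⟨$⟩ʳ (π y ⟨$⟩ʳ i) ≡ π (mul π x y) ⟨$⟩ʳ i))

IsHFP : (N : ℕ) → Code N → Assignment N → Set
IsHFP N C π =
  IsPropelinear C π ×
  IsBinaryHadamardCode N C ×
  (∀ i → π 𝟎 ⟨$⟩ʳ i ≡ i) ×
  (∀ i → π 𝟏 ⟨$⟩ʳ i ≡ i) ×
  (∀ a → C a → a ≢ 𝟎 → a ≢ 𝟏 → ∀ i → π a ⟨$⟩ʳ i ≢ i)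

-- inverse in (C,·): x⁻¹ = π_x⁻¹(x)   (indeed x · π_x⁻¹(x) = x + x = 𝟎)
inv : ∀ {m} → Assignment m → Word m → Word m
inv π x = tabulate (λ i → lookup x (π x ⟨$⟩ʳ i))

pow : ∀ {m} → Assignment m → Word m → ℕ → Word m
pow π x zero    = 𝟎
pow π x (suc k) = mul π x (pow π x k)

data Gen {m} (π : Assignment m) (a b : Word m) : Word m → Set where
  gen-0   : Gen π a b 𝟎
  gen-a   : Gen π a b a
  gen-b   : Gen π a b b
  gen-mul : ∀ {x y} → Gen π a b x → Gen π a b y → Gen π a b (mul π x y)
  gen-inv : ∀ {x} → Gen π a b x → Gen π a b (inv π x)

-- C = ⟨a,b⟩ is of type Q (length 4n): a, b ∈ C generate (C,·), and
-- (C,·) has presentation ⟨a,b : a^{4n}=0, a^{2n}=b², b⁻¹ab=a⁻¹⟩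
IsTypeQ : (n : ℕ) → Code (4 * n) → Assignment (4 * n) → Word (4 * n) → Word (4 * n) → Set
IsTypeQ n C π a b =
  C a × C b ×
  (∀ x → C x → Gen π a b x) ×
  pow π a (4 * n) ≡ 𝟎 ×
  pow π a (2 * n) ≡ pow π b 2 ×
  mul π (inv π b) (mul π a b) ≡ inv π a

Kernel : ∀ {m} → Code m → Word m → Set
Kernel C z = ∀ x → C x ⇔ C (x ⊕ z)

linComb : ∀ {m d} → Vec (Word m) d → Vec Bool d → Word m
linComb []      []      = 𝟎
linComb (v ∷ B) (c ∷ cs) = (if c then v else 𝟎) ⊕ linComb B cs

IsBasis : ∀ {m d} → (Word m → Set) → Vec (Word m) d → Set
IsBasis P B =
  (∀ z → P z ⇔ (∃ λ c → z ≡ linComb B c)) ×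
  (∀ c → linComb B c ≡ 𝟎 → c ≡ replicate _ false)

HasDim : ∀ {m} → (Word m → Set) → ℕ → Set
HasDim {m} P d = Σ (Vec (Word m) d) λ B → IsBasis P B

IsZeroHeadMatrix : (n : ℕ) → Code (4 * n) → (Fin (4 * n) → Word (4 * n)) → Set
IsZeroHeadMatrix n C H =
  (∀ i j → H i ≡ H j → i ≡ j) ×
  (∀ x → (C x × (∀ k → toℕ k ≡ 0 → lookup x k ≡ false)) ⇔ (∃ λ i → x ≡ H i))

column : ∀ {N} → (Fin N → Word N) → Fin N → Word N
column H j = tabulate (λ i → lookup (H i) j)

TransposeCode : ∀ {N} → (Fin N → Word N) → Code N
TransposeCode H y = (∃ λ j → y ≡ column H j) ⊎ (∃ λ j → y ≡ compl (column H j))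

{-# OPTIONS --safe #-}

-- Write f(x) for the first bit of a codeword x.  Since x·y = x + π_x(y), the bit of y at the coordinate π_x⁻¹(1)
-- is f(xy) + f(x), and fullness makes these coordinates exhaust all of them.  Hence C is, up to adding f, the set of
-- right translates of f on the group (C,·), and the transpose code is the set of its left translates.  On the
-- dicyclic group f is a pair of sequences p(i) = f(aⁱ), r(i) = f(aⁱb) changing sign under i ↦ i + 2n, and the
-- Hadamard property says that the autocorrelations of p and r at every shift not divisible by 2n cancel.
--
-- A two-dimensional kernel is {0, 1, z, 1 + z}, which every π_x preserves, so z is a character plus a constant.
-- If z is a power of a, counting minus signs modulo 2 in the correlation at shift 2 is contradictory.  So z = aᵗb,
-- whence r is p shifted by t plus the alternating sequence, n is even, and p has no autocorrelation at even shifts.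
--
-- Suppose now that some non-constant w preserves the left translates.  The translates reached from f in this way
-- form a group, whose order is a power of 2 as it acts simply transitively on a vector space; either it contains aⁿ
-- or it has order 4, and in both cases the alternating sequence preserves the translates as well.  Then p is a
-- palindrome up to sign, its even subsequence has no autocorrelation at all, and the shifts 1 and 2 of that
-- subsequence give opposite parities for n/2.  This needs n > 2; for n = 1, 2 the code C is linear.
module Submission where

open import Defs
import Algebra.Properties.CommutativeMonoid.Sum as CommutativeMonoidSum
open import Data.Bool.Base using (Bool; true; false; not; _xor_; _∧_)
import Data.Bool.Properties as Boolₚ
open import Data.Bool.Properties using (xor-∧-commutativeRing; xor-same; not-involutive; xor-annihilates-not; xor-comm; xor-assoc; xor-identityʳ; ∧-zeroʳ; not-distribˡ-xor)
open import Data.Empty using (⊥; ⊥-elim)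
open import Data.Fin using (Fin)
open import Data.Fin.Base using (zero; suc; toℕ; fromℕ<; splitAt; _↑ˡ_; _↑ʳ_; punchOut; join)
import Data.Fin.Properties as Finₚ
open import Data.Fin.Permutation using (Permutation; permutation; _⟨$⟩ʳ_; _⟨$⟩ˡ_; inverseˡ; inverseʳ)
import Data.Integer.Base as ℤ
open import Data.Integer.Base using (ℤ; +_; -[1+_]; -_; _+_; _-_)
import Data.Integer.Properties as ℤₚ
open import Data.Integer.DivMod using (_%ℕ_; _/ℕ_; n%ℕd<d; a≡a%ℕn+[a/ℕn]*n)
open import Data.Integer.Divisibility.Signed using (_∣_; divides; _∣?_; ∣⇒∣ᵤ)
open import Data.Integer.Tactic.RingSolver using () renaming (ring to ℤ-ring)
open import Data.Maybe.Base using (just; nothing)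
open import Data.Nat using (ℕ; _*_)
import Data.Nat.Base as ℕ
open import Data.Nat.Base using (zero; suc)
import Data.Nat.Divisibility as ℕ∣
open import Data.Nat.Induction using (<-rec)
import Data.Nat.Properties as ℕₚ
open import Data.Product.Base using (∃; _×_; _,_; proj₁; proj₂)
open import Data.Sum.Base using (_⊎_; inj₁; inj₂; [_,_]′)
open import Data.Unit.Base using (tt)
open import Data.Vec.Base using ([]; _∷_; lookup; tabulate; replicate)
import Data.Vec.Properties as Vecₚ
open import Function.Bundles using (Equivalence; mk⇔; _⇔_)
open import Level using (0ℓ)
open import Relation.Binary.Definitions using (Tri; tri<; tri≈; tri>)
open import Relation.Binary.PropositionalEquality
open import Relation.Nullary using (¬_; yes; no; contradiction)
open import Relation.Nullary.Decidable using (Dec; map′; _×-dec_; _⊎-dec_; _→-dec_; toWitness)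
open import Tactic.RingSolver using (solve-∀)
import Tactic.RingSolver.Core.AlmostCommutativeRing as ACR
open import Algebra.Properties.AbelianGroup ℤₚ.+-0-abelianGroup using () renaming (∙-cancelˡ to +-cancelˡ)

-- The set of left translates is mapped to itself when y is replaced by gy. A word preserving this
-- set (a period) therefore stays a period under shifts and reflections, and sums of shifts
-- manufacture the special periods on which the argument turns. In place of a count of the group of
-- reached translates, a rotation reached from f is shown to be trivial by stripping a multiplier
-- that kills it: an odd factor by an orbit sum, a factor 2 by excluding aⁿ. Two reflections differ
-- by a rotation, so a non-constant period can differ from its shift by 1 only by a constant. The
-- Hadamard property enters mostly modulo 2. The xor of the differences h(i + s) + h(i) telescopes
-- for s = 1 and s = 2, which is why these two shifts keep recurring. The relations of type Q alone
-- would allow a proper quotient of the dicyclic group. That a has order exactly 4n and that b is no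
-- power of a follow from the number 8n of codewords. Sequences live on all of ℤ, so that
-- complementation is the shift by 2n and exponents keep track of signs.

private
  module ℤ-Sum = CommutativeMonoidSum ℤₚ.+-0-commutativeMonoid

  variable
    m : ℕ

-- Arithmetic of bits

Bool-ring : ACR.AlmostCommutativeRing 0ℓ 0ℓ
Bool-ring = ACR.fromCommutativeRing xor-∧-commutativeRing λ where
  false → just refl
  true  → nothing

xor-swap : ∀ x y z → x xor y ≡ z → y ≡ x xor z
xor-swap false y z eq = eq
xor-swap true  y z eq = trans (sym (not-involutive y)) (cong not eq)

true≢false : true ≡ false → ⊥
true≢false ()

not-fixed : ∀ x → x ≡ not x → ⊥
not-fixed false ()
not-fixed true ()

-- Parity of integers

-- Two-sided induction from 0, suited to statements whose step is a cancellable operation: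
-- cancelling it turns the upward step into the downward one.
ℤ-ind : (P : ℤ → Set) → P (+ 0) → (∀ i → P i → P (+ 1 + i)) → (∀ i → P (+ 1 + i) → P i) →
        ∀ i → P i
ℤ-ind P z up down (+ zero)         = z
ℤ-ind P z up down (+ suc n)        = up (+ n) (ℤ-ind P z up down (+ n))
ℤ-ind P z up down -[1+ zero ]      = down -[1+ 0 ] z
ℤ-ind P z up down -[1+ suc n ]     = down -[1+ suc n ] (ℤ-ind P z up down -[1+ n ])

parℕ : ℕ → Bool
parℕ zero    = false
parℕ (suc n) = not (parℕ n)

par : ℤ → Bool
par (+ n)    = parℕ n
par -[1+ n ] = not (parℕ n)

par-suc : ∀ i → par (+ 1 + i) ≡ not (par i)
par-suc (+ n)          = refl
par-suc -[1+ zero ]    = refl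
par-suc -[1+ suc n ]   = sym (not-involutive _)

not-injective : ∀ {x y} → not x ≡ not y → x ≡ y
not-injective {x} {y} eq = trans (sym (not-involutive x)) (trans (cong not eq) (not-involutive y))

par-+ : ∀ i j → par (i + j) ≡ par i xor par j
par-+ i j = ℤ-ind P (cong par (ℤₚ.+-identityˡ j)) up down i
  where
  P : ℤ → Set
  P i = par (i + j) ≡ par i xor par j
  step : ∀ i → par (+ 1 + i + j) ≡ not (par (i + j))
  step i = trans (cong par (ℤₚ.+-assoc (+ 1) i j)) (par-suc (i + j))
  lem : ∀ x y → (true xor x) xor y ≡ true xor (x xor y)
  lem = solve-∀ Bool-ring
  up : ∀ i → P i → P (+ 1 + i)
  up i h = trans (step i) (trans (cong not h)
    (trans (sym (lem (par i) (par j))) (cong (_xor par j) (sym (par-suc i)))))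
  down : ∀ i → P (+ 1 + i) → P i
  down i h = not-injective (trans (sym (step i)) (trans h
    (trans (cong (_xor par j) (par-suc i)) (lem (par i) (par j)))))

par-double : ∀ k → par (k + k) ≡ false
par-double k = trans (par-+ k k) (xor-same (par k))

par-neg : ∀ i → par (- i) ≡ par i
par-neg i = sym (trans (sym (lem (par i) (par (- i)))) (cong (_xor par (- i))
  (trans (sym (par-+ i (- i))) (cong par (ℤₚ.+-inverseʳ i)))))
  where
  lem : ∀ x y → (x xor y) xor y ≡ x
  lem = solve-∀ Bool-ring

par-- : ∀ i j → par (i - j) ≡ par i xor par j
par-- i j = trans (par-+ i (- j)) (cong (par i xor_) (par-neg j))

par-* : ∀ i j → par (i ℤ.* j) ≡ par i ∧ par j
par-* i j = ℤ-ind P (cong par (ℤₚ.*-zeroˡ j)) up down i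
  where
  P : ℤ → Set
  P i = par (i ℤ.* j) ≡ par i ∧ par j
  dist : ∀ i j → (+ 1 + i) ℤ.* j ≡ j + i ℤ.* j
  dist = solve-∀ ℤ-ring
  step : ∀ i → par ((+ 1 + i) ℤ.* j) ≡ par j xor par (i ℤ.* j)
  step i = trans (cong par (dist i j)) (par-+ j (i ℤ.* j))
  lem : ∀ x y → (true xor x) ∧ y ≡ y xor (x ∧ y)
  lem = solve-∀ Bool-ring
  up : ∀ i → P i → P (+ 1 + i)
  up i h = trans (step i) (trans (cong (par j xor_) h)
    (trans (sym (lem (par i) (par j))) (cong (_∧ par j) (sym (par-suc i)))))
  xor-cancel : ∀ x y z → x xor y ≡ x xor z → y ≡ z
  xor-cancel false y z eq = eq
  xor-cancel true  y z eq = not-injective eq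
  down : ∀ i → P (+ 1 + i) → P i
  down i h = xor-cancel (par j) _ _ (trans (sym (step i)) (trans h
    (trans (cong (_∧ par j) (par-suc i)) (lem (par i) (par j)))))

halve : ∀ i → ∃ λ k → i ≡ k + k ⊎ i ≡ + 1 + (k + k)
halve = ℤ-ind (λ i → ∃ λ k → i ≡ k + k ⊎ i ≡ + 1 + (k + k)) (+ 0 , inj₁ refl) up down
  where
  carry : ∀ k → + 1 + (+ 1 + (k + k)) ≡ (+ 1 + k) + (+ 1 + k)
  carry = solve-∀ ℤ-ring
  borrow : ∀ k → k + k ≡ + 1 + (+ 1 + ((k - + 1) + (k - + 1)))
  borrow = solve-∀ ℤ-ring
  up : ∀ i → _ → _
  up i (k , inj₁ eq) = k , inj₂ (cong (_+_ (+ 1)) eq)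
  up i (k , inj₂ eq) = + 1 + k , inj₁ (trans (cong (_+_ (+ 1)) eq) (carry k))
  down : ∀ i → _ → _
  down i (k , inj₁ eq) = k - + 1 , inj₂ (+-cancelˡ (+ 1) i _ (trans eq (borrow k)))
  down i (k , inj₂ eq) = k , inj₁ (+-cancelˡ (+ 1) i _ eq)

even-double : ∀ i → par i ≡ false → ∃ λ k → i ≡ k + k
even-double i ev with halve i
... | k , inj₁ eq = k , eq
... | k , inj₂ eq = ⊥-elim (true≢false (trans (sym (trans (cong par eq)
                      (trans (par-suc (k + k)) (cong not (par-double k))))) ev))

odd-double : ∀ i → par i ≡ true → ∃ λ k → i ≡ + 1 + (k + k)
odd-double i od with halve i
... | k , inj₂ eq = k , eq
... | k , inj₁ eq = ⊥-elim (true≢false (trans (sym od) (trans (cong par eq) (par-double k))))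

double-injective : ∀ i j → i + i ≡ j + j → i ≡ j
double-injective i j eq = ℤₚ.*-cancelˡ-≡ (+ 2) i j (trans (twice i) (trans eq (sym (twice j))))
  where
  twice : ∀ i → + 2 ℤ.* i ≡ i + i
  twice = solve-∀ ℤ-ring

-- Used with M = 2n for `p` and `r`, and with M = 1 to recognise alternating sequences.
Antiperiodic : ℤ → (ℤ → Bool) → Set
Antiperiodic M p = ∀ i → p (i + M) ≡ not (p i)

antiperiodic-* : ∀ {M p} → Antiperiodic M p → ∀ q i → p (i + q ℤ.* M) ≡ par q xor p i
antiperiodic-* {M} {p} anti q = ℤ-ind (λ q → ∀ i → p (i + q ℤ.* M) ≡ par q xor p i)
    (λ i → cong p (zero-lem i M)) up down q
  where
  zero-lem : ∀ i M → i + + 0 ℤ.* M ≡ i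
  zero-lem = solve-∀ ℤ-ring
  dist : ∀ i q M → i + (+ 1 + q) ℤ.* M ≡ (i + q ℤ.* M) + M
  dist = solve-∀ ℤ-ring
  lem : ∀ x y → (true xor x) xor y ≡ true xor (x xor y)
  lem = solve-∀ Bool-ring
  step : ∀ q i → p (i + (+ 1 + q) ℤ.* M) ≡ not (p (i + q ℤ.* M))
  step q i = trans (cong p (dist i q M)) (anti (i + q ℤ.* M))
  up : ∀ q → (∀ i → p (i + q ℤ.* M) ≡ par q xor p i) →
       ∀ i → p (i + (+ 1 + q) ℤ.* M) ≡ par (+ 1 + q) xor p i
  up q h i = trans (step q i) (trans (cong not (h i))
    (trans (sym (lem (par q) (p i))) (cong (_xor p i) (sym (par-suc q)))))
  down : ∀ q → (∀ i → p (i + (+ 1 + q) ℤ.* M) ≡ par (+ 1 + q) xor p i) →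
         ∀ i → p (i + q ℤ.* M) ≡ par q xor p i
  down q h i = not-injective (trans (sym (step q i)) (trans (h i)
    (trans (cong (_xor p i) (par-suc q)) (lem (par q) (p i)))))

-- Sums of signs

S : ℕ → (ℤ → Bool) → ℤ
S zero    g = + 0
S (suc M) g = S M g + sgn (g (+ M))

-- The parity of the number of minus signs in `S`; unlike `S`, it telescopes on differences.
X : ℕ → (ℤ → Bool) → Bool
X zero    g = false
X (suc M) g = X M g xor g (+ M)

S-cong : ∀ {g h} → (∀ i → g i ≡ h i) → ∀ M → S M g ≡ S M h
S-cong eq zero    = refl
S-cong eq (suc M) = cong₂ _+_ (S-cong eq M) (cong sgn (eq (+ M)))

X-cong : ∀ {g h} → (∀ i → g i ≡ h i) → ∀ M → X M g ≡ X M h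
X-cong eq zero    = refl
X-cong eq (suc M) = cong₂ _xor_ (X-cong eq M) (eq (+ M))

S-const : ∀ e M → S M (λ _ → e) ≡ + M ℤ.* sgn e
S-const e zero    = sym (ℤₚ.*-zeroˡ (sgn e))
S-const e (suc M) = trans (cong (_+ sgn e) (S-const e M)) (sym (dist (+ M) (sgn e)))
  where
  dist : ∀ m s → (+ 1 + m) ℤ.* s ≡ m ℤ.* s + s
  dist = solve-∀ ℤ-ring

-- Here c is the number of minus signs: each of them lowers the sum by 2 from its maximum M.
S-count : ∀ g M → ∃ λ c → S M g + (c + c) ≡ + M × X M g ≡ par c
S-count g zero = + 0 , refl , refl
S-count g (suc M) with g (+ M) | S-count g M
... | false | c , eqS , eqX = c , trans (mid (S M g) c) (cong (_+_ (+ 1)) eqS) , trans (lem (X M g)) eqX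
  where
  mid : ∀ s c → (s + + 1) + (c + c) ≡ + 1 + (s + (c + c))
  mid = solve-∀ ℤ-ring
  lem : ∀ x → x xor false ≡ x
  lem = solve-∀ Bool-ring
... | true | c , eqS , eqX = + 1 + c , trans (mid (S M g) c) (cong (_+_ (+ 1)) eqS)
                           , trans (lem (X M g)) (trans (cong not eqX) (sym (par-suc c)))
  where
  mid : ∀ s c → (s + - (+ 1)) + ((+ 1 + c) + (+ 1 + c)) ≡ + 1 + (s + (c + c))
  mid = solve-∀ ℤ-ring
  lem : ∀ x → x xor true ≡ true xor x
  lem = solve-∀ Bool-ring

-- A vanishing sum of 2n signs contains exactly n minus signs, so the parity of n is the xor of the bits.
balanced-parity : ∀ n M M' g h → M ℕ.+ M' ≡ n ℕ.+ n → S M g + S M' h ≡ + 0 →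
                  par (+ n) ≡ X M g xor X M' h
balanced-parity n M M' g h size bal with S-count g M | S-count h M'
... | c , eqS , eqX | d , eqS' , eqX' = trans (cong par (double-injective (+ n) (c + d) (begin
    + n + + n                                   ≡⟨ cong +_ (sym size) ⟩
    + M + + M'                                  ≡⟨ cong₂ _+_ (sym eqS) (sym eqS') ⟩
    (S M g + (c + c)) + (S M' h + (d + d))      ≡⟨ regroup (S M g) (S M' h) c d ⟩
    (S M g + S M' h) + ((c + d) + (c + d))      ≡⟨ cong (_+ ((c + d) + (c + d))) bal ⟩
    + 0 + ((c + d) + (c + d))                   ≡⟨ ℤₚ.+-identityˡ _ ⟩
    (c + d) + (c + d)                           ∎)))
    (trans (par-+ c d) (cong₂ _xor_ (sym eqX) (sym eqX')))
  where
  open ≡-Reasoning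
  regroup : ∀ s t c d → (s + (c + c)) + (t + (d + d)) ≡ (s + t) + ((c + d) + (c + d))
  regroup = solve-∀ ℤ-ring

S-+ : ∀ g m k → S (m ℕ.+ k) g ≡ S m g + S k (λ i → g (+ m + i))
S-+ g m zero = trans (cong (λ l → S l g) (ℕₚ.+-identityʳ m)) (sym (ℤₚ.+-identityʳ _))
S-+ g m (suc k) = trans (cong (λ l → S l g) (ℕₚ.+-suc m k))
  (trans (cong (_+ sgn (g (+ (m ℕ.+ k)))) (S-+ g m k)) (ℤₚ.+-assoc (S m g) _ _))

S-shift : ∀ M g → (∀ i → g (i + + M) ≡ g i) → ∀ l → S M (λ i → g (l + i)) ≡ S M g
S-shift M g per l = ℤ-ind (λ l → S M (λ i → g (l + i)) ≡ S M g)
    (S-cong (λ i → cong g (ℤₚ.+-identityˡ i)) M)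
    (λ l h → trans (step l) h) (λ l h → trans (sym (step l)) h) l
  where
  -- Adding the first term to either side gives the sum over M + 1 consecutive terms, whose last
  -- term repeats the first.
  rot : ∀ h → h (+ M) ≡ h (+ 0) → S M (λ i → h (+ 1 + i)) ≡ S M h
  rot h eq = +-cancelˡ (sgn (h (+ 0))) _ _ (begin
    sgn (h (+ 0)) + S M (λ i → h (+ 1 + i))       ≡⟨ cong (_+ S M (λ i → h (+ 1 + i))) (sym (ℤₚ.+-identityˡ (sgn (h (+ 0))))) ⟩
    S 1 h + S M (λ i → h (+ 1 + i))               ≡⟨ sym (S-+ h 1 M) ⟩
    S M h + sgn (h (+ M))                         ≡⟨ cong (λ x → S M h + sgn x) eq ⟩
    S M h + sgn (h (+ 0))                         ≡⟨ ℤₚ.+-comm (S M h) _ ⟩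
    sgn (h (+ 0)) + S M h                         ∎)
    where open ≡-Reasoning
  assoc : ∀ l i → (+ 1 + l) + i ≡ l + (+ 1 + i)
  assoc = solve-∀ ℤ-ring
  step : ∀ l → S M (λ i → g ((+ 1 + l) + i)) ≡ S M (λ i → g (l + i))
  step l = trans (S-cong (λ i → cong g (assoc l i)) M)
    (rot (λ i → g (l + i)) (trans (per l) (cong g (sym (ℤₚ.+-identityʳ l)))))

S-reverse : ∀ g M → S M (λ i → g (+ M - + 1 - i)) ≡ S M g
S-reverse g zero    = refl
S-reverse g (suc M) = begin
    S (suc M) (λ i → g (+ suc M - + 1 - i))
      ≡⟨ S-+ (λ i → g (+ suc M - + 1 - i)) 1 M ⟩
    (+ 0 + sgn (g (+ suc M - + 1 - + 0))) + S M (λ i → g (+ suc M - + 1 - (+ 1 + i)))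
      ≡⟨ cong₂ _+_ (trans (ℤₚ.+-identityˡ _) (cong (λ x → sgn (g x)) (e₁ (+ M))))
                   (S-cong (λ i → cong g (e₂ (+ M) i)) M) ⟩
    sgn (g (+ M)) + S M (λ i → g (+ M - + 1 - i))
      ≡⟨ cong (_+_ (sgn (g (+ M)))) (S-reverse g M) ⟩
    sgn (g (+ M)) + S M g
      ≡⟨ ℤₚ.+-comm _ (S M g) ⟩
    S M g + sgn (g (+ M)) ∎
  where
  open ≡-Reasoning
  e₁ : ∀ m → (+ 1 + m) - + 1 - + 0 ≡ m
  e₁ = solve-∀ ℤ-ring
  e₂ : ∀ m i → (+ 1 + m) - + 1 - (+ 1 + i) ≡ m - + 1 - i
  e₂ = solve-∀ ℤ-ring

S-reflect : ∀ M g → (∀ i → g (i + + M) ≡ g i) → ∀ l → S M (λ i → g (l - i)) ≡ S M g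
S-reflect M g per l = trans (S-cong (λ i → cong g (e l (+ M) i)) M)
  (trans (S-reverse (λ i → g (l - + M + + 1 + i)) M) (S-shift M g per (l - + M + + 1)))
  where
  e : ∀ l m i → l - i ≡ l - m + + 1 + (m - + 1 - i)
  e = solve-∀ ℤ-ring

S-even-odd : ∀ g n → S (n ℕ.+ n) g ≡ S n (λ i → g (i + i)) + S n (λ i → g (+ 1 + (i + i)))
S-even-odd g zero    = refl
S-even-odd g (suc n) = trans (cong (λ l → S (suc l) g) (ℕₚ.+-suc n n))
  (trans (cong (λ s → s + sgn (g (+ (n ℕ.+ n))) + sgn (g (+ suc (n ℕ.+ n)))) (S-even-odd g n))
    (regroup (S n (λ i → g (i + i))) (S n (λ i → g (+ 1 + (i + i)))) _ _))
  where
  regroup : ∀ s t x y → s + t + x + y ≡ (s + x) + (t + y)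
  regroup = solve-∀ ℤ-ring

X-telescope : ∀ (g : ℤ → Bool) n → X n (λ i → g (+ 1 + i) xor g i) ≡ g (+ n) xor g (+ 0)
X-telescope g zero    = sym (xor-same (g (+ 0)))
X-telescope g (suc n) = trans (cong (_xor (g (+ suc n) xor g (+ n))) (X-telescope g n))
  (lem (g (+ n)) (g (+ 0)) (g (+ suc n)))
  where
  lem : ∀ x y z → (x xor y) xor (z xor x) ≡ z xor y
  lem = solve-∀ Bool-ring

-- A difference at distance 2 is the sum of two adjacent differences at distance 1, hence itself a
-- difference at distance 1.
X-telescope₂ : ∀ (g : ℤ → Bool) n → X n (λ i → g (i + + 2) xor g i) ≡
               (g (+ 1 + + n) xor g (+ n)) xor (g (+ 1) xor g (+ 0))
X-telescope₂ g n = trans (X-cong eq n) (X-telescope (λ i → g (+ 1 + i) xor g i) n)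
  where
  e : ∀ i → i + + 2 ≡ + 1 + (+ 1 + i)
  e = solve-∀ ℤ-ring
  lem : ∀ x y z → x xor z ≡ (x xor y) xor (y xor z)
  lem = solve-∀ Bool-ring
  eq : ∀ i → g (i + + 2) xor g i ≡ (g (+ 1 + (+ 1 + i)) xor g (+ 1 + i)) xor (g (+ 1 + i) xor g i)
  eq i = trans (cong (λ k → g k xor g i) (e i)) (lem (g (+ 1 + (+ 1 + i))) (g (+ 1 + i)) (g i))

X-xor : ∀ (g h : ℤ → Bool) M → X M (λ i → g i xor h i) ≡ X M g xor X M h
X-xor g h zero    = refl
X-xor g h (suc M) = trans (cong (_xor (g (+ M) xor h (+ M))) (X-xor g h M))
  (lem (X M g) (X M h) (g (+ M)) (h (+ M)))
  where
  lem : ∀ a b c d → (a xor b) xor (c xor d) ≡ (a xor c) xor (b xor d)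
  lem = solve-∀ Bool-ring

X-const : ∀ e M → X M (λ _ → e) ≡ par (+ M) ∧ e
X-const e zero    = refl
X-const e (suc M) = trans (cong (_xor e) (X-const e M)) (lem (parℕ M) e)
  where
  lem : ∀ x y → (x ∧ y) xor y ≡ (true xor x) ∧ y
  lem = solve-∀ Bool-ring

-- Antiperiodic sequences with cancelling autocorrelations

xor-chain : ∀ {a b c x y} → a xor b ≡ x → b xor c ≡ y → a ≡ (x xor y) xor c
xor-chain {a} {b} {c} refl refl = lem a b c
  where
  lem : ∀ a b c → a ≡ ((a xor b) xor (b xor c)) xor c
  lem = solve-∀ Bool-ring

halveℕ : ∀ o → ∃ λ k → o ≡ k ℕ.+ k ⊎ o ≡ suc (k ℕ.+ k)
halveℕ zero    = zero , inj₁ refl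
halveℕ (suc o) = step (halveℕ o)
  where
  step : (∃ λ k → o ≡ k ℕ.+ k ⊎ o ≡ suc (k ℕ.+ k)) → ∃ λ k → suc o ≡ k ℕ.+ k ⊎ suc o ≡ suc (k ℕ.+ k)
  step (k , inj₁ eq) = k , inj₂ (cong suc eq)
  step (k , inj₂ eq) = suc k , inj₁ (cong suc (trans eq (sym (ℕₚ.+-suc k k))))

sgn≢0 : ∀ e → sgn e ≡ + 0 → ⊥
sgn≢0 false ()
sgn≢0 true ()

module Bent (n : ℕ) (1≤n : 1 ℕ.≤ n) (p r : ℤ → Bool)
  (anti-p : Antiperiodic (+ n + + n) p) (anti-r : Antiperiodic (+ n + + n) r)
  (bent : ∀ t → ¬ (+ n + + n) ∣ t →
    S (n ℕ.+ n) (λ i → p (i + t) xor p i) + S (n ℕ.+ n) (λ i → r (i - t) xor r i) ≡ + 0)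
  where

  M : ℤ
  M = + n + + n

  small∤ : ∀ s → 0 ℕ.< s → s ℕ.< n ℕ.+ n → ¬ M ∣ + s
  small∤ (suc s) _ s<2n d = ℕ∣.>⇒∤ s<2n (∣⇒∣ᵤ d)

  -- Otherwise all 4n terms of the correlation at shift t carry the same sign and cannot cancel.
  translation⇒∣ : ∀ t e → (∀ i → p (i + t) ≡ e xor p i) → (∀ i → r (i - t) ≡ e xor r i) → M ∣ t
  translation⇒∣ t e hp hr with M ∣? t
  ... | yes d = d
  ... | no ∤ = ⊥-elim (absurd (ℤₚ.i*j≡0⇒i≡0∨j≡0 M (double-injective (M ℤ.* sgn e) (+ 0) (begin
      M ℤ.* sgn e + M ℤ.* sgn e
        ≡⟨ sym (cong₂ _+_ (S-const e (n ℕ.+ n)) (S-const e (n ℕ.+ n))) ⟩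
      S (n ℕ.+ n) (λ _ → e) + S (n ℕ.+ n) (λ _ → e)
        ≡⟨ sym (cong₂ _+_ (S-cong (λ i → diff (hp i)) (n ℕ.+ n)) (S-cong (λ i → diff (hr i)) (n ℕ.+ n))) ⟩
      S (n ℕ.+ n) (λ i → p (i + t) xor p i) + S (n ℕ.+ n) (λ i → r (i - t) xor r i)
        ≡⟨ bent t ∤ ⟩
      + 0 ∎))))
    where
    open ≡-Reasoning
    lem : ∀ x y → (x xor y) xor y ≡ x
    lem = solve-∀ Bool-ring
    diff : ∀ {x y} → x ≡ e xor y → x xor y ≡ e
    diff {x} {y} eq = trans (cong (_xor y) eq) (lem e y)
    absurd : M ≡ + 0 ⊎ sgn e ≡ + 0 → ⊥
    absurd (inj₁ eq) = ℕₚ.<⇒≢ 1≤n (sym (ℕₚ.m+n≡0⇒m≡0 n (ℤₚ.+-injective eq)))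
    absurd (inj₂ eq) = sgn≢0 e eq

  shift-neg : ∀ (h : ℤ → Bool) t e → (∀ i → h (i + t) ≡ e xor h i) → ∀ i → h (i - t) ≡ e xor h i
  shift-neg h t e hh i = xor-swap e (h (i - t)) (h i) (trans (sym (hh (i - t))) (cong h (back i t)))
    where
    back : ∀ i t → i - t + t ≡ i
    back = solve-∀ ℤ-ring

  common-translation⇒∣ : ∀ t e → (∀ i → p (i + t) ≡ e xor p i) → (∀ i → r (i + t) ≡ e xor r i) → M ∣ t
  common-translation⇒∣ t e hp hr = translation⇒∣ t e hp (shift-neg r t e hr)

  quotient-parity : ∀ (h : ℤ → Bool) → Antiperiodic M h → ∀ q e → (∀ i → h (i + q ℤ.* M) ≡ e xor h i) → par q ≡ e
  quotient-parity h anti q e hh = cancel (h (+ 0)) (trans (sym (antiperiodic-* {M} {h} anti q (+ 0))) (hh (+ 0)))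
    where
    lem : ∀ y x → y ≡ (y xor x) xor x
    lem = solve-∀ Bool-ring
    cancel : ∀ x {y z} → y xor x ≡ z xor x → y ≡ z
    cancel x {y} {z} eq = trans (lem y x) (trans (cong (_xor x) eq) (sym (lem z x)))

  -- An odd multiple of `M` would flip the signs, so the quotient is even and t is a multiple of the
  -- order 4n of a.
  common-period⇒∣ : ∀ t → (∀ i → p (i + t) ≡ p i) → (∀ i → r (i + t) ≡ r i) → ∃ λ k → t ≡ k ℤ.* M + k ℤ.* M
  common-period⇒∣ t hp hr = go (common-translation⇒∣ t false hp hr)
    where
    go : M ∣ t → ∃ λ k → t ≡ k ℤ.* M + k ℤ.* M
    go (divides q t≡) = proj₁ half , trans t≡ (trans (cong (ℤ._* M) (proj₂ half)) (ℤₚ.*-distribʳ-+ M (proj₁ half) (proj₁ half)))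
      where
      half : ∃ λ k → q ≡ k + k
      half = even-double q (quotient-parity p anti-p q false (λ i → trans (cong (λ l → p (i + l)) (sym t≡)) (hp i)))

  -- Two applications add c twice, and the alternating terms at i and i + t differ by `α ∧ par t`
  -- only.
  doubled : ∀ (h : ℤ → Bool) t c α → (∀ i → h (i + t) xor h i ≡ c xor (α ∧ par i)) →
            ∀ i → h (i + (t + t)) ≡ (α ∧ par t) xor h i
  doubled h t c α hh i = trans (cong h (sym (ℤₚ.+-assoc i t t)))
    (trans (xor-chain (hh (i + t)) (hh i))
      (cong (_xor h i) (trans (cong (λ x → (c xor (α ∧ x)) xor (c xor (α ∧ par i))) (par-+ i t))
        (lem c α (par i) (par t)))))
    where
    lem : ∀ c α x y → (c xor (α ∧ (x xor y))) xor (c xor (α ∧ x)) ≡ α ∧ y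
    lem = solve-∀ Bool-ring

  half-shift : ∀ (h : ℤ → Bool) → Antiperiodic M h → ∀ c k →
               (∀ i → h (i + (+ n + k ℤ.* M)) xor h i ≡ c xor par i) →
               ∀ i → h (i + + n) xor h i ≡ (par k xor c) xor par i
  half-shift h anti c k hh i = trans (lem (par k) (h (i + + n)) (h i))
    (trans (cong (λ x → par k xor (x xor h i)) (sym (trans (cong h (sym (ℤₚ.+-assoc i (+ n) (k ℤ.* M)))) (antiperiodic-* {M} {h} anti k (i + + n)))))
      (trans (cong (par k xor_) (hh i)) (assoc (par k) c (par i))))
    where
    lem : ∀ e x y → x xor y ≡ e xor ((e xor x) xor y)
    lem = solve-∀ Bool-ring
    assoc : ∀ e c x → e xor (c xor x) ≡ (e xor c) xor x
    assoc = solve-∀ Bool-ring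

  -- A non-constant kernel word of the code, as a condition on the two sequences

  module _ (1<n : 1 ℕ.< n) where

    ∤2 : ¬ M ∣ + 2
    ∤2 = small∤ 2 (ℕ.s≤s ℕ.z≤n) (ℕₚ.+-mono-≤ 1<n 1≤n)

    ∤1 : ¬ M ∣ + 1
    ∤1 = small∤ 1 (ℕ.s≤s ℕ.z≤n) (ℕₚ.+-mono-≤ 1≤n 1≤n)

    -- The defect `c xor par i` has period 2, so it cancels in the difference g at distance 2, which
    -- thereby gets period n. Its xor over one period telescopes to the change of the defect between
    -- 0 and 1.
    half-shift-sum : ∀ (h : ℤ → Bool) c → (∀ i → h (i + + n) xor h i ≡ c xor par i) →
      let g = λ i → h (i + + 2) xor h i in S (n ℕ.+ n) g ≡ S n g + S n g × X n g ≡ true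
    half-shift-sum h c hh = trans (S-+ g n n) (cong (_+_ (S n g)) (S-cong per n)) , (begin
        X n g                                                    ≡⟨ X-telescope₂ h n ⟩
        (h (+ 1 + + n) xor h (+ n)) xor (h (+ 1) xor h (+ 0))    ≡⟨ mid (h (+ 1 + + n)) (h (+ n)) (h (+ 1)) (h (+ 0)) ⟩
        (h (+ 1 + + n) xor h (+ 1)) xor (h (+ n) xor h (+ 0))
          ≡⟨ cong₂ _xor_ (hh (+ 1)) (hh (+ 0)) ⟩
        (c xor true) xor (c xor false)                           ≡⟨ fin c ⟩
        true                                                     ∎)
      where
      open ≡-Reasoning
      g : ℤ → Bool
      g i = h (i + + 2) xor h i
      mid : ∀ a b c d → (a xor b) xor (c xor d) ≡ (a xor c) xor (b xor d)
      mid = solve-∀ Bool-ring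
      fin : ∀ c → (c xor true) xor (c xor false) ≡ true
      fin = solve-∀ Bool-ring
      swap : ∀ m i → m + i + + 2 ≡ i + + 2 + m
      swap = solve-∀ ℤ-ring
      lem : ∀ a b c d → a xor b ≡ ((a xor c) xor (b xor d)) xor (c xor d)
      lem = solve-∀ Bool-ring
      fin₂ : ∀ c x → (c xor x) xor (c xor x) ≡ false
      fin₂ = solve-∀ Bool-ring
      parity₂ : ∀ i → par (i + + 2) ≡ par i
      parity₂ i = trans (par-+ i (+ 2)) (id-lem (par i))
        where
        id-lem : ∀ x → x xor false ≡ x
        id-lem = solve-∀ Bool-ring
      per : ∀ i → g (+ n + i) ≡ g i
      per i = trans (cong₂ (λ k l → h k xor h l) (swap (+ n) i) (ℤₚ.+-comm (+ n) i))
        (trans (lem (h (i + + 2 + + n)) (h (i + + n)) (h (i + + 2)) (h i))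
          (cong (_xor g i) (trans (cong₂ _xor_ (trans (hh (i + + 2)) (cong (c xor_) (parity₂ i))) (hh i))
            (fin₂ c (par i)))))

    -- Halving the correlation at shift 2 leaves n + n signs with sum 0, hence n minus signs. Each
    -- half contributes an odd number of them, so n would be even.
    ¬half-shift : par (+ n) ≡ true → ∀ c d → (∀ i → p (i + + n) xor p i ≡ c xor par i) →
                  (∀ i → r (i + + n) xor r i ≡ d xor par i) → ⊥
    -- The correlation pairs i with i - 2 in `r`; moving `r` by 2 puts this pair into the form h(i +
    -- 2), h(i) up to order.
    ¬half-shift odd c d hp hr = go (half-shift-sum p c hp) (half-shift-sum (λ i → r (i - + 2)) d hr₂)
      where
      open ≡-Reasoning
      gp gr : ℤ → Bool
      gp i = p (i + + 2) xor p i
      gr i = r (i + + 2 - + 2) xor r (i - + 2)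
      comm : ∀ i m → i + m - + 2 ≡ i - + 2 + m
      comm = solve-∀ ℤ-ring
      id-lem : ∀ x → x xor false ≡ x
      id-lem = solve-∀ Bool-ring
      hr₂ : ∀ i → r (i + + n - + 2) xor r (i - + 2) ≡ d xor par i
      hr₂ i = trans (cong (λ k → r k xor r (i - + 2)) (comm i (+ n)))
        (trans (hr (i - + 2)) (cong (d xor_) (trans (par-- i (+ 2)) (id-lem (par i)))))
      regroup : ∀ a b → (a + b) + (a + b) ≡ (a + a) + (b + b)
      regroup = solve-∀ ℤ-ring
      cancel : ∀ i → i + + 2 - + 2 ≡ i
      cancel = solve-∀ ℤ-ring
      flip : ∀ i → gr i ≡ r (i - + 2) xor r i
      flip i = trans (cong (λ k → r k xor r (i - + 2)) (cancel i)) (xor-comm (r i) (r (i - + 2)))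
      go : S (n ℕ.+ n) gp ≡ S n gp + S n gp × X n gp ≡ true →
           S (n ℕ.+ n) gr ≡ S n gr + S n gr × X n gr ≡ true → ⊥
      go (Sp , Xp) (Sr , Xr) = true≢false (trans (sym odd)
        (trans (balanced-parity n n n gp gr refl (double-injective (S n gp + S n gr) (+ 0) (begin
            (S n gp + S n gr) + (S n gp + S n gr)        ≡⟨ regroup (S n gp) (S n gr) ⟩
            (S n gp + S n gp) + (S n gr + S n gr)        ≡⟨ sym (cong₂ _+_ Sp Sr) ⟩
            S (n ℕ.+ n) gp + S (n ℕ.+ n) gr
              ≡⟨ cong (_+_ (S (n ℕ.+ n) gp)) (S-cong flip (n ℕ.+ n)) ⟩
            S (n ℕ.+ n) gp + S (n ℕ.+ n) (λ i → r (i - + 2) xor r i)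
              ≡⟨ bent (+ 2) ∤2 ⟩
            + 0 ∎)))
          (cong₂ _xor_ Xp Xr)))

    -- The case of a kernel word aᵗ. Doubling makes 2t a multiple of `M`, so t is an odd multiple of
    -- n. The shift by 2t then flips signs, which only the alternating term can cause: α is 1 and t
    -- is odd, so n is odd and `¬half-shift` applies.
    ¬rotation-kernel : ∀ t c d α → ¬ M ∣ t → (∀ i → p (i + t) xor p i ≡ c xor (α ∧ par i)) →
                       (∀ i → r (i - t) xor r i ≡ d xor (α ∧ par i)) → ⊥
    ¬rotation-kernel t c d α ∤t hp hr = go (translation⇒∣ (t + t) (α ∧ par t) (doubled p t c α hp) doubled-r)
      where
      neg : ∀ i t → i - (t + t) ≡ i + (- t + - t)
      neg = solve-∀ ℤ-ring
      doubled-r : ∀ i → r (i - (t + t)) ≡ (α ∧ par t) xor r i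
      doubled-r i = trans (cong r (neg i t)) (trans (doubled r (- t) d α hr i)
        (cong (λ x → (α ∧ x) xor r i) (par-neg t)))
      dist : ∀ q m → q ℤ.* (m + m) ≡ q ℤ.* m + q ℤ.* m
      dist = solve-∀ ℤ-ring
      half : ∀ k m → (k + k) ℤ.* m ≡ k ℤ.* (m + m)
      half = solve-∀ ℤ-ring
      pos : ∀ k m → (+ 1 + (k + k)) ℤ.* m ≡ m + k ℤ.* (m + m)
      pos = solve-∀ ℤ-ring
      negl : ∀ k m → - ((+ 1 + (k + k)) ℤ.* m) ≡ m + (- (+ 1) - k) ℤ.* (m + m)
      negl = solve-∀ ℤ-ring
      ∧-trueˡ : ∀ x y → x ∧ y ≡ true → x ≡ true
      ∧-trueˡ true y _ = refl
      ∧-trueʳ : ∀ x y → x ∧ y ≡ true → y ≡ true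
      ∧-trueʳ true y e = e
      go : M ∣ t + t → ⊥
      go (divides q eq) = by-parity (par q) refl
        where
        t≡ : t ≡ q ℤ.* + n
        t≡ = double-injective t (q ℤ.* + n) (trans eq (dist q (+ n)))
        even-case : (∃ λ k → q ≡ k + k) → ⊥
        even-case (k , q≡) = ∤t (divides k (trans t≡ (trans (cong (ℤ._* + n) q≡) (half k (+ n)))))
        odd-case : par q ≡ true → (∃ λ k → q ≡ + 1 + (k + k)) → ⊥
        odd-case od (k , q≡) = ¬half-shift (∧-trueʳ (par q) (par (+ n)) n-odd) (par k xor c) (par (- (+ 1) - k) xor d)
            (half-shift p anti-p c k λ i →
              trans (cong (λ l → p (i + l) xor p i) (sym (trans t≡′ (pos k (+ n))))) (trans (hp i) (α-one i c)))
            (half-shift r anti-r d (- (+ 1) - k) λ i →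
              trans (cong (λ l → r (i + l) xor r i) (sym (trans (cong -_ t≡′) (negl k (+ n))))) (trans (hr i) (α-one i d)))
          where
          t≡′ : t ≡ (+ 1 + (k + k)) ℤ.* + n
          t≡′ = trans t≡ (cong (ℤ._* + n) q≡)
          αt : α ∧ par t ≡ true
          αt = trans (sym (quotient-parity p anti-p q (α ∧ par t) λ i →
            trans (cong (λ l → p (i + l)) (sym eq)) (doubled p t c α hp i))) od
          n-odd : par q ∧ par (+ n) ≡ true
          n-odd = trans (sym (trans (cong par t≡) (par-* q (+ n)))) (∧-trueʳ α (par t) αt)
          α-one : ∀ i c → c xor (α ∧ par i) ≡ c xor par i
          α-one i c = cong (λ x → c xor (x ∧ par i)) (∧-trueˡ α (par t) αt)
        by-parity : ∀ b → par q ≡ b → ⊥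
        by-parity false ev = even-case (even-double q ev)
        by-parity true  od = odd-case od (odd-double q od)

    -- The case of a kernel word aᵗb. As `r` is a shift of `p` up to the defect, both halves of the
    -- correlation at shift s agree when `α ∧ par s` is 0, and then each of them vanishes. Shift 2
    -- always qualifies and makes n even; if α were 0, shift 1 would qualify too and make n odd.
    reflection-kernel : ∀ t c α → (∀ i → r (i + t) xor p i ≡ c xor (α ∧ par i)) →
      (∀ i → r i ≡ p (i - t) xor ((c xor par t) xor par i)) × par (+ n) ≡ false ×
      (∀ s → par s ≡ false → ¬ M ∣ s → S (n ℕ.+ n) (λ i → p (i + s) xor p i) ≡ + 0)
    reflection-kernel t c α h = r-formula , n-even
        , λ s ev → autocorrelation s (trans (cong (α ∧_) ev) (∧-zero α))
      where
      ∧-zero : ∀ x → x ∧ false ≡ false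
      ∧-zero false = refl
      ∧-zero true = refl
      id-lem : ∀ x → x xor false ≡ x
      id-lem = solve-∀ Bool-ring
      r-raw : ∀ i → r i ≡ p (i - t) xor (c xor (α ∧ (par i xor par t)))
      r-raw i = trans (cong r (sym (back i t))) (trans (move (r (i - t + t)) (p (i - t)) (h (i - t)))
        (cong (λ x → p (i - t) xor (c xor (α ∧ x))) (par-- i t)))
        where
        back : ∀ i t → i - t + t ≡ i
        back = solve-∀ ℤ-ring
        move : ∀ x y {z} → x xor y ≡ z → x ≡ y xor z
        move x y refl = lem x y
          where
          lem : ∀ x y → x ≡ y xor (x xor y)
          lem = solve-∀ Bool-ring
      autocorrelation : ∀ s → α ∧ par s ≡ false → ¬ M ∣ s →
                        S (n ℕ.+ n) (λ i → p (i + s) xor p i) ≡ + 0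
      autocorrelation s αs ∤s = double-injective _ (+ 0) (trans
          (cong (_+_ (S (n ℕ.+ n) g)) (sym (trans (S-cong r-part (n ℕ.+ n)) (S-shift (n ℕ.+ n) g per (- (s + t))))))
          (bent s ∤s))
        where
        g : ℤ → Bool
        g i = p (i + s) xor p i
        comm : ∀ i s m → i + m + s ≡ i + s + m
        comm = solve-∀ ℤ-ring
        per : ∀ i → g (i + M) ≡ g i
        per i = trans (cong₂ _xor_ (trans (cong p (comm i s M)) (anti-p (i + s))) (anti-p i))
          (xor-annihilates-not (p (i + s)) (p i))
        e₁ : ∀ i s t → i - t ≡ - (s + t) + i + s
        e₁ = solve-∀ ℤ-ring
        e₂ : ∀ i s t → i - s - t ≡ - (s + t) + i
        e₂ = solve-∀ ℤ-ring
        ∧-lem : ∀ α x s t → α ∧ ((x xor s) xor t) ≡ (α ∧ s) xor (α ∧ (x xor t))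
        ∧-lem = solve-∀ Bool-ring
        lem : ∀ a b c z y → (a xor (c xor (z xor y))) xor (b xor (c xor y)) ≡ z xor (b xor a)
        lem = solve-∀ Bool-ring
        -- The shift - (s + t) makes the two arguments i - s - t and i - t of `p` coincide with
        -- those of g; the order in which they appear is immaterial for xor.
        r-part : ∀ i → r (i - s) xor r i ≡ g (- (s + t) + i)
        r-part i = trans (cong₂ _xor_
            (trans (r-raw (i - s)) (cong (λ x → p (i - s - t) xor (c xor x))
              (trans (cong (λ x → α ∧ (x xor par t)) (par-- i s)) (∧-lem α (par i) (par s) (par t))))) (r-raw i))
          (trans (lem (p (i - s - t)) (p (i - t)) c (α ∧ par s) (α ∧ (par i xor par t)))
            (trans (cong (_xor (p (i - t) xor p (i - s - t))) αs)
              (cong₂ (λ k l → p k xor p l) (e₁ i s t) (e₂ i s t))))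
      parity : ∀ s → α ∧ par s ≡ false → ¬ M ∣ s → par (+ n) ≡ X (n ℕ.+ n) (λ i → p (i + s) xor p i)
      parity s αs ∤s = trans
        (balanced-parity n (n ℕ.+ n) 0 _ (λ _ → false) (ℕₚ.+-identityʳ _)
          (trans (ℤₚ.+-identityʳ _) (autocorrelation s αs ∤s)))
        (id-lem _)
      n-even : par (+ n) ≡ false
      n-even = trans (parity (+ 2) (∧-zero α) ∤2) (trans (X-telescope₂ p (n ℕ.+ n))
        (trans (cong (_xor (p (+ 1) xor p (+ 0)))
            (trans (cong₂ _xor_ (anti-p (+ 1)) (anti-p (+ 0))) (xor-annihilates-not (p (+ 1)) (p (+ 0)))))
          (xor-same (p (+ 1) xor p (+ 0)))))
      α-true : α ≡ true
      α-true = go α refl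
        where
        go : ∀ a → α ≡ a → α ≡ true
        go true  eq = eq
        go false eq = ⊥-elim (true≢false (trans (sym (trans
          (X-cong (λ i → cong (λ k → p k xor p i) (ℤₚ.+-comm i (+ 1))) (n ℕ.+ n))
          (trans (X-telescope p (n ℕ.+ n)) (trans (cong (_xor p (+ 0)) (anti-p (+ 0))) (lem (p (+ 0)))))))
            (trans (sym (parity (+ 1) (cong (_∧ true) eq) ∤1)) n-even)))
          where
          lem : ∀ x → (true xor x) xor x ≡ true
          lem = solve-∀ Bool-ring
      r-formula : ∀ i → r i ≡ p (i - t) xor ((c xor par t) xor par i)
      r-formula i = trans (r-raw i) (cong (p (i - t) xor_)
        (trans (cong (λ a → c xor (a ∧ (par i xor par t))) α-true) (lem c (par i) (par t))))
        where
        lem : ∀ c x y → c xor (x xor y) ≡ (c xor y) xor x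
        lem = solve-∀ Bool-ring

  -- Left translates and the periods preserving them

  -- The pair (q , q') lists the values at aⁱ and aⁱb of a left translate of f, by aʲ or by aʲb respectively.
  data Translate (q q' : ℤ → Bool) : Set where
    rotation   : ∀ j → (∀ i → q i ≡ p (i + j)) → (∀ i → q' i ≡ r (i + j)) → Translate q q'
    reflection : ∀ j → (∀ i → q i ≡ r (j - i)) → (∀ i → q' i ≡ not (p (j - i))) → Translate q q'

  -- A kernel word of the transpose code, read at aⁱ and aⁱb. One implication suffices, since adding
  -- a word twice returns to the start.
  Period : (w w' : ℤ → Bool) → Set
  Period w w' = ∀ q q' → Translate q q' → Translate (λ i → q i xor w i) (λ i → q' i xor w' i)

  translate-resp : ∀ {q q' s s'} → (∀ i → q i ≡ s i) → (∀ i → q' i ≡ s' i) → Translate q q' → Translate s s'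
  translate-resp e e' (rotation j h h')   = rotation j (λ i → trans (sym (e i)) (h i)) (λ i → trans (sym (e' i)) (h' i))
  translate-resp e e' (reflection j h h') = reflection j (λ i → trans (sym (e i)) (h i)) (λ i → trans (sym (e' i)) (h' i))

  period-resp : ∀ {w w' v v'} → (∀ i → w i ≡ v i) → (∀ i → w' i ≡ v' i) → Period w w' → Period v v'
  period-resp e e' V q q' T = translate-resp (λ i → cong (q i xor_) (e i)) (λ i → cong (q' i xor_) (e' i)) (V q q' T)

  translate-base : Translate p r
  translate-base = rotation (+ 0) (λ i → cong p (sym (ℤₚ.+-identityʳ i))) (λ i → cong r (sym (ℤₚ.+-identityʳ i)))

  period-0 : Period (λ _ → false) (λ _ → false)
  period-0 q q' = translate-resp (λ i → id-lem (q i)) (λ i → id-lem (q' i))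
    where
    id-lem : ∀ x → x ≡ x xor false
    id-lem = solve-∀ Bool-ring

  period-1 : Period (λ _ → true) (λ _ → true)
  period-1 q q' (rotation j h h') = rotation (j + M)
      (λ i → trans (flip (h i)) (sym (trans (cong p (assoc i j M)) (anti-p (i + j)))))
      (λ i → trans (flip (h' i)) (sym (trans (cong r (assoc i j M)) (anti-r (i + j)))))
    where
    lem : ∀ x → x xor true ≡ true xor x
    lem = solve-∀ Bool-ring
    flip : ∀ {x y} → x ≡ y → x xor true ≡ not y
    flip {x} refl = lem x
    assoc : ∀ i j m → i + (j + m) ≡ i + j + m
    assoc = solve-∀ ℤ-ring
  period-1 q q' (reflection j h h') = reflection (j + M)
      (λ i → trans (flip (h i)) (sym (trans (cong r (assoc i j M)) (anti-r (j - i)))))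
      (λ i → trans (flip (h' i)) (cong not (sym (trans (cong p (assoc i j M)) (anti-p (j - i))))))
    where
    lem : ∀ x → x xor true ≡ true xor x
    lem = solve-∀ Bool-ring
    flip : ∀ {x y} → x ≡ y → x xor true ≡ not y
    flip {x} refl = lem x
    assoc : ∀ i j m → j + m - i ≡ j - i + m
    assoc = solve-∀ ℤ-ring

  period-const : ∀ e → Period (λ _ → e) (λ _ → e)
  period-const false = period-0
  period-const true  = period-1

  period-xor : ∀ {w w' v v'} → Period w w' → Period v v' → Period (λ i → w i xor v i) (λ i → w' i xor v' i)
  period-xor {w} {w'} {v} {v'} V V' q q' T =
    translate-resp (λ i → xor-assoc (q i) (w i) (v i)) (λ i → xor-assoc (q' i) (w' i) (v' i)) (V' _ _ (V _ _ T))

  -- Replaces y by aˡy: a left translate of a left translate is again one.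
  translate-shift : ∀ {q q'} l → Translate q q' → Translate (λ i → q (i + l)) (λ i → q' (i + l))
  translate-shift l (rotation j h h') = rotation (l + j)
      (λ i → trans (h (i + l)) (cong p (ℤₚ.+-assoc i l j))) (λ i → trans (h' (i + l)) (cong r (ℤₚ.+-assoc i l j)))
  translate-shift l (reflection j h h') = reflection (j - l)
      (λ i → trans (h (i + l)) (cong r (e i j l))) (λ i → trans (h' (i + l)) (cong (λ k → not (p k)) (e i j l)))
    where
    e : ∀ i j l → j - (i + l) ≡ j - l - i
    e = solve-∀ ℤ-ring

  -- Replaces y by (aˡb)y. Since (aˡb)(aⁱb) is a^(l - i + 2n), the second component changes sign.
  translate-reflect : ∀ {q q'} l → Translate q q' → Translate (λ i → q' (l - i)) (λ i → not (q (l - i)))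
  translate-reflect l (rotation j h h') = reflection (l + j)
      (λ i → trans (h' (l - i)) (cong r (e i j l))) (λ i → cong not (trans (h (l - i)) (cong p (e i j l))))
    where
    e : ∀ i j l → l - i + j ≡ l + j - i
    e = solve-∀ ℤ-ring
  translate-reflect l (reflection j h h') = rotation (j - l + M)
      (λ i → trans (h' (l - i)) (sym (trans (cong p (e i j l M)) (anti-p (j - (l - i))))))
      (λ i → trans (cong not (h (l - i))) (sym (trans (cong r (e i j l M)) (anti-r (j - (l - i))))))
    where
    e : ∀ i j l m → i + (j - l + m) ≡ j - (l - i) + m
    e = solve-∀ ℤ-ring

  period-shift : ∀ {w w'} l → Period w w' → Period (λ i → w (i + l)) (λ i → w' (i + l))
  period-shift {w} {w'} l V q q' T = translate-resp
      (λ i → cong (λ k → q k xor w (i + l)) (e i l)) (λ i → cong (λ k → q' k xor w' (i + l)) (e i l))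
      (translate-shift l (V _ _ (translate-shift (- l) T)))
    where
    e : ∀ i l → i + l - l ≡ i
    e = solve-∀ ℤ-ring

  -- Conjugation of the period by aˡb. The square of aˡb is complementation, so a complement is left
  -- over, which `period-1` removes.
  period-reflect : ∀ {w w'} l → Period w w' → Period (λ i → w' (l - i)) (λ i → w (l - i))
  period-reflect {w} {w'} l V q q' T = translate-resp
      (λ i → trans (lem (q (l - (l - i))) (w' (l - i))) (cong (λ k → q k xor w' (l - i)) (e i l)))
      (λ i → trans (lem (q' (l - (l - i))) (w (l - i))) (cong (λ k → q' k xor w (l - i)) (e i l)))
      (translate-not (translate-reflect l (V _ _ (translate-reflect l T))))
    where
    e : ∀ i l → l - (l - i) ≡ i
    e = solve-∀ ℤ-ring
    lem : ∀ x y → ((true xor x) xor y) xor true ≡ x xor y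
    lem = solve-∀ Bool-ring
    not-not : ∀ x y → (true xor (x xor y)) xor true ≡ x xor y
    not-not = solve-∀ Bool-ring
    translate-not : Translate (λ i → not (q (l - (l - i))) xor w' (l - i)) (λ i → not (q' (l - (l - i)) xor w (l - i))) →
                    Translate (λ i → (not (q (l - (l - i))) xor w' (l - i)) xor true)
                              (λ i → (not (q' (l - (l - i))) xor w (l - i)) xor true)
    translate-not T' = translate-resp (λ _ → refl)
      (λ i → trans (not-not (q' (l - (l - i))) (w (l - i))) (sym (lem (q' (l - (l - i))) (w (l - i))))) (period-1 _ _ T')

  period-sum : ∀ (W W' : ℤ → ℤ → Bool) → (∀ k → Period (W (+ k)) (W' (+ k))) → ∀ o →
               Period (λ i → X o (λ s → W s i)) (λ i → X o (λ s → W' s i))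
  period-sum W W' V zero    = period-0
  period-sum W W' V (suc o) = period-xor (period-sum W W' V o) (V o)

  -- The exponents of the rotations in the group of translates reached from f. They are closed under
  -- addition because periods may be shifted.
  RotPeriod : ℤ → Set
  RotPeriod j = Period (λ i → p (i + j) xor p i) (λ i → r (i + j) xor r i)

  rotPeriod-+ : ∀ j k → RotPeriod j → RotPeriod k → RotPeriod (j + k)
  rotPeriod-+ j k Vj Vk = period-resp (λ i → eq p i) (λ i → eq r i) (period-xor (period-shift k Vj) Vk)
    where
    comm : ∀ i j k → i + k + j ≡ i + (j + k)
    comm = solve-∀ ℤ-ring
    lem : ∀ x y z → (x xor y) xor (y xor z) ≡ x xor z
    lem = solve-∀ Bool-ring
    eq : ∀ (h : ℤ → Bool) i → (h (i + k + j) xor h (i + k)) xor (h (i + k) xor h i) ≡ h (i + (j + k)) xor h i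
    eq h i = trans (lem (h (i + k + j)) (h (i + k)) (h i)) (cong (λ l → h l xor h i) (comm i j k))

  rotPeriod-* : ∀ j → RotPeriod j → ∀ k → RotPeriod (+ k ℤ.* j)
  rotPeriod-* j V zero    = period-resp (eq p) (eq r) period-0
    where
    zero-lem : ∀ i j → i ≡ i + + 0 ℤ.* j
    zero-lem = solve-∀ ℤ-ring
    eq : ∀ (h : ℤ → Bool) i → false ≡ h (i + + 0 ℤ.* j) xor h i
    eq h i = trans (sym (xor-same (h i))) (cong (λ l → h l xor h i) (zero-lem i j))
  rotPeriod-* j V (suc k) = subst RotPeriod (dist (+ k) j) (rotPeriod-+ j (+ k ℤ.* j) V (rotPeriod-* j V k))
    where
    dist : ∀ k j → j + k ℤ.* j ≡ (+ 1 + k) ℤ.* j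
    dist = solve-∀ ℤ-ring

  Constant : (w w' : ℤ → Bool) → Set
  Constant w w' = ∃ λ e → (∀ i → w i ≡ e) × (∀ i → w' i ≡ e)

  -- Every period is constant

  module _ (2<n : 2 ℕ.< n) (t : ℤ) (c : Bool)
    (r-formula : ∀ i → r i ≡ p (i - t) xor (c xor par i))
    (n-even : par (+ n) ≡ false)
    (autocorrelation : ∀ s → par s ≡ false → ¬ M ∣ s → S (n ℕ.+ n) (λ i → p (i + s) xor p i) ≡ + 0)
    where

    -- The reflection fixes k, so d vanishes there. It sends k + n to k - n, exactly one antiperiod
    -- away, so d would have to be 1 at k + n.
    ¬twisted-palindrome : ∀ k (d : ℤ → Bool) → d k ≡ d (k + + n) → (∀ i → p (k + k - i) ≡ d i xor p i) → ⊥
    ¬twisted-palindrome k d d≡ h = not-fixed (p (k - + n))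
        (trans (cong p (sym (e₂ k (+ n)))) (trans (h (k + + n))
          (trans (cong (_xor p (k + + n)) (trans (sym d≡) dk)) (trans (cong p (e₃ k (+ n))) (anti-p (k - + n))))))
      where
      e₁ : ∀ k → k + k - k ≡ k
      e₁ = solve-∀ ℤ-ring
      e₂ : ∀ k m → k + k - (k + m) ≡ k - m
      e₂ = solve-∀ ℤ-ring
      e₃ : ∀ k m → k + m ≡ k - m + (m + m)
      e₃ = solve-∀ ℤ-ring
      lem : ∀ x y → x ≡ (x xor y) xor y
      lem = solve-∀ Bool-ring
      dk : d k ≡ false
      dk = trans (lem (d k) (p k)) (trans (cong (_xor p k) (trans (sym (h k)) (cong p (e₁ k)))) (xor-same (p k)))

    n-half : ∃ λ m → n ≡ m ℕ.+ m
    n-half = go (halveℕ n)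
      where
      go : (∃ λ m → n ≡ m ℕ.+ m ⊎ n ≡ suc (m ℕ.+ m)) → ∃ λ m → n ≡ m ℕ.+ m
      go (m , inj₁ eq) = m , eq
      go (m , inj₂ eq) = ⊥-elim (true≢false (trans (sym (trans (cong parℕ eq) (cong not (par-double (+ m))))) n-even))

    -- Reflection swaps the even and the odd positions of an odd palindrome, so its even subsequence is itself
    -- perfect; shifts by 1 and 2 then force contradictory parities.
    ¬odd-palindrome : ∀ k e → (∀ i → p (+ 1 + (k + k) - i) ≡ e xor p i) → ⊥
    ¬odd-palindrome k e h = true≢false (trans (sym parity₁) parity₂)
      where
      n/2 = proj₁ n-half
      q : ℤ → Bool
      q i = p (i + i)
      q-anti : ∀ i → q (i + + n) ≡ not (q i)
      q-anti i = trans (cong p (e₁ i (+ n))) (anti-p (i + i))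
        where
        e₁ : ∀ i m → (i + m) + (i + m) ≡ i + i + (m + m)
        e₁ = solve-∀ ℤ-ring
      perfect : ∀ u → ¬ M ∣ (u + u) → S n (λ i → q (i + u) xor q i) ≡ + 0
      perfect u ∤ = double-injective _ (+ 0) (begin
          S n G + S n G                                             ≡⟨ cong (_+_ (S n G)) (sym (S-reflect n G per (k - u))) ⟩
          S n G + S n (λ i → G (k - u - i))                         ≡⟨ cong₂ _+_ (S-cong even-part n) (S-cong odd-part n) ⟩
          S n (λ i → g (i + i)) + S n (λ i → g (+ 1 + (i + i)))     ≡⟨ sym (S-even-odd g n) ⟩
          S (n ℕ.+ n) g                                             ≡⟨ autocorrelation (u + u) (par-double u) ∤ ⟩
          + 0                                                       ∎)
        where
        open ≡-Reasoning
        G g : ℤ → Bool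
        G i = q (i + u) xor q i
        g i = p (i + (u + u)) xor p i
        comm : ∀ i u m → i + m + u ≡ i + u + m
        comm = solve-∀ ℤ-ring
        per : ∀ i → G (i + + n) ≡ G i
        per i = trans (cong₂ _xor_ (trans (cong q (comm i u (+ n))) (q-anti (i + u))) (q-anti i))
          (xor-annihilates-not (q (i + u)) (q i))
        e₁ : ∀ i u → (i + u) + (i + u) ≡ i + i + (u + u)
        e₁ = solve-∀ ℤ-ring
        even-part : ∀ i → G i ≡ g (i + i)
        even-part i = cong (λ l → p l xor q i) (e₁ i u)
        e₂ : ∀ i u k → (k - u - i + u) + (k - u - i + u) ≡ + 1 + (k + k) - (+ 1 + (i + i))
        e₂ = solve-∀ ℤ-ring
        e₃ : ∀ i u k → (k - u - i) + (k - u - i) ≡ + 1 + (k + k) - (+ 1 + (i + i) + (u + u))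
        e₃ = solve-∀ ℤ-ring
        lem : ∀ e x y → (e xor x) xor (e xor y) ≡ y xor x
        lem = solve-∀ Bool-ring
        odd-part : ∀ i → G (k - u - i) ≡ g (+ 1 + (i + i))
        odd-part i = trans (cong₂ (λ a b → p a xor p b) (e₂ i u k) (e₃ i u k))
          (trans (cong₂ _xor_ (h (+ 1 + (i + i))) (h (+ 1 + (i + i) + (u + u))))
            (lem e (p (+ 1 + (i + i))) (p (+ 1 + (i + i) + (u + u)))))
      parity : ∀ u → ¬ M ∣ (u + u) → par (+ n/2) ≡ X n (λ i → q (i + u) xor q i)
      parity u ∤ = trans (balanced-parity n/2 n 0 _ (λ _ → false) (trans (ℕₚ.+-identityʳ n) (proj₂ n-half))
          (trans (ℤₚ.+-identityʳ _) (perfect u ∤))) (xor-identityʳ _)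
      parity₁ : par (+ n/2) ≡ true
      parity₁ = trans (parity (+ 1) (small∤ 2 (ℕ.s≤s ℕ.z≤n) (ℕₚ.+-mono-≤ (ℕₚ.≤-trans (ℕₚ.n≤1+n 2) 2<n) 1≤n)))
        (trans (X-cong (λ i → cong (λ l → q l xor q i) (ℤₚ.+-comm i (+ 1))) n)
          (trans (X-telescope q n) (trans (cong (_xor q (+ 0)) (q-anti (+ 0))) (lem (q (+ 0))))))
        where
        lem : ∀ x → (true xor x) xor x ≡ true
        lem = solve-∀ Bool-ring
      -- Shift 2 of q is shift 4 of `p`, and 4 < 2n is what demands `2<n`.
      parity₂ : par (+ n/2) ≡ false
      parity₂ = trans (parity (+ 2) (small∤ 4 (ℕ.s≤s ℕ.z≤n) (ℕₚ.+-mono-≤ 2<n (ℕₚ.≤-trans (ℕₚ.n≤1+n 2) 2<n))))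
        (trans (X-telescope₂ q n)
          (trans (cong (_xor (q (+ 1) xor q (+ 0)))
              (trans (cong₂ _xor_ (q-anti (+ 1)) (q-anti (+ 0))) (xor-annihilates-not (q (+ 1)) (q (+ 0)))))
            (xor-same (q (+ 1) xor q (+ 0)))))

    ¬palindrome : ∀ l e → (∀ i → p (l - i) ≡ e xor p i) → ⊥
    ¬palindrome l e h = go (halve l)
      where
      go : (∃ λ k → l ≡ k + k ⊎ l ≡ + 1 + (k + k)) → ⊥
      go (k , inj₁ l≡) = ¬twisted-palindrome k (λ _ → e) refl (λ i → trans (cong (λ x → p (x - i)) (sym l≡)) (h i))
      go (k , inj₂ l≡) = ¬odd-palindrome k e (λ i → trans (cong (λ x → p (x - i)) (sym l≡)) (h i))

    reflected : ∀ j i → p (j - t - i) ≡ r (j - i) xor ((c xor par j) xor par i)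
    reflected j i = trans (lem (p (j - t - i)) (c xor par (j - i)))
        (cong₂ _xor_ (sym (trans (r-formula (j - i)) (cong (λ l → p l xor (c xor par (j - i))) (e i j t))))
          (trans (cong (c xor_) (par-- j i)) (sym (xor-assoc c (par j) (par i)))))
      where
      lem : ∀ x y → x ≡ (x xor y) xor y
      lem = solve-∀ Bool-ring
      e : ∀ i j t → j - i - t ≡ j - t - i
      e = solve-∀ ℤ-ring

    -- Adding the alternating word to f reaches a rotation or a reflection. For a rotation by j,
    -- doubling and the evenness of n make j a multiple of `M`, so the alternating difference would
    -- be constant. For a reflection, the alternating terms of w and of `r-formula` cancel, and `p`
    -- becomes a palindrome up to sign.
    ¬alternating : ∀ w w' e e' → (∀ i → w i ≡ e xor par i) → (∀ i → w' i ≡ e' xor par i) → Period w w' → ⊥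
    ¬alternating w w' e e' hw hw' V = go (V p r translate-base)
      where
      rotate : ∀ (h v : ℤ → Bool) d j → (∀ i → v i ≡ d xor par i) → (∀ i → h i xor v i ≡ h (i + j)) →
               ∀ i → h (i + j) xor h i ≡ d xor (true ∧ par i)
      rotate h v d j hv hh i = trans (cong (_xor h i) (sym (hh i))) (trans (lem (h i) (v i)) (hv i))
        where
        lem : ∀ x y → (x xor y) xor x ≡ y
        lem = solve-∀ Bool-ring
      go : Translate (λ i → p i xor w i) (λ i → r i xor w' i) → ⊥
      go (rotation j h h') = case (common-translation⇒∣ (j + j) (par j)
            (doubled p j e true hp) (doubled r j e' true (rotate r w' e' j hw' h')))
        where
        hp : ∀ i → p (i + j) xor p i ≡ e xor (true ∧ par i)
        hp = rotate p w e j hw h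
        case : M ∣ (j + j) → ⊥
        case (divides q eq) = fin (even-double q (trans q≡j j-even))
          where
          dist : ∀ q m → q ℤ.* (m + m) ≡ q ℤ.* m + q ℤ.* m
          dist = solve-∀ ℤ-ring
          half : ∀ k m → (k + k) ℤ.* m ≡ k ℤ.* (m + m)
          half = solve-∀ ℤ-ring
          j≡ : j ≡ q ℤ.* + n
          j≡ = double-injective j (q ℤ.* + n) (trans eq (dist q (+ n)))
          q≡j : par q ≡ par j
          q≡j = quotient-parity p anti-p q (par j) λ i →
            trans (cong (λ l → p (i + l)) (sym eq)) (doubled p j e true hp i)
          j-even : par j ≡ false
          j-even = trans (cong par j≡) (trans (par-* q (+ n)) (trans (cong (par q ∧_) n-even) (∧-zeroʳ (par q))))
          fin : (∃ λ k → q ≡ k + k) → ⊥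
          fin (k , q≡) = not-fixed e (trans (sym (xor-identityʳ e)) (trans (const (+ 0)) (trans (sym (const (+ 1))) (lem e))))
            where
            lem : ∀ x → x xor true ≡ true xor x
            lem = solve-∀ Bool-ring
            lem₂ : ∀ x y → (x xor y) xor y ≡ x
            lem₂ = solve-∀ Bool-ring
            const : ∀ i → e xor par i ≡ par k
            const i = trans (sym (hp i)) (trans (cong (_xor p i)
              (trans (cong (λ l → p (i + l)) (trans j≡ (trans (cong (ℤ._* + n) q≡) (half k (+ n)))))
                (antiperiodic-* {M} {p} anti-p k i))) (lem₂ (par k) (p i)))
      go (reflection j h h') = ¬palindrome (j - t) (e xor (c xor par j)) λ i → trans (reflected j i)
          (trans (cong (_xor ((c xor par j) xor par i)) (trans (sym (h i)) (cong (p i xor_) (hw i))))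
            (lem (p i) e (c xor par j) (par i)))
        where
        lem : ∀ x e d y → (x xor (e xor y)) xor (d xor y) ≡ (e xor d) xor x
        lem = solve-∀ Bool-ring

    -- Excludes the word that is constant on the powers of a and complementary on the other coset. A
    -- rotation by j is doubled first, which removes the two constants; afterwards both equal the
    -- parity of the same quotient. A reflection makes `p` a palindrome with an alternating twist.
    constants-agree : ∀ w w' e e' → (∀ i → w i ≡ e) → (∀ i → w' i ≡ e') → Period w w' → e ≡ e'
    constants-agree w w' e e' hw hw' V = go (V p r translate-base)
      where
      rotate : ∀ (h v : ℤ → Bool) d j → (∀ i → v i ≡ d) → (∀ i → h i xor v i ≡ h (i + j)) → ∀ i → h (i + j) ≡ d xor h i
      rotate h v d j hv hh i = trans (sym (hh i)) (trans (cong (h i xor_) (hv i)) (xor-comm (h i) d))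
      twice : ∀ (h : ℤ → Bool) d j → (∀ i → h (i + j) ≡ d xor h i) → ∀ i → h (i + (j + j)) ≡ h i
      twice h d j hh i = trans (cong h (sym (ℤₚ.+-assoc i j j))) (trans (hh (i + j)) (trans (cong (d xor_) (hh i)) (lem d (h i))))
        where
        lem : ∀ d x → d xor (d xor x) ≡ x
        lem = solve-∀ Bool-ring
      go : Translate (λ i → p i xor w i) (λ i → r i xor w' i) → e ≡ e'
      go (rotation j h h') = fin (common-period⇒∣ (j + j) (twice p e j hp) (twice r e' j hr))
        where
        hp : ∀ i → p (i + j) ≡ e xor p i
        hp = rotate p w e j hw h
        hr : ∀ i → r (i + j) ≡ e' xor r i
        hr = rotate r w' e' j hw' h'
        fin : (∃ λ k → j + j ≡ k ℤ.* M + k ℤ.* M) → e ≡ e'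
        fin (k , eq) = trans (sym (quotient-parity p anti-p k e λ i → trans (cong (λ l → p (i + l)) (sym j≡)) (hp i)))
                             (quotient-parity r anti-r k e' λ i → trans (cong (λ l → r (i + l)) (sym j≡)) (hr i))
          where
          j≡ : j ≡ k ℤ.* M
          j≡ = double-injective j (k ℤ.* M) eq
      go (reflection j h h') = ⊥-elim (fin (even-double l l-even))
        where
        l = j - t
        d : Bool
        d = e xor (c xor par j)
        lem : ∀ x e d y → (x xor e) xor (d xor y) ≡ ((e xor d) xor y) xor x
        lem = solve-∀ Bool-ring
        mirror : ∀ i → p (l - i) ≡ (d xor par i) xor p i
        mirror i = trans (reflected j i)
          (trans (cong (_xor ((c xor par j) xor par i)) (trans (sym (h i)) (cong (p i xor_) (hw i))))
            (lem (p i) e (c xor par j) (par i)))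
        -- Mirroring twice is the identity, so the twists at 0 and at l agree. The centre is thus an
        -- integer k, and the evenness of n gives equal twists at k and k + n.
        l-even : par l ≡ false
        l-even = trans (lem₂ (par l) d (p (+ 0))) (trans (sym twice-mirror) (xor-same (p (+ 0))))
          where
          e₁ : ∀ l → l - (l - + 0) ≡ + 0
          e₁ = solve-∀ ℤ-ring
          e₂ : ∀ l → l - + 0 ≡ l
          e₂ = solve-∀ ℤ-ring
          lem₂ : ∀ x d y → x ≡ ((d xor x) xor ((d xor false) xor y)) xor y
          lem₂ = solve-∀ Bool-ring
          twice-mirror : p (+ 0) xor p (+ 0) ≡ ((d xor par l) xor ((d xor false) xor p (+ 0))) xor p (+ 0)
          twice-mirror = cong (_xor p (+ 0)) (trans (cong p (sym (e₁ l))) (trans (mirror (l - + 0))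
            (cong₂ _xor_ (cong (λ k → d xor par k) (e₂ l)) (mirror (+ 0)))))
        fin : (∃ λ k → l ≡ k + k) → ⊥
        fin (k , l≡) = ¬twisted-palindrome k (λ i → d xor par i)
          (cong (d xor_) (sym (trans (par-+ k (+ n)) (trans (cong (par k xor_) n-even) (xor-identityʳ (par k))))))
          (λ i → trans (cong (λ x → p (x - i)) (sym l≡)) (mirror i))

    -- If a^n were a period, the sum of its n shifts would be an alternating period.
    ¬rotPeriod-n : RotPeriod (+ n) → ⊥
    ¬rotPeriod-n V = ¬alternating (sum p) (sum r) (sum p (+ 0)) (sum r (+ 0)) (form p anti-p) (form r anti-r)
        (period-sum (λ s i → diff p (i + s)) (λ s i → diff r (i + s)) (λ k → period-shift (+ k) V) n)
      where
      diff sum : (ℤ → Bool) → ℤ → Bool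
      diff h i = h (i + + n) xor h i
      sum h i = X n (λ s → diff h (i + s))
      -- Moving the window by 1 changes its sum by `diff h (i + + n) xor diff h i`, that is by h(i +
      -- 2n) + h(i), which is 1.
      step : ∀ h → Antiperiodic M h → Antiperiodic (+ 1) (sum h)
      step h anti i = trans (lem (sum h (i + + 1)) (sum h i)) (cong (_xor sum h i) (begin
          sum h (i + + 1) xor sum h i
            ≡⟨ cong (_xor sum h i) (X-cong (λ s → cong (diff h) (ℤₚ.+-assoc i (+ 1) s)) n) ⟩
          X n (λ s → diff h (i + (+ 1 + s))) xor sum h i
            ≡⟨ sym (X-xor (λ s → diff h (i + (+ 1 + s))) (λ s → diff h (i + s)) n) ⟩
          X n (λ s → diff h (i + (+ 1 + s)) xor diff h (i + s))
            ≡⟨ X-telescope (λ s → diff h (i + s)) n ⟩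
          diff h (i + + n) xor diff h (i + + 0)
            ≡⟨ cong₂ (λ x k → (x xor h (i + + n)) xor diff h k)
                     (trans (cong h (ℤₚ.+-assoc i (+ n) (+ n))) (anti i)) (ℤₚ.+-identityʳ i) ⟩
          ((true xor h i) xor h (i + + n)) xor (h (i + + n) xor h i)
            ≡⟨ lem₂ (h i) (h (i + + n)) ⟩
          true ∎))
        where
        open ≡-Reasoning
        lem : ∀ x y → x ≡ (x xor y) xor y
        lem = solve-∀ Bool-ring
        lem₂ : ∀ x y → ((true xor x) xor y) xor (y xor x) ≡ true
        lem₂ = solve-∀ Bool-ring
      e₁ : ∀ i → i ≡ + 0 + i ℤ.* + 1
      e₁ = solve-∀ ℤ-ring
      form : ∀ h → Antiperiodic M h → ∀ i → sum h i ≡ sum h (+ 0) xor par i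
      form h anti i = trans (cong (sum h) (e₁ i))
        (trans (antiperiodic-* {+ 1} {sum h} (step h anti) i (+ 0)) (xor-comm (par i) (sum h (+ 0))))

    -- For odd o, the sum of the o translates of (p , r) by multiples of 2j is again a translate, fixed by 2j.
    odd-multiple⇒∣ : ∀ o j → par (+ o) ≡ true → RotPeriod j → M ∣ + o ℤ.* j → M ∣ j
    odd-multiple⇒∣ o j o-odd V (divides q eq) = fin (common-period⇒∣ dj (proj₁ periods) (proj₂ periods))
      where
      dj = j + j
      sum : (ℤ → Bool) → ℤ → Bool
      sum h i = X o (λ s → h (i + s ℤ.* dj))
      V-sum : Period (λ i → X o (λ s → p (i + s ℤ.* dj) xor p i)) (λ i → X o (λ s → r (i + s ℤ.* dj) xor r i))
      V-sum = period-sum (λ s i → p (i + s ℤ.* dj) xor p i) (λ s i → r (i + s ℤ.* dj) xor r i)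
        (rotPeriod-* dj (rotPeriod-+ j j V V)) o
      -- As o is odd, the o copies of h(i) add up to a single one, which cancels against the leading
      -- h(i).
      absorb : ∀ (h : ℤ → Bool) i → h i xor X o (λ s → h (i + s ℤ.* dj) xor h i) ≡ sum h i
      absorb h i = trans (cong (h i xor_) (trans (X-xor (λ s → h (i + s ℤ.* dj)) (λ _ → h i) o)
          (cong (sum h i xor_) (trans (X-const (h i) o) (cong (_∧ h i) o-odd))))) (lem (h i) (sum h i))
        where
        lem : ∀ x y → x xor (y xor x) ≡ y
        lem = solve-∀ Bool-ring
      T : Translate (sum p) (sum r)
      T = translate-resp (absorb p) (absorb r) (V-sum p r translate-base)
      -- With steps 2j instead of j, the total displacement is an even multiple of `M`, so the two
      -- ends of the telescope agree.
      invariant : ∀ h → Antiperiodic M h → ∀ i → sum h (i + dj) ≡ sum h i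
      invariant h anti i = trans (lem (sum h (i + dj)) (sum h i)) (cong (_xor sum h i) (begin
          sum h (i + dj) xor sum h i
            ≡⟨ cong (_xor sum h i) (X-cong (λ s → cong h (e₁ i s dj)) o) ⟩
          X o (λ s → h (i + (+ 1 + s) ℤ.* dj)) xor sum h i
            ≡⟨ sym (X-xor (λ s → h (i + (+ 1 + s) ℤ.* dj)) (λ s → h (i + s ℤ.* dj)) o) ⟩
          X o (λ s → h (i + (+ 1 + s) ℤ.* dj) xor h (i + s ℤ.* dj))
            ≡⟨ X-telescope (λ s → h (i + s ℤ.* dj)) o ⟩
          h (i + + o ℤ.* dj) xor h (i + + 0 ℤ.* dj)
            ≡⟨ cong₂ _xor_ (trans (cong (λ l → h (i + l)) o-multiple)
                 (trans (antiperiodic-* {M} {h} anti (q + q) i) (cong (_xor h i) (par-double q)))) (cong h (e₂ i dj)) ⟩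
          h i xor h i
            ≡⟨ xor-same (h i) ⟩
          false ∎))
        where
        open ≡-Reasoning
        lem : ∀ x y → x ≡ (x xor y) xor y
        lem = solve-∀ Bool-ring
        e₁ : ∀ i s d → i + d + s ℤ.* d ≡ i + (+ 1 + s) ℤ.* d
        e₁ = solve-∀ ℤ-ring
        e₂ : ∀ i d → i + + 0 ℤ.* d ≡ i
        e₂ = solve-∀ ℤ-ring
        dist : ∀ o j → o ℤ.* (j + j) ≡ o ℤ.* j + o ℤ.* j
        dist = solve-∀ ℤ-ring
        o-multiple : + o ℤ.* dj ≡ (q + q) ℤ.* M
        o-multiple = trans (dist (+ o) j) (trans (cong₂ _+_ eq eq) (sym (ℤₚ.*-distribʳ-+ M q q)))
      -- The invariance of a translate is carried back to `p` and `r` themselves; a reflection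
      -- interchanges their roles.
      transfer : Translate (sum p) (sum r) → (∀ i → p (i + dj) ≡ p i) × (∀ i → r (i + dj) ≡ r i)
      transfer (rotation l h h') = move p (sum p) h (invariant p anti-p) , move r (sum r) h' (invariant r anti-r)
        where
        e₁ : ∀ i l d → i + d ≡ i - l + d + l
        e₁ = solve-∀ ℤ-ring
        e₂ : ∀ i l → i - l + l ≡ i
        e₂ = solve-∀ ℤ-ring
        move : ∀ (f g : ℤ → Bool) → (∀ i → g i ≡ f (i + l)) → (∀ i → g (i + dj) ≡ g i) → ∀ i → f (i + dj) ≡ f i
        move f g fg per i = trans (cong f (e₁ i l dj)) (trans (sym (fg (i - l + dj)))
          (trans (per (i - l)) (trans (fg (i - l)) (cong f (e₂ i l)))))
      transfer (reflection l h h') =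
          move p (λ i → not (sum r i)) (λ i → trans (cong not (h' i)) (not-involutive _)) (λ i → cong not (invariant r anti-r i))
        , move r (sum p) h (invariant p anti-p)
        where
        e₁ : ∀ i l d → i + d ≡ l - (l - i - d)
        e₁ = solve-∀ ℤ-ring
        e₂ : ∀ i l d → l - i - d + d ≡ l - i
        e₂ = solve-∀ ℤ-ring
        e₃ : ∀ i l → l - (l - i) ≡ i
        e₃ = solve-∀ ℤ-ring
        move : ∀ (f g : ℤ → Bool) → (∀ i → g i ≡ f (l - i)) → (∀ i → g (i + dj) ≡ g i) → ∀ i → f (i + dj) ≡ f i
        move f g fg per i = trans (cong f (e₁ i l dj)) (trans (sym (fg (l - i - dj)))
          (trans (sym (per (l - i - dj))) (trans (cong g (e₂ i l dj)) (trans (fg (l - i)) (cong f (e₃ i l))))))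
      periods : (∀ i → p (i + dj) ≡ p i) × (∀ i → r (i + dj) ≡ r i)
      periods = transfer T
      fin : (∃ λ k → dj ≡ k ℤ.* M + k ℤ.* M) → M ∣ j
      fin (k , e) = divides k (double-injective j (k ℤ.* M) e)

    -- Otherwise j is an odd multiple of n, and up to a constant, which is itself a period, the
    -- rotation reached would be aⁿ.
    rotPeriod-double⇒∣ : ∀ j → RotPeriod j → M ∣ (j + j) → M ∣ j
    rotPeriod-double⇒∣ j V (divides q eq) = go (halve q)
      where
      dist : ∀ q m → q ℤ.* (m + m) ≡ q ℤ.* m + q ℤ.* m
      dist = solve-∀ ℤ-ring
      half : ∀ k m → (k + k) ℤ.* m ≡ k ℤ.* (m + m)
      half = solve-∀ ℤ-ring
      pos : ∀ k m → (+ 1 + (k + k)) ℤ.* m ≡ m + k ℤ.* (m + m)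
      pos = solve-∀ ℤ-ring
      j≡ : j ≡ q ℤ.* + n
      j≡ = double-injective j (q ℤ.* + n) (trans eq (dist q (+ n)))
      go : (∃ λ k → q ≡ k + k ⊎ q ≡ + 1 + (k + k)) → M ∣ j
      go (k , inj₁ q≡) = divides k (trans j≡ (trans (cong (ℤ._* + n) q≡) (half k (+ n))))
      go (k , inj₂ q≡) = ⊥-elim (¬rotPeriod-n (period-resp (adjust p anti-p) (adjust r anti-r) (period-xor V (period-const (par k)))))
        where
        lem : ∀ e x y → ((e xor x) xor y) xor e ≡ x xor y
        lem = solve-∀ Bool-ring
        adjust : ∀ h → Antiperiodic M h → ∀ i → (h (i + j) xor h i) xor par k ≡ h (i + + n) xor h i
        adjust h anti i = trans (cong (λ x → (x xor h i) xor par k)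
            (trans (cong h (trans (cong (_+_ i) (trans j≡ (trans (cong (ℤ._* + n) q≡) (pos k (+ n))))) (sym (ℤₚ.+-assoc i (+ n) (k ℤ.* M)))))
              (antiperiodic-* {M} {h} anti k (i + + n))))
          (lem (par k) (h (i + + n)) (h i))

    -- An even multiplier o is halved while j is doubled; when o is odd, the orbit sum decides.
    multiple⇒∣ : ∀ o → 0 ℕ.< o → ∀ j → RotPeriod j → M ∣ + o ℤ.* j → M ∣ j
    multiple⇒∣ = <-rec _ λ o rec 0<o j V d → go o rec 0<o j V d (halveℕ o)
      where
      dist : ∀ k j → (k + k) ℤ.* j ≡ k ℤ.* (j + j)
      dist = solve-∀ ℤ-ring
      go : ∀ o → (∀ {k} → k ℕ.< o → 0 ℕ.< k → ∀ j → RotPeriod j → M ∣ + k ℤ.* j → M ∣ j) →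
           0 ℕ.< o → ∀ j → RotPeriod j → M ∣ + o ℤ.* j → (∃ λ k → o ≡ k ℕ.+ k ⊎ o ≡ suc (k ℕ.+ k)) → M ∣ j
      go _ rec () j V d (zero , inj₁ refl)
      go _ rec 0<o j V d (suc k , inj₁ refl) = rotPeriod-double⇒∣ j V
        (rec (ℕₚ.m<m+n (suc k) (ℕ.s≤s ℕ.z≤n)) (ℕ.s≤s ℕ.z≤n) (j + j) (rotPeriod-+ j j V V) (subst (M ∣_) (dist (+ suc k) j) d))
      go _ rec 0<o j V d (k , inj₂ refl) = odd-multiple⇒∣ (suc (k ℕ.+ k)) j (cong not (par-double (+ k))) V d

    rotPeriod⇒∣ : ∀ j → RotPeriod j → M ∣ j
    -- The multiplier 2n kills every j modulo `M`.
    rotPeriod⇒∣ j V = multiple⇒∣ (n ℕ.+ n) (ℕₚ.≤-trans 1≤n (ℕₚ.m≤m+n n n)) j V (divides j (ℤₚ.*-comm M j))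

    rotation⇒constant : ∀ w w' j → Period w w' → (∀ i → p i xor w i ≡ p (i + j)) → (∀ i → r i xor w' i ≡ r (i + j)) →
                        Constant w w'
    rotation⇒constant w w' j V h h' = fin (rotPeriod⇒∣ j (period-resp (solved p w h) (solved r w' h') V))
      where
      lem : ∀ x y → y ≡ (x xor y) xor x
      lem = solve-∀ Bool-ring
      lem₂ : ∀ x y → (y xor x) xor x ≡ y
      lem₂ = solve-∀ Bool-ring
      solved : ∀ (f v : ℤ → Bool) → (∀ i → f i xor v i ≡ f (i + j)) → ∀ i → v i ≡ f (i + j) xor f i
      solved f v fv i = trans (lem (f i) (v i)) (cong (_xor f i) (fv i))
      fin : M ∣ j → Constant w w'
      fin (divides q j≡) = par q , value p anti-p w h , value r anti-r w' h'
        where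
        value : ∀ f → Antiperiodic M f → ∀ v → (∀ i → f i xor v i ≡ f (i + j)) → ∀ i → v i ≡ par q
        value f anti v fv i = trans (solved f v fv i) (trans (cong (_xor f i)
          (trans (cong (λ l → f (i + l)) j≡) (antiperiodic-* {M} {f} anti q i))) (lem₂ (f i) (par q)))

    -- The critical case is that w reaches a reflection. Its difference D with its own shift then
    -- decides: a rotation makes D constant, so w is constant or alternating, and a second
    -- reflection composes with the first to a rotation.
    period⇒constant : ∀ w w' → Period w w' → Constant w w'
    period⇒constant w w' V = go (V p r translate-base)
      where
      D : Period (λ i → w (i + + 1) xor w i) (λ i → w' (i + + 1) xor w' i)
      D = period-xor (period-shift (+ 1) V) V
      shift-eq : ∀ (v : ℤ → Bool) e → (∀ i → v (i + + 1) xor v i ≡ e) → ∀ i → v (i + + 1) ≡ e xor v i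
      shift-eq v e h i = trans (lem (v (i + + 1)) (v i)) (cong (_xor v i) (h i))
        where
        lem : ∀ x y → x ≡ (x xor y) xor y
        lem = solve-∀ Bool-ring
      steps : ∀ e → (∀ i → w (i + + 1) xor w i ≡ e) → (∀ i → w' (i + + 1) xor w' i ≡ e) → Constant w w'
      steps false h h' = w (+ 0) , stays w h , λ i → trans (stays w' h' i) (sym agree)
        where
        stays : ∀ v → (∀ i → v (i + + 1) xor v i ≡ false) → ∀ i → v i ≡ v (+ 0)
        stays v hv = ℤ-ind (λ i → v i ≡ v (+ 0)) refl
            (λ i eq → trans (step i) eq) (λ i eq → trans (sym (step i)) eq)
          where
          step : ∀ i → v (+ 1 + i) ≡ v i
          step i = trans (cong v (ℤₚ.+-comm (+ 1) i)) (shift-eq v false hv i)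
        agree : w (+ 0) ≡ w' (+ 0)
        agree = constants-agree w w' (w (+ 0)) (w' (+ 0)) (stays w h) (stays w' h') V
      steps true h h' = ⊥-elim (¬alternating w w' (w (+ 0)) (w' (+ 0)) (form w h) (form w' h') V)
        where
        e₁ : ∀ i → i ≡ + 0 + i ℤ.* + 1
        e₁ = solve-∀ ℤ-ring
        form : ∀ v → (∀ i → v (i + + 1) xor v i ≡ true) → ∀ i → v i ≡ v (+ 0) xor par i
        form v hv i = trans (cong v (e₁ i))
          (trans (antiperiodic-* {+ 1} {v} (shift-eq v true hv) i (+ 0)) (xor-comm (par i) (v (+ 0))))
      go : Translate (λ i → p i xor w i) (λ i → r i xor w' i) → Constant w w'
      go (rotation j h h') = rotation⇒constant w w' j V h h'
      go (reflection j h h') = go₂ (D p r translate-base)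
        where
        go₂ : Translate (λ i → p i xor (w (i + + 1) xor w i)) (λ i → r i xor (w' (i + + 1) xor w' i)) → Constant w w'
        go₂ (rotation k g g') = fin (rotation⇒constant _ _ k D g g')
          where
          fin : Constant (λ i → w (i + + 1) xor w i) (λ i → w' (i + + 1) xor w' i) → Constant w w'
          fin (e , c₁ , c₂) = steps e c₁ c₂
        -- Here the shifted w carries the reflection with index j to the one with index k. Its
        -- mirror image at j therefore carries f to the rotation by k - j, and so is constant.
        go₂ (reflection k g g') = fin (rotation⇒constant (λ i → w' (j - i + + 1)) (λ i → w (j - i + + 1)) (k - j)
            (period-reflect j (period-shift (+ 1) V)) P R)
          where
          e₁ : ∀ i j → j - (j - i) ≡ i
          e₁ = solve-∀ ℤ-ring
          e₂ : ∀ i j k → k - (j - i) ≡ i + (k - j)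
          e₂ = solve-∀ ℤ-ring
          e₃ : ∀ i j → i ≡ j - (j + + 1 - i) + + 1
          e₃ = solve-∀ ℤ-ring
          lemR : ∀ x w y → (x xor y) xor w ≡ x xor (w xor y)
          lemR = solve-∀ Bool-ring
          P : ∀ i → p i xor w' (j - i + + 1) ≡ p (i + (k - j))
          P i = not-injective (begin
            not (p i xor w' (j - i + + 1))
              ≡⟨ not-distribˡ-xor (p i) _ ⟩
            not (p i) xor w' (j - i + + 1)
              ≡⟨ cong (λ l → not (p l) xor w' (j - i + + 1)) (sym (e₁ i j)) ⟩
            not (p (j - (j - i))) xor w' (j - i + + 1)
              ≡⟨ cong (_xor w' (j - i + + 1)) (sym (h' (j - i))) ⟩
            (r (j - i) xor w' (j - i)) xor w' (j - i + + 1)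
              ≡⟨ lemR (r (j - i)) (w' (j - i + + 1)) (w' (j - i)) ⟩
            r (j - i) xor (w' (j - i + + 1) xor w' (j - i))
              ≡⟨ g' (j - i) ⟩
            not (p (k - (j - i)))
              ≡⟨ cong (λ l → not (p l)) (e₂ i j k) ⟩
            not (p (i + (k - j))) ∎)
            where open ≡-Reasoning
          R : ∀ i → r i xor w (j - i + + 1) ≡ r (i + (k - j))
          R i = begin
            r i xor w (j - i + + 1)
              ≡⟨ cong (λ l → r l xor w (j - i + + 1)) (sym (e₁ i j)) ⟩
            r (j - (j - i)) xor w (j - i + + 1)
              ≡⟨ cong (_xor w (j - i + + 1)) (sym (h (j - i))) ⟩
            (p (j - i) xor w (j - i)) xor w (j - i + + 1)
              ≡⟨ lemR (p (j - i)) (w (j - i + + 1)) (w (j - i)) ⟩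
            p (j - i) xor (w (j - i + + 1) xor w (j - i))
              ≡⟨ g (j - i) ⟩
            r (k - (j - i))
              ≡⟨ cong r (e₂ i j k) ⟩
            r (i + (k - j)) ∎
            where open ≡-Reasoning
          fin : Constant (λ i → w' (j - i + + 1)) (λ i → w (j - i + + 1)) → Constant w w'
          fin (e , c₁ , c₂) = e , (λ i → trans (cong w (e₃ i j)) (c₂ (j + + 1 - i)))
                                , (λ i → trans (cong w' (e₃ i j)) (c₁ (j + + 1 - i)))

-- Lengths 4 and 8

-- The bit of aᵗ or aᵗb at the coordinate belonging to aⁱ or aⁱb; the index i − t is taken modulo N to stay in ℕ.
value : ℕ → (ℕ → Bool) → (ℕ → Bool) → Bool → ℕ → Bool → ℕ → Bool
value N p r false t false i = p (i ℕ.+ t) xor p i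
value N p r false t true  i = r (i ℕ.+ (N ℕ.∸ t)) xor r i
value N p r true  t false i = r (i ℕ.+ t) xor p i
value N p r true  t true  i = not (p (i ℕ.+ (N ℕ.∸ t))) xor r i

∀ᵇ? : ∀ {P : Bool → Set} → (∀ x → Dec (P x)) → Dec (∀ x → P x)
∀ᵇ? P? = map′ (λ { (f , t) false → f ; (f , t) true → t }) (λ h → h false , h true) (P? false ×-dec P? true)

∃ᵇ? : ∀ {P : Bool → Set} → (∀ x → Dec (P x)) → Dec (∃ P)
∃ᵇ? P? = map′ (λ { (inj₁ f) → false , f ; (inj₂ t) → true , t }) (λ { (false , h) → inj₁ h ; (true , h) → inj₂ h })
  (P? false ⊎-dec P? true)

-- Meant for N = 4n and K = 2n: codewords need exponents below 4n, but coordinates only exponents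
-- below 2n, as complementary codewords determine the same coordinate.
ShiftClosed : ℕ → ℕ → (ℕ → Bool) → (ℕ → Bool) → Bool → ℕ → Set
ShiftClosed K N p r ε₀ t₀ = ∀ ε (t : Fin N) → ∃ λ ε' → ∃ λ (t' : Fin N) → ∀ δ (i : Fin K) →
  value N p r ε (toℕ t) δ (toℕ i) xor value N p r ε₀ t₀ δ (toℕ i) ≡ value N p r ε' (toℕ t') δ (toℕ i)

shiftClosed? : ∀ K N p r ε₀ t₀ → Dec (ShiftClosed K N p r ε₀ t₀)
shiftClosed? K N p r ε₀ t₀ = ∀ᵇ? λ ε → Finₚ.all? λ t → ∃ᵇ? λ ε' → Finₚ.any? λ t' → ∀ᵇ? λ δ → Finₚ.all? λ i → _ Boolₚ.≟ _

antiext₂ : Bool → Bool → ℕ → Bool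
antiext₂ b₀ b₁ 0 = b₀
antiext₂ b₀ b₁ 1 = b₁
antiext₂ b₀ b₁ (suc (suc k)) = not (antiext₂ b₀ b₁ k)

antiext₄ : Bool → Bool → Bool → Bool → ℕ → Bool
antiext₄ b₀ b₁ b₂ b₃ 0 = b₀
antiext₄ b₀ b₁ b₂ b₃ 1 = b₁
antiext₄ b₀ b₁ b₂ b₃ 2 = b₂
antiext₄ b₀ b₁ b₂ b₃ 3 = b₃
antiext₄ b₀ b₁ b₂ b₃ (suc (suc (suc (suc k)))) = not (antiext₄ b₀ b₁ b₂ b₃ k)

BothClosed : ℕ → ℕ → (ℕ → Bool) → (ℕ → Bool) → Set
BothClosed K N p r = ShiftClosed K N p r false 1 × ShiftClosed K N p r true 0

-- The correlation at shift 1 for n = 2, in the form to which `S` unfolds, with the indices i - 1 of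
-- `r` raised by 8.
Correlation₁ : (ℕ → Bool) → (ℕ → Bool) → Set
Correlation₁ p r = ((((+ 0 + sgn (p 1 xor p 0)) + sgn (p 2 xor p 1)) + sgn (p 3 xor p 2)) + sgn (p 4 xor p 3))
  + ((((+ 0 + sgn (r 7 xor r 0)) + sgn (r 8 xor r 1)) + sgn (r 9 xor r 2)) + sgn (r 10 xor r 3)) ≡ + 0

bothClosed? : ∀ K N p r → Dec (BothClosed K N p r)
bothClosed? K N p r = shiftClosed? K N p r false 1 ×-dec shiftClosed? K N p r true 0

abstract
  -- An exhaustive check of 16 pairs of sequences, kept opaque so that later uses do not unfold it.
  closed₁ : ∀ b₀ b₁ c₀ c₁ → BothClosed 2 4 (antiext₂ b₀ b₁) (antiext₂ c₀ c₁)
  closed₁ = toWitness {a? = ∀ᵇ? λ b₀ → ∀ᵇ? λ b₁ → ∀ᵇ? λ c₀ → ∀ᵇ? λ c₁ → bothClosed? 2 4 (antiext₂ b₀ b₁) (antiext₂ c₀ c₁)} tt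

  -- An exhaustive check of 256 pairs, sieved by the correlation at shift 1.
  closed₂ : ∀ b₀ b₁ b₂ b₃ c₀ c₁ c₂ c₃ → Correlation₁ (antiext₄ b₀ b₁ b₂ b₃) (antiext₄ c₀ c₁ c₂ c₃) →
            BothClosed 4 8 (antiext₄ b₀ b₁ b₂ b₃) (antiext₄ c₀ c₁ c₂ c₃)
  closed₂ = toWitness {a? = ∀ᵇ? λ b₀ → ∀ᵇ? λ b₁ → ∀ᵇ? λ b₂ → ∀ᵇ? λ b₃ → ∀ᵇ? λ c₀ → ∀ᵇ? λ c₁ → ∀ᵇ? λ c₂ → ∀ᵇ? λ c₃ →
    (_ ℤₚ.≟ _) →-dec bothClosed? 4 8 (antiext₄ b₀ b₁ b₂ b₃) (antiext₄ c₀ c₁ c₂ c₃)} tt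

-- Propelinear codes and Hadamard codes

word-ext : ∀ {x y : Word m} → (∀ i → lookup x i ≡ lookup y i) → x ≡ y
word-ext {x = x} {y} h = trans (sym (Vecₚ.tabulate∘lookup x)) (trans (Vecₚ.tabulate-cong h) (Vecₚ.tabulate∘lookup y))

lookup-⊕ : ∀ (x y : Word m) i → lookup (x ⊕ y) i ≡ lookup x i xor lookup y i
lookup-⊕ x y i = Vecₚ.lookup-zipWith _xor_ i x y

lookup-𝟎 : ∀ i → lookup (𝟎 {m}) i ≡ false
lookup-𝟎 i = Vecₚ.lookup-replicate i false

lookup-𝟏 : ∀ i → lookup (𝟏 {m}) i ≡ true
lookup-𝟏 i = Vecₚ.lookup-replicate i true

lookup-compl : ∀ (x : Word m) i → lookup (compl x) i ≡ not (lookup x i)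
lookup-compl x i = trans (lookup-⊕ x 𝟏 i) (trans (cong (lookup x i xor_) (lookup-𝟏 i)) (xor-comm (lookup x i) true))

compl-involutive : ∀ (x : Word m) → compl (compl x) ≡ x
compl-involutive x = word-ext λ i → trans (lookup-compl (compl x) i)
  (trans (cong not (lookup-compl x i)) (not-involutive (lookup x i)))

compl-𝟎 : compl (𝟎 {m}) ≡ 𝟏
compl-𝟎 = word-ext λ i → trans (lookup-compl 𝟎 i) (trans (cong not (lookup-𝟎 i)) (sym (lookup-𝟏 i)))

compl-𝟏 : compl (𝟏 {m}) ≡ 𝟎
compl-𝟏 = trans (cong compl (sym compl-𝟎)) (compl-involutive 𝟎)

⊕-cancelʳ : ∀ (x z : Word m) → (x ⊕ z) ⊕ z ≡ x
⊕-cancelʳ x z = word-ext λ i → trans (lookup-⊕ (x ⊕ z) z i)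
    (trans (cong (_xor lookup z i) (lookup-⊕ x z i)) (lem (lookup x i) (lookup z i)))
  where
  lem : ∀ x z → (x xor z) xor z ≡ x
  lem = solve-∀ Bool-ring

injective⇒surjective : ∀ {k l} (f : Fin k → Fin l) → (∀ {i j} → f i ≡ f j → i ≡ j) → l ℕ.≤ k → ∀ j → ∃ λ i → f i ≡ j
injective⇒surjective {k} {suc l} f inj l≤k j = go (Finₚ.any? (λ i → f i Finₚ.≟ j))
  where
  go : _ → ∃ λ i → f i ≡ j
  go (yes found) = found
  go (no none) = ⊥-elim (ℕₚ.<-irrefl refl (ℕₚ.≤-trans l≤k
    (Finₚ.injective⇒≤ {f = λ i → punchOut {i = j} {f i} (λ eq → none (i , sym eq))}
      (λ {a} {b} eq → inj (Finₚ.punchOut-injective {i = j} (λ e → none (a , sym e)) (λ e → none (b , sym e)) eq)))))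

module Propelinear {N : ℕ} (C : Code N) (π : Assignment N)
  (prop : IsPropelinear C π) (π-𝟎 : ∀ i → π 𝟎 ⟨$⟩ʳ i ≡ i) (π-𝟏 : ∀ i → π 𝟏 ⟨$⟩ʳ i ≡ i)
  where

  infixl 7 _·_
  _·_ : Word N → Word N → Word N
  _·_ = mul π

  C-𝟎 : C 𝟎
  C-𝟎 = proj₁ prop

  C-· : ∀ {x y} → C x → C y → C (x · y)
  C-· {x} {y} Cx Cy = proj₁ (proj₂ prop x y Cx Cy)

  lookup-· : ∀ x y i → lookup (x · y) i ≡ lookup x i xor lookup y (π x ⟨$⟩ˡ i)
  lookup-· x y i = trans (lookup-⊕ x (act (π x) y) i) (cong (lookup x i xor_) (Vecₚ.lookup∘tabulate _ i))

  π-·ˡ : ∀ {x y} → C x → C y → ∀ i → π (x · y) ⟨$⟩ˡ i ≡ π y ⟨$⟩ˡ (π x ⟨$⟩ˡ i)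
  π-·ˡ {x} {y} Cx Cy i = trans (cong (π (x · y) ⟨$⟩ˡ_) (sym
      (trans (sym (proj₂ (proj₂ prop x y Cx Cy) k)) (trans (cong (π x ⟨$⟩ʳ_) (inverseʳ (π y))) (inverseʳ (π x))))))
      (inverseˡ (π (x · y)))
    where k = π y ⟨$⟩ˡ (π x ⟨$⟩ˡ i)

  ·-assoc : ∀ {x y} z → C x → C y → (x · y) · z ≡ x · (y · z)
  ·-assoc {x} {y} z Cx Cy = word-ext λ i → trans (lookup-· (x · y) z i)
    (trans (cong₂ _xor_ (lookup-· x y i) (cong (lookup z) (π-·ˡ Cx Cy i)))
      (trans (xor-assoc (lookup x i) (lookup y (π x ⟨$⟩ˡ i)) (lookup z (π y ⟨$⟩ˡ (π x ⟨$⟩ˡ i))))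
        (sym (trans (lookup-· x (y · z) i) (cong (lookup x i xor_) (lookup-· y z (π x ⟨$⟩ˡ i)))))))

  fix-ˡ : ∀ x i → π x ⟨$⟩ʳ i ≡ i → π x ⟨$⟩ˡ i ≡ i
  fix-ˡ x i fix = trans (cong (π x ⟨$⟩ˡ_) (sym fix)) (inverseˡ (π x))

  ·-identityˡ : ∀ y → 𝟎 · y ≡ y
  ·-identityˡ y = word-ext λ i → trans (lookup-· 𝟎 y i)
    (cong₂ _xor_ (lookup-𝟎 i) (cong (lookup y) (fix-ˡ 𝟎 i (π-𝟎 i))))

  𝟏-· : ∀ y → 𝟏 · y ≡ compl y
  𝟏-· y = word-ext λ i → trans (lookup-· 𝟏 y i)
    (trans (cong₂ _xor_ (lookup-𝟏 i) (cong (lookup y) (fix-ˡ 𝟏 i (π-𝟏 i)))) (sym (lookup-compl y i)))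

  ·-identityʳ : ∀ x → x · 𝟎 ≡ x
  ·-identityʳ x = word-ext λ i → trans (lookup-· x 𝟎 i)
    (trans (cong (lookup x i xor_) (lookup-𝟎 (π x ⟨$⟩ˡ i))) (xor-identityʳ (lookup x i)))

  ·-compl : ∀ x y → x · compl y ≡ compl (x · y)
  ·-compl x y = word-ext λ i → trans (lookup-· x (compl y) i)
      (trans (cong (lookup x i xor_) (lookup-compl y (π x ⟨$⟩ˡ i)))
        (trans (lem (lookup x i) (lookup y (π x ⟨$⟩ˡ i))) (sym (trans (lookup-compl (x · y) i) (cong not (lookup-· x y i))))))
    where
    lem : ∀ x y → x xor (true xor y) ≡ true xor (x xor y)
    lem = solve-∀ Bool-ring

  ·-cancelˡ : ∀ x {y z} → x · y ≡ x · z → y ≡ z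
  ·-cancelˡ x {y} {z} eq = word-ext λ i → xor-cancel (lookup x (π x ⟨$⟩ʳ i))
      (trans (sym (at y i)) (trans (cong (λ w → lookup w (π x ⟨$⟩ʳ i)) eq) (at z i)))
    where
    at : ∀ y i → lookup (x · y) (π x ⟨$⟩ʳ i) ≡ lookup x (π x ⟨$⟩ʳ i) xor lookup y i
    at y i = trans (lookup-· x y (π x ⟨$⟩ʳ i)) (cong (λ k → lookup x (π x ⟨$⟩ʳ i) xor lookup y k) (inverseˡ (π x)))
    xor-cancel : ∀ x {y z} → x xor y ≡ x xor z → y ≡ z
    xor-cancel false eq = eq
    xor-cancel true  eq = not-injective eq

  ·-inverseʳ : ∀ x → x · inv π x ≡ 𝟎
  ·-inverseʳ x = word-ext λ i → trans (lookup-· x (inv π x) i) (trans (cong (lookup x i xor_)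
    (trans (Vecₚ.lookup∘tabulate _ (π x ⟨$⟩ˡ i)) (cong (lookup x) (inverseʳ (π x))))) (trans (xor-same (lookup x i)) (sym (lookup-𝟎 i))))

-- Orthogonality and the size of a Hadamard code

sumFin-cong : ∀ {f g : Fin m → ℤ} → (∀ i → f i ≡ g i) → sumFin m f ≡ sumFin m g
sumFin-cong {zero}  h = refl
sumFin-cong {suc m} h = cong₂ _+_ (h zero) (sumFin-cong (λ i → h (suc i)))

sumFin-const : ∀ m k → sumFin m (λ _ → k) ≡ + m ℤ.* k
sumFin-const zero    k = sym (ℤₚ.*-zeroˡ k)
sumFin-const (suc m) k = trans (cong (_+_ k) (sumFin-const m k)) (sym (dist (+ m) k))
  where
  dist : ∀ m k → (+ 1 + m) ℤ.* k ≡ k + m ℤ.* k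
  dist = solve-∀ ℤ-ring

sumFin-*ʳ : ∀ m (f : Fin m → ℤ) k → sumFin m (λ i → f i ℤ.* k) ≡ sumFin m f ℤ.* k
sumFin-*ʳ zero    f k = sym (ℤₚ.*-zeroˡ k)
sumFin-*ʳ (suc m) f k = trans (cong (_+_ (f zero ℤ.* k)) (sumFin-*ʳ m (λ i → f (suc i)) k))
  (sym (ℤₚ.*-distribʳ-+ k (f zero) (sumFin m (λ i → f (suc i)))))

sgn² : ∀ e → sgn e ℤ.* sgn e ≡ + 1
sgn² false = refl
sgn² true  = refl

sgn-not : ∀ e → sgn (not e) ≡ sgn e ℤ.* - (+ 1)
sgn-not false = refl
sgn-not true  = refl

module HadamardCode {N : ℕ} (1≤N : 1 ℕ.≤ N) (C : Code N) (had : IsBinaryHadamardCode N C) where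

  H₀ : Fin N → Word N
  H₀ = proj₁ had

  private
    orth : IsBinaryHadamard N H₀
    orth = proj₁ (proj₂ had)

    inner : Word N → Word N → ℤ
    inner x y = sumFin N (λ k → sgn (lookup x k) ℤ.* sgn (lookup y k))

    split : ∀ {x} → C x → (∃ λ i → x ≡ H₀ i) ⊎ (∃ λ i → x ≡ compl (H₀ i))
    split = Equivalence.to (proj₂ (proj₂ had) _)

    unsplit : ∀ {x} → (∃ λ i → x ≡ H₀ i) ⊎ (∃ λ i → x ≡ compl (H₀ i)) → C x
    unsplit = Equivalence.from (proj₂ (proj₂ had) _)

    inner-refl : ∀ x → inner x x ≡ + N
    inner-refl x = trans (sumFin-cong (λ k → sgn² (lookup x k))) (trans (sumFin-const N (+ 1)) (ℤₚ.*-identityʳ (+ N)))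

    inner-≢ : ∀ {i j} → i ≢ j → inner (H₀ i) (H₀ j) ≡ + 0
    -- The comparison and the orthogonality relation are abstracted together, so that the
    -- conditional in the latter reduces.
    inner-≢ {i} {j} i≢j with i Finₚ.≟ j | orth i j
    ... | yes i≡j | _  = contradiction i≡j i≢j
    ... | no _    | eq = eq

    inner-compl : ∀ x y → inner (compl x) y ≡ inner x y ℤ.* - (+ 1)
    inner-compl x y = trans (sumFin-cong (λ k → trans (cong (ℤ._* sgn (lookup y k)) (trans (cong sgn (lookup-compl x k)) (sgn-not (lookup x k))))
        (swap (sgn (lookup x k)) (sgn (lookup y k))))) (sumFin-*ʳ N (λ k → sgn (lookup x k) ℤ.* sgn (lookup y k)) (- (+ 1)))
      where
      swap : ∀ a b → a ℤ.* - (+ 1) ℤ.* b ≡ a ℤ.* b ℤ.* - (+ 1)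
      swap = solve-∀ ℤ-ring

    N≢0 : + N ≡ + 0 → ⊥
    N≢0 eq = ℕₚ.<⇒≢ 1≤N (sym (ℤₚ.+-injective eq))

    H₀-injective : ∀ {i j} → H₀ i ≡ H₀ j → i ≡ j
    H₀-injective {i} {j} eq = go (i Finₚ.≟ j)
      where
      go : _ → i ≡ j
      go (yes i≡j) = i≡j
      go (no i≢j)  = ⊥-elim (N≢0 (trans (sym (trans (cong (inner (H₀ i)) (sym eq)) (inner-refl (H₀ i)))) (inner-≢ i≢j)))

    x≢compl : ∀ (x : Word N) → x ≢ compl x
    x≢compl x eq = not-fixed _ (trans (cong (λ w → lookup w (fromℕ< 1≤N)) eq) (lookup-compl x (fromℕ< 1≤N)))

    H₀≢compl : ∀ {i j} → H₀ i ≢ compl (H₀ j)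
    H₀≢compl {i} {j} eq = go (i Finₚ.≟ j)
      where
      go : _ → ⊥
      go (yes refl) = x≢compl (H₀ i) eq
      go (no i≢j)   = N≢0 (trans (sym (inner-refl (H₀ i))) (trans (cong (λ w → inner w (H₀ i)) eq)
        (trans (inner-compl (H₀ j) (H₀ i)) (trans (cong (ℤ._* - (+ 1)) (inner-≢ (λ e → i≢j (sym e)))) refl))))

  C-compl : ∀ {x} → C x → C (compl x)
  C-compl {x} Cx = unsplit (go (split Cx))
    where
    go : _ → (∃ λ i → compl x ≡ H₀ i) ⊎ (∃ λ i → compl x ≡ compl (H₀ i))
    go (inj₁ (i , eq)) = inj₂ (i , cong compl eq)
    go (inj₂ (i , eq)) = inj₁ (i , trans (cong compl eq) (compl-involutive (H₀ i)))

  -- `𝟎` is itself a row or the complement of one, so y is orthogonal to it, and the inner product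
  -- with `𝟎` is the sum of signs.
  balanced : C 𝟎 → ∀ {y} → C y → y ≢ 𝟎 → y ≢ 𝟏 → sumFin N (λ k → sgn (lookup y k)) ≡ + 0
  balanced C𝟎 {y} Cy y≢𝟎 y≢𝟏 = trans (sumFin-cong (λ k →
      trans (sym (ℤₚ.*-identityʳ _)) (cong (λ e → sgn (lookup y k) ℤ.* sgn e) (sym (lookup-𝟎 k)))))
      (vanish (split Cy) (split C𝟎))
    where
    vanish : (∃ λ i → y ≡ H₀ i) ⊎ (∃ λ i → y ≡ compl (H₀ i)) → (∃ λ j → 𝟎 ≡ H₀ j) ⊎ (∃ λ j → 𝟎 ≡ compl (H₀ j)) →
             inner y 𝟎 ≡ + 0
    inner-comm : ∀ x y → inner x y ≡ inner y x
    inner-comm x y = sumFin-cong (λ k → ℤₚ.*-comm (sgn (lookup x k)) (sgn (lookup y k)))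
    compl-0 : ∀ {x z} → inner x z ≡ + 0 → inner (compl x) z ≡ + 0
    compl-0 {x} {z} eq = trans (inner-compl x z) (cong (ℤ._* - (+ 1)) eq)
    compl-0ʳ : ∀ {x z} → inner x z ≡ + 0 → inner x (compl z) ≡ + 0
    compl-0ʳ {x} {z} eq = trans (inner-comm x (compl z)) (compl-0 {z} {x} (trans (inner-comm z x) eq))
    H₀≡𝟏 : ∀ j → 𝟎 ≡ compl (H₀ j) → H₀ j ≡ 𝟏
    H₀≡𝟏 j e = trans (sym (compl-involutive (H₀ j))) (trans (cong compl (sym e)) compl-𝟎)
    vanish (inj₁ (i , e)) (inj₁ (j , f)) = trans (cong₂ inner e f) (inner-≢ λ i≡j →
      y≢𝟎 (trans e (trans (cong H₀ i≡j) (sym f))))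
    vanish (inj₁ (i , e)) (inj₂ (j , f)) = trans (cong₂ inner e f) (compl-0ʳ {H₀ i} {H₀ j} (inner-≢ λ i≡j →
      y≢𝟏 (trans e (trans (cong H₀ i≡j) (H₀≡𝟏 j f)))))
    vanish (inj₂ (i , e)) (inj₁ (j , f)) = trans (cong₂ inner e f) (compl-0 {H₀ i} {H₀ j} (inner-≢ λ i≡j →
      y≢𝟏 (trans e (trans (cong (λ k → compl (H₀ k)) i≡j) (trans (cong compl (sym f)) compl-𝟎)))))
    vanish (inj₂ (i , e)) (inj₂ (j , f)) = trans (cong₂ inner e f) (compl-0 {H₀ i} {compl (H₀ j)} (compl-0ʳ {H₀ i} {H₀ j} (inner-≢ λ i≡j →
      y≢𝟎 (trans e (trans (cong (λ k → compl (H₀ k)) i≡j) (sym f))))))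

  -- The rows and their complements are 2N distinct words. This bound is what keeps the group from
  -- being smaller than the dicyclic group.
  cardinality : ∀ k (g : Fin k → Word N) → (∀ x → C x → ∃ λ t → x ≡ g t) → N ℕ.+ N ℕ.≤ k
  cardinality k g onto = Finₚ.injective⇒≤ {f = λ s → index (splitAt N s)} λ {s} {t} eq →
      trans (sym (Finₚ.join-splitAt N N s)) (trans (cong (join N N) (index-injective (splitAt N s) (splitAt N t) eq)) (Finₚ.join-splitAt N N t))
    where
    word : Fin N ⊎ Fin N → Word N
    word = [ H₀ , (λ i → compl (H₀ i)) ]′
    C-word : ∀ s → C (word s)
    C-word (inj₁ i) = unsplit (inj₁ (i , refl))
    C-word (inj₂ i) = unsplit (inj₂ (i , refl))
    index : Fin N ⊎ Fin N → Fin k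
    index s = proj₁ (onto (word s) (C-word s))
    word-injective : ∀ s t → word s ≡ word t → s ≡ t
    word-injective (inj₁ i) (inj₁ j) eq = cong inj₁ (H₀-injective eq)
    word-injective (inj₁ i) (inj₂ j) eq = ⊥-elim (H₀≢compl eq)
    word-injective (inj₂ i) (inj₁ j) eq = ⊥-elim (H₀≢compl (sym eq))
    word-injective (inj₂ i) (inj₂ j) eq = cong inj₂ (H₀-injective
      (trans (sym (compl-involutive (H₀ i))) (trans (cong compl eq) (compl-involutive (H₀ j)))))
    index-injective : ∀ s t → index s ≡ index t → s ≡ t
    index-injective s t eq = word-injective s t (trans (proj₂ (onto (word s) (C-word s)))
      (trans (cong g eq) (sym (proj₂ (onto (word t) (C-word t))))))

S-sumFin : ∀ g m → sumFin m (λ k → sgn (g (+ toℕ k))) ≡ S m g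
S-sumFin g zero    = refl
S-sumFin g (suc m) = trans (cong₂ _+_ (sym (ℤₚ.+-identityˡ (sgn (g (+ 0))))) (S-sumFin (λ i → g (+ 1 + i)) m)) (sym (S-+ g 1 m))

sumFin-+ : ∀ k l (f : Fin (k ℕ.+ l) → ℤ) → sumFin (k ℕ.+ l) f ≡ sumFin k (λ i → f (i ↑ˡ l)) + sumFin l (λ i → f (k ↑ʳ i))
sumFin-+ zero    l f = sym (ℤₚ.+-identityˡ _)
sumFin-+ (suc k) l f = trans (cong (_+_ (f zero)) (sumFin-+ k l (λ i → f (suc i)))) (sym (ℤₚ.+-assoc (f zero) _ _))

sumFin≡sum : ∀ m (f : Fin m → ℤ) → sumFin m f ≡ ℤ-Sum.sum f
sumFin≡sum zero    f = refl
sumFin≡sum (suc m) f = cong (_+_ (f zero)) (sumFin≡sum m (λ i → f (suc i)))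

sumFin-permute : ∀ {k l} (f : Fin l → ℤ) (σ : Permutation k l) → sumFin l f ≡ sumFin k (λ i → f (σ ⟨$⟩ʳ i))
sumFin-permute {k} {l} f σ = trans (sumFin≡sum l f) (trans (ℤ-Sum.sum-permute f σ) (sym (sumFin≡sum k _)))

-- The dicyclic group of codewords

residue-injective : ∀ (i j M : ℕ) → i ℕ.< M → j ℕ.< M → + M ∣ (+ i - + j) → i ≡ j
residue-injective i j M i<M j<M d = ℤₚ.+-injective (ℤₚ.i-j≡0⇒i≡j (+ i) (+ j) (ℤₚ.∣i∣≡0⇒i≡0 (zero-abs (∣⇒∣ᵤ d) abs<)))
  where
  abs< : ℤ.∣ + i - + j ∣ ℕ.< M
  abs< = subst (ℕ._< M) (sym (trans (cong ℤ.∣_∣ (ℤₚ.[+m]-[+n]≡m⊖n i j)) (ℤₚ.∣m⊖n∣≡∣n⊖m∣ i j))) (bound i j i<M j<M)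
    where
    bound : ∀ i j → i ℕ.< M → j ℕ.< M → ℤ.∣ j ℤ.⊖ i ∣ ℕ.< M
    bound i j i<M j<M = ℕₚ.≤-<-trans (ℤₚ.∣m⊝n∣≤m⊔n j i) (ℕₚ.⊔-lub j<M i<M)
  zero-abs : ∀ {k} → M ℕ∣.∣ k → k ℕ.< M → k ≡ 0
  zero-abs {zero}  _ _ = refl
  zero-abs {suc k} d lt = ⊥-elim (ℕ∣.>⇒∤ lt d)

module Dicyclic (n N : ℕ) (1≤n : 1 ℕ.≤ n) (N≡ : N ≡ (n ℕ.+ n) ℕ.+ (n ℕ.+ n))
  (C : Code N) (π : Assignment N) (hfp : IsHFP N C π) (a b : Word N)
  (Ca : C a) (Cb : C b) (gen : ∀ x → C x → Gen π a b x)
  (a^4n : pow π a N ≡ 𝟎) (a^2n : pow π a (n ℕ.+ n) ≡ pow π b 2)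
  (conj : mul π (inv π b) (mul π a b) ≡ inv π a)
  where

  private
    prop = proj₁ hfp
    had = proj₁ (proj₂ hfp)
    π-𝟎 = proj₁ (proj₂ (proj₂ hfp))
    π-𝟏 = proj₁ (proj₂ (proj₂ (proj₂ hfp)))
    free = proj₂ (proj₂ (proj₂ (proj₂ hfp)))

  1≤N : 1 ℕ.≤ N
  1≤N = subst (1 ℕ.≤_) (sym N≡) (ℕₚ.≤-trans 1≤n (ℕₚ.≤-trans (ℕₚ.m≤m+n n n) (ℕₚ.m≤m+n (n ℕ.+ n) (n ℕ.+ n))))

  open Propelinear C π prop π-𝟎 π-𝟏 public
  open HadamardCode 1≤N C had public

  M : ℤ
  M = + n + + n

  +N≡ : + N ≡ M + M
  +N≡ = cong +_ N≡

  C-pow : ∀ {x} → C x → ∀ k → C (pow π x k)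
  C-pow Cx zero    = C-𝟎
  C-pow Cx (suc k) = C-· Cx (C-pow Cx k)

  a⁻¹ : Word N
  a⁻¹ = inv π a

  -- Closure under `inv` comes from finite order: the inverse of a is its power with exponent 4n -
  -- 1.
  C-a⁻¹ : C a⁻¹
  C-a⁻¹ = go N 1≤N a^4n
    where
    go : ∀ k → 1 ℕ.≤ k → pow π a k ≡ 𝟎 → C a⁻¹
    go (suc k) _ eq = subst C (·-cancelˡ a (trans eq (sym (·-inverseʳ a)))) (C-pow Ca k)

  E : ℤ → Word N
  E (+ k)    = pow π a k
  E -[1+ k ] = pow π a⁻¹ (suc k)

  C-E : ∀ i → C (E i)
  C-E (+ k)    = C-pow Ca k
  C-E -[1+ k ] = C-pow C-a⁻¹ (suc k)

  private
    a·a⁻¹· : ∀ x → a · (a⁻¹ · x) ≡ x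
    a·a⁻¹· x = trans (sym (·-assoc x Ca C-a⁻¹)) (trans (cong (_· x) (·-inverseʳ a)) (·-identityˡ x))

  E-suc : ∀ i → E (+ 1 + i) ≡ a · E i
  E-suc (+ k)          = refl
  E-suc -[1+ zero ]    = sym (a·a⁻¹· 𝟎)
  E-suc -[1+ suc k ]   = sym (a·a⁻¹· (pow π a⁻¹ (suc k)))

  E-+ : ∀ i j → E (i + j) ≡ E i · E j
  E-+ i j = ℤ-ind (λ i → E (i + j) ≡ E i · E j)
      (trans (cong E (ℤₚ.+-identityˡ j)) (sym (·-identityˡ (E j)))) up down i
    where
    left : ∀ i → E (+ 1 + i + j) ≡ a · E (i + j)
    left i = trans (cong E (ℤₚ.+-assoc (+ 1) i j)) (E-suc (i + j))
    right : ∀ i → E (+ 1 + i) · E j ≡ a · (E i · E j)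
    right i = trans (cong (_· E j) (E-suc i)) (·-assoc (E j) Ca (C-E i))
    up : ∀ i → E (i + j) ≡ E i · E j → E (+ 1 + i + j) ≡ E (+ 1 + i) · E j
    up i h = trans (left i) (trans (cong (a ·_) h) (sym (right i)))
    down : ∀ i → E (+ 1 + i + j) ≡ E (+ 1 + i) · E j → E (i + j) ≡ E i · E j
    down i h = ·-cancelˡ a (trans (sym (left i)) (trans h (right i)))

  E-M : E M ≡ b · b
  E-M = trans a^2n (cong (b ·_) (·-identityʳ b))

  E-2M : E (M + M) ≡ 𝟎
  E-2M = trans (cong E (sym +N≡)) a^4n

  private
    a⁻¹≡E : a⁻¹ ≡ E (- (+ 1))
    a⁻¹≡E = sym (·-identityʳ a⁻¹)

    C-b⁻¹ : C (inv π b)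
    C-b⁻¹ = subst C (·-cancelˡ b (trans b⁴ (sym (·-inverseʳ b)))) (C-· Cb (C-E M))
      where
      b⁴ : b · (b · E M) ≡ 𝟎
      b⁴ = trans (sym (·-assoc (E M) Cb Cb)) (trans (cong (_· E M) (sym E-M)) (trans (sym (E-+ M M)) E-2M))

    a·b : a · b ≡ b · E (- (+ 1))
    a·b = begin
      a · b                        ≡⟨ sym (·-identityˡ (a · b)) ⟩
      𝟎 · (a · b)                  ≡⟨ cong (_· (a · b)) (sym (·-inverseʳ b)) ⟩
      (b · inv π b) · (a · b)      ≡⟨ ·-assoc (a · b) Cb C-b⁻¹ ⟩
      b · (inv π b · (a · b))      ≡⟨ cong (b ·_) (trans conj a⁻¹≡E) ⟩
      b · E (- (+ 1))              ∎
      where open ≡-Reasoning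

  E-b : ∀ i → E i · b ≡ b · E (- i)
  E-b = ℤ-ind (λ i → E i · b ≡ b · E (- i)) (trans (·-identityˡ b) (sym (·-identityʳ b))) up down
    where
    left : ∀ i → E (+ 1 + i) · b ≡ a · (E i · b)
    left i = trans (cong (_· b) (E-suc i)) (·-assoc b Ca (C-E i))
    neg : ∀ i → - (+ 1) + - i ≡ - (+ 1 + i)
    neg = solve-∀ ℤ-ring
    right : ∀ i → a · (b · E (- i)) ≡ b · E (- (+ 1 + i))
    right i = begin
      a · (b · E (- i))                    ≡⟨ sym (·-assoc (E (- i)) Ca Cb) ⟩
      (a · b) · E (- i)                    ≡⟨ cong (_· E (- i)) a·b ⟩
      (b · E (- (+ 1))) · E (- i)          ≡⟨ ·-assoc (E (- i)) Cb (C-E (- (+ 1))) ⟩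
      b · (E (- (+ 1)) · E (- i))          ≡⟨ cong (b ·_) (sym (E-+ (- (+ 1)) (- i))) ⟩
      b · E (- (+ 1) + - i)                ≡⟨ cong (λ k → b · E k) (neg i) ⟩
      b · E (- (+ 1 + i))                  ∎
      where open ≡-Reasoning
    up : ∀ i → E i · b ≡ b · E (- i) → E (+ 1 + i) · b ≡ b · E (- (+ 1 + i))
    up i h = trans (left i) (trans (cong (a ·_) h) (right i))
    down : ∀ i → E (+ 1 + i) · b ≡ b · E (- (+ 1 + i)) → E i · b ≡ b · E (- i)
    down i h = ·-cancelˡ a (trans (sym (left i)) (trans h (sym (right i))))

  b-E : ∀ i → b · E i ≡ E (- i) · b
  b-E i = sym (trans (E-b (- i)) (cong (λ k → b · E k) (ℤₚ.neg-involutive i)))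

  E′ : ℤ → Word N
  E′ i = E i · b

  C-E′ : ∀ i → C (E′ i)
  C-E′ i = C-· (C-E i) Cb

  E-E′ : ∀ i j → E i · E′ j ≡ E′ (i + j)
  E-E′ i j = trans (sym (·-assoc b (C-E i) (C-E j))) (cong (_· b) (sym (E-+ i j)))

  E′-E : ∀ i j → E′ i · E j ≡ E′ (i - j)
  E′-E i j = trans (·-assoc (E j) (C-E i) Cb) (trans (cong (E i ·_) (b-E j)) (E-E′ i (- j)))

  E′-E′ : ∀ i j → E′ i · E′ j ≡ E (i - j + M)
  E′-E′ i j = begin
    E′ i · E′ j               ≡⟨ sym (·-assoc b (C-E′ i) (C-E j)) ⟩
    (E′ i · E j) · b          ≡⟨ cong (_· b) (E′-E i j) ⟩
    E (i - j) · b · b         ≡⟨ ·-assoc b (C-E (i - j)) Cb ⟩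
    E (i - j) · (b · b)       ≡⟨ cong (E (i - j) ·_) (sym E-M) ⟩
    E (i - j) · E M           ≡⟨ sym (E-+ (i - j) M) ⟩
    E (i - j + M)             ∎
    where open ≡-Reasoning

  NormalForm : Word N → Set
  NormalForm x = ∃ λ i → x ≡ E i ⊎ x ≡ E′ i

  normalForm : ∀ {x} → C x → NormalForm x
  normalForm Cx = go (gen _ Cx)
    where
    times : ∀ {x y} → NormalForm x → NormalForm y → NormalForm (x · y)
    times (i , inj₁ refl) (j , inj₁ refl) = i + j , inj₁ (sym (E-+ i j))
    times (i , inj₁ refl) (j , inj₂ refl) = i + j , inj₂ (E-E′ i j)
    times (i , inj₂ refl) (j , inj₁ refl) = i - j , inj₂ (E′-E i j)
    times (i , inj₂ refl) (j , inj₂ refl) = i - j + M , inj₁ (E′-E′ i j)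
    e₁ : ∀ i m → i - (i + m) + m ≡ + 0
    e₁ = solve-∀ ℤ-ring
    inverse : ∀ {x} → NormalForm x → NormalForm (inv π x)
    inverse (i , inj₁ refl) = - i , inj₁ (·-cancelˡ (E i) (trans (·-inverseʳ (E i))
      (trans (cong E (sym (ℤₚ.+-inverseʳ i))) (E-+ i (- i)))))
    -- As aⁱb has square a^(2n), its inverse is a^(i + 2n)b.
    inverse (i , inj₂ refl) = i + M , inj₂ (·-cancelˡ (E′ i) (trans (·-inverseʳ (E′ i))
      (sym (trans (E′-E′ i (i + M)) (cong E (e₁ i M))))))
    go : ∀ {x} → Gen π a b x → NormalForm x
    go gen-0           = + 0 , inj₁ refl
    go gen-a           = + 1 , inj₁ (sym (·-identityʳ a))
    go gen-b           = + 0 , inj₂ (sym (·-identityˡ b))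
    go (gen-mul g h)   = times (go g) (go h)
    go (gen-inv g)     = inverse (go g)

  private
    E-period : ∀ δ → E δ ≡ 𝟎 → ∀ q → E (q ℤ.* δ) ≡ 𝟎
    E-period δ h = ℤ-ind (λ q → E (q ℤ.* δ) ≡ 𝟎) (cong E (ℤₚ.*-zeroˡ δ))
        (λ q eq → trans (step q) eq) (λ q eq → trans (sym (step q)) eq)
      where
      dist : ∀ q δ → (+ 1 + q) ℤ.* δ ≡ δ + q ℤ.* δ
      dist = solve-∀ ℤ-ring
      step : ∀ q → E ((+ 1 + q) ℤ.* δ) ≡ E (q ℤ.* δ)
      step q = trans (cong E (dist q δ)) (trans (E-+ δ (q ℤ.* δ)) (trans (cong (_· E (q ℤ.* δ)) h) (·-identityˡ _)))

    E-reduce : ∀ d .{{_ : ℕ.NonZero d}} → E (+ d) ≡ 𝟎 → ∀ i → E i ≡ E (+ (i %ℕ d))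
    E-reduce d h i = trans (cong E (a≡a%ℕn+[a/ℕn]*n i d)) (trans (E-+ (+ (i %ℕ d)) ((i /ℕ d) ℤ.* + d))
      (trans (cong (E (+ (i %ℕ d)) ·_) (E-period (+ d) h (i /ℕ d))) (·-identityʳ _)))

    -- If a^(d + 1) is trivial, the normal forms list all 2N codewords by 2(d + 1) words.
    order-bound : ∀ d → E (+ suc d) ≡ 𝟎 → N ℕ.≤ suc d
    order-bound d h = halve-≤ (cardinality (suc d ℕ.+ suc d) (λ s → word (splitAt (suc d) s)) onto)
      where
      halve-≤ : ∀ {k l} → k ℕ.+ k ℕ.≤ l ℕ.+ l → k ℕ.≤ l
      halve-≤ {k} {l} le = ℕₚ.≮⇒≥ λ l<k → ℕₚ.<⇒≱ (ℕₚ.+-mono-< l<k l<k) le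
      word : Fin (suc d) ⊎ Fin (suc d) → Word N
      word = [ (λ k → E (+ toℕ k)) , (λ k → E′ (+ toℕ k)) ]′
      res : ℤ → Fin (suc d)
      res i = fromℕ< (n%ℕd<d i (suc d))
      E-res : ∀ i → E i ≡ E (+ toℕ (res i))
      E-res i = trans (E-reduce (suc d) h i) (cong (λ k → E (+ k)) (sym (Finₚ.toℕ-fromℕ< (n%ℕd<d i (suc d)))))
      onto : ∀ x → C x → ∃ λ t → x ≡ word (splitAt (suc d) t)
      onto x Cx = find (normalForm Cx)
        where
        find : NormalForm x → ∃ λ t → x ≡ word (splitAt (suc d) t)
        find (i , inj₁ eq) = res i ↑ˡ suc d , trans eq (trans (E-res i) (sym (cong word (Finₚ.splitAt-↑ˡ (suc d) (res i) (suc d)))))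
        find (i , inj₂ eq) = suc d ↑ʳ res i , trans eq (trans (cong (_· b) (E-res i)) (sym (cong word (Finₚ.splitAt-↑ʳ (suc d) (suc d) (res i)))))

    instance
      N-nonZero : ℕ.NonZero N
      N-nonZero = ℕ.>-nonZero 1≤N

  E-mod : ∀ i → ∃ λ (t : Fin N) → E i ≡ E (+ toℕ t)
  E-mod i = fromℕ< (n%ℕd<d i N) , trans (E-reduce N a^4n i) (cong (λ k → E (+ k)) (sym (Finₚ.toℕ-fromℕ< (n%ℕd<d i N))))

  -- A non-zero remainder modulo N would be an exponent below the bound of `order-bound`.
  E≡𝟎⇒∣ : ∀ i → E i ≡ 𝟎 → + N ∣ i
  E≡𝟎⇒∣ i eq = go (i %ℕ N) refl
    where
    E-residue : E (+ (i %ℕ N)) ≡ 𝟎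
    E-residue = trans (sym (E-reduce N a^4n i)) eq
    go : ∀ ρ → i %ℕ N ≡ ρ → + N ∣ i
    go zero    h = divides (i /ℕ N) (trans (a≡a%ℕn+[a/ℕn]*n i N) (trans (cong (λ k → + k + (i /ℕ N) ℤ.* + N) h) (ℤₚ.+-identityˡ _)))
    go (suc d) h = ⊥-elim (ℕₚ.<⇒≱ (n%ℕd<d i N) (subst (N ℕ.≤_) (sym h) (order-bound d (subst (λ k → E (+ k) ≡ 𝟎) h E-residue))))

  E-injective : ∀ i j → E i ≡ E j → + N ∣ (i - j)
  E-injective i j eq = E≡𝟎⇒∣ (i - j) (trans (E-+ i (- j)) (trans (cong (_· E (- j)) eq)
    (trans (sym (E-+ j (- j))) (cong E (ℤₚ.+-inverseʳ j)))))

  E′-injective : ∀ i j → E′ i ≡ E′ j → + N ∣ (i - j)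
  E′-injective i j eq = subst (+ N ∣_) (e₁ i j M) (E-injective (i - j + M) (j - j + M)
      (trans (sym (E′-E′ i j)) (trans (cong (_· E′ j) eq) (E′-E′ j j))))
    where
    e₁ : ∀ i j m → (i - j + m) - (j - j + m) ≡ i - j
    e₁ = solve-∀ ℤ-ring

  -- If b were a power of a, the 4n powers of a would exhaust the 8n codewords.
  E≢E′ : ∀ i j → E i ≢ E′ j
  E≢E′ i j eq = ℕₚ.<⇒≱ (ℕₚ.m<m+n N 1≤N) (cardinality N (λ k → E (+ toℕ k)) onto)
    where
    s = - j + i
    b≡ : b ≡ E s
    b≡ = ·-cancelˡ (E j) (trans (sym eq) (trans (cong E (e₁ i j)) (E-+ j s)))
      where
      e₁ : ∀ i j → i ≡ j + (- j + i)
      e₁ = solve-∀ ℤ-ring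
    onto : ∀ x → C x → ∃ λ t → x ≡ E (+ toℕ t)
    onto x Cx = find (normalForm Cx)
      where
      find : NormalForm x → ∃ λ t → x ≡ E (+ toℕ t)
      find (k , inj₁ e) = proj₁ (E-mod k) , trans e (proj₂ (E-mod k))
      find (k , inj₂ e) = proj₁ (E-mod (k + s)) , trans e (trans (cong (E k ·_) b≡) (trans (sym (E-+ k s)) (proj₂ (E-mod (k + s)))))

  𝟎≢𝟏 : 𝟎 {N} ≢ 𝟏
  𝟎≢𝟏 eq = true≢false (trans (sym (lookup-𝟏 o)) (trans (cong (λ w → lookup w o) (sym eq)) (lookup-𝟎 o)))
    where o = fromℕ< 1≤N

  C-𝟏 : C 𝟏
  C-𝟏 = subst C compl-𝟎 (C-compl C-𝟎)

  N∤M : ¬ + N ∣ M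
  N∤M d = ℕ∣.>⇒∤ {{ℕ.>-nonZero 0<2n}} (subst (n ℕ.+ n ℕ.<_) (sym N≡) (ℕₚ.m<m+n (n ℕ.+ n) 0<2n)) (∣⇒∣ᵤ d)
    where
    0<2n : 0 ℕ.< n ℕ.+ n
    0<2n = ℕₚ.≤-trans 1≤n (ℕₚ.m≤m+n n n)

  -- `𝟏` squares to `𝟎`, and the dicyclic group has a single involution: aⁱb squares to a^(2n),
  -- which is not trivial, and a power of a with trivial square is `𝟎` or a^(2n).
  E-M≡𝟏 : E M ≡ 𝟏
  E-M≡𝟏 = go (normalForm C-𝟏)
    where
    square : 𝟏 · 𝟏 ≡ 𝟎
    square = trans (𝟏-· 𝟏) compl-𝟏
    e₁ : ∀ i m → i - i + m ≡ m
    e₁ = solve-∀ ℤ-ring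
    dist : ∀ q m → q ℤ.* (m + m) ≡ q ℤ.* m + q ℤ.* m
    dist = solve-∀ ℤ-ring
    e₂ : ∀ k m → (k + k) ℤ.* m ≡ k ℤ.* (m + m)
    e₂ = solve-∀ ℤ-ring
    e₃ : ∀ k m → (+ 1 + (k + k)) ℤ.* m ≡ m + k ℤ.* (m + m)
    e₃ = solve-∀ ℤ-ring
    go : NormalForm 𝟏 → E M ≡ 𝟏
    go (i , inj₂ eq) = ⊥-elim (N∤M (E≡𝟎⇒∣ M (trans (cong E (sym (e₁ i M))) (trans (sym (E′-E′ i i)) (trans (cong₂ _·_ (sym eq) (sym eq)) square)))))
    go (i , inj₁ eq) = case (E≡𝟎⇒∣ (i + i) (trans (E-+ i i) (trans (cong₂ _·_ (sym eq) (sym eq)) square)))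
      where
      case : + N ∣ (i + i) → E M ≡ 𝟏
      case (divides q h) = split (halve q)
        where
        i≡ : i ≡ q ℤ.* M
        i≡ = double-injective i (q ℤ.* M) (trans h (trans (cong (q ℤ.*_) +N≡) (dist q M)))
        split : (∃ λ k → q ≡ k + k ⊎ q ≡ + 1 + (k + k)) → E M ≡ 𝟏
        split (k , inj₁ q≡) = ⊥-elim (𝟎≢𝟏 (sym (trans eq (trans (cong E (trans i≡ (trans (cong (ℤ._* M) q≡) (e₂ k M)))) (E-period (M + M) E-2M k)))))
        split (k , inj₂ q≡) = sym (trans eq (trans (cong E (trans i≡ (trans (cong (ℤ._* M) q≡) (e₃ k M))))
          (trans (E-+ M (k ℤ.* (M + M))) (trans (cong (E M ·_) (E-period (M + M) E-2M k)) (·-identityʳ (E M))))))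

  E-+M : ∀ i → E (i + M) ≡ compl (E i)
  E-+M i = trans (cong E (ℤₚ.+-comm i M)) (trans (E-+ M i) (trans (cong (_· E i) E-M≡𝟏) (𝟏-· (E i))))

  E′-+M : ∀ i → E′ (i + M) ≡ compl (E′ i)
  E′-+M i = trans (cong E′ (ℤₚ.+-comm i M)) (trans (sym (E-E′ M i)) (trans (cong (_· E′ i) E-M≡𝟏) (𝟏-· (E′ i))))

  inverseˡ-exists : ∀ {x} → C x → ∃ λ y → C y × y · x ≡ 𝟎
  inverseˡ-exists {x} Cx = go (normalForm Cx)
    where
    e₁ : ∀ i m → i + m - i + m ≡ m + m
    e₁ = solve-∀ ℤ-ring
    go : NormalForm x → ∃ λ y → C y × y · x ≡ 𝟎
    go (i , inj₁ eq) = E (- i) , C-E (- i) , trans (cong (E (- i) ·_) eq) (trans (sym (E-+ (- i) i)) (cong E (ℤₚ.+-inverseˡ i)))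
    go (i , inj₂ eq) = E′ (i + M) , C-E′ (i + M) , trans (cong (E′ (i + M) ·_) eq) (trans (E′-E′ (i + M) i) (trans (cong E (e₁ i M)) E-2M))

  -- Coordinates as codewords modulo complement

  module Coordinates (o : Fin N) where

    pos : Word N → Fin N
    pos x = π x ⟨$⟩ˡ o

    f : Word N → Bool
    f x = lookup x o

    lookup-pos : ∀ x y → lookup y (pos x) ≡ f (x · y) xor f x
    lookup-pos x y = trans (lem (lookup y (pos x)) (f x)) (cong (_xor f x) (sym (lookup-· x y o)))
      where
      lem : ∀ u v → u ≡ (v xor u) xor v
      lem = solve-∀ Bool-ring

    pos-· : ∀ {x g} → C x → C g → pos (x · g) ≡ π g ⟨$⟩ˡ pos x
    pos-· Cx Cg = π-·ˡ Cx Cg o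

    word≟ : (x y : Word N) → _
    word≟ = Vecₚ.≡-dec Boolₚ._≟_

    -- The permutation of y x⁻¹ fixes the coordinate o, so fullness leaves only `𝟎` and `𝟏` for y
    -- x⁻¹.
    pos-injective : ∀ {x y} → C x → C y → pos x ≡ pos y → y ≡ x ⊎ y ≡ compl x
    pos-injective {x} {y} Cx Cy eq = go (inverseˡ-exists Cx)
      where
      go : (∃ λ z → C z × z · x ≡ 𝟎) → y ≡ x ⊎ y ≡ compl x
      go (z , Cz , zx) = decide (word≟ g 𝟎) (word≟ g 𝟏)
        where
        g = y · z
        Cg : C g
        Cg = C-· Cy Cz
        gx : g · x ≡ y
        gx = trans (·-assoc x Cy Cz) (trans (cong (y ·_) zx) (·-identityʳ y))
        fixed : π g ⟨$⟩ʳ o ≡ o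
        fixed = trans (cong (π g ⟨$⟩ʳ_) (sym unmoved)) (inverseʳ (π g))
          where
          unmoved : π g ⟨$⟩ˡ o ≡ o
          unmoved = trans (sym (inverseʳ (π x))) (trans (cong (π x ⟨$⟩ʳ_)
            (trans (sym (π-·ˡ Cg Cx o)) (trans (cong pos gx) (sym eq)))) (inverseʳ (π x)))
        decide : _ → _ → y ≡ x ⊎ y ≡ compl x
        decide (yes g≡𝟎) _ = inj₁ (trans (sym gx) (trans (cong (_· x) g≡𝟎) (·-identityˡ x)))
        decide (no _) (yes g≡𝟏) = inj₂ (trans (sym gx) (trans (cong (_· x) g≡𝟏) (𝟏-· x)))
        decide (no g≢𝟎) (no g≢𝟏) = ⊥-elim (free g Cg g≢𝟎 g≢𝟏 o fixed)

    -- Representatives of the codewords modulo complement. There are as many as coordinates, so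
    -- injectivity of `coordinate` makes it a bijection.
    element : Fin (n ℕ.+ n) ⊎ Fin (n ℕ.+ n) → Word N
    element = [ (λ k → E (+ toℕ k)) , (λ k → E′ (+ toℕ k)) ]′

    C-element : ∀ s → C (element s)
    C-element (inj₁ k) = C-E (+ toℕ k)
    C-element (inj₂ k) = C-E′ (+ toℕ k)

    coordinate : Fin ((n ℕ.+ n) ℕ.+ (n ℕ.+ n)) → Fin N
    coordinate s = pos (element (splitAt (n ℕ.+ n) s))

    private
      ∣N⇒∣M : ∀ {i} → + N ∣ i → M ∣ i
      ∣N⇒∣M (divides q eq) = divides (q + q) (trans eq (trans (cong (q ℤ.*_) +N≡) (e₁ q M)))
        where
        e₁ : ∀ q m → q ℤ.* (m + m) ≡ (q + q) ℤ.* m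
        e₁ = solve-∀ ℤ-ring

      cancel-M : ∀ i j → + N ∣ (j - (i + M)) → M ∣ (j - i)
      cancel-M i j d = go (∣N⇒∣M d)
        where
        e₁ : ∀ i j m → j - i ≡ j - (i + m) + m
        e₁ = solve-∀ ℤ-ring
        e₂ : ∀ q m → q ℤ.* m + m ≡ (+ 1 + q) ℤ.* m
        e₂ = solve-∀ ℤ-ring
        go : M ∣ (j - (i + M)) → M ∣ (j - i)
        go (divides q eq) = divides (+ 1 + q) (trans (e₁ i j M) (trans (cong (_+ M) eq) (e₂ q M)))

      element-injective : ∀ s t → element t ≡ element s ⊎ element t ≡ compl (element s) → s ≡ t
      element-injective (inj₁ i) (inj₁ j) h = cong inj₁ (sym (Finₚ.toℕ-injective
          (residue-injective (toℕ j) (toℕ i) (n ℕ.+ n) (Finₚ.toℕ<n j) (Finₚ.toℕ<n i) (go h))))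
        where
        go : _ → M ∣ (+ toℕ j - + toℕ i)
        go (inj₁ eq) = ∣N⇒∣M (E-injective (+ toℕ j) (+ toℕ i) eq)
        go (inj₂ eq) = cancel-M (+ toℕ i) (+ toℕ j) (E-injective (+ toℕ j) (+ toℕ i + M) (trans eq (sym (E-+M (+ toℕ i)))))
      element-injective (inj₁ i) (inj₂ j) (inj₁ eq) = ⊥-elim (E≢E′ (+ toℕ i) (+ toℕ j) (sym eq))
      element-injective (inj₁ i) (inj₂ j) (inj₂ eq) = ⊥-elim (E≢E′ (+ toℕ i + M) (+ toℕ j) (trans (E-+M (+ toℕ i)) (sym eq)))
      element-injective (inj₂ i) (inj₁ j) (inj₁ eq) = ⊥-elim (E≢E′ (+ toℕ j) (+ toℕ i) eq)
      element-injective (inj₂ i) (inj₁ j) (inj₂ eq) = ⊥-elim (E≢E′ (+ toℕ j) (+ toℕ i + M) (trans eq (sym (E′-+M (+ toℕ i)))))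
      element-injective (inj₂ i) (inj₂ j) h = cong inj₂ (sym (Finₚ.toℕ-injective
          (residue-injective (toℕ j) (toℕ i) (n ℕ.+ n) (Finₚ.toℕ<n j) (Finₚ.toℕ<n i) (go h))))
        where
        go : _ → M ∣ (+ toℕ j - + toℕ i)
        go (inj₁ eq) = ∣N⇒∣M (E′-injective (+ toℕ j) (+ toℕ i) eq)
        go (inj₂ eq) = cancel-M (+ toℕ i) (+ toℕ j) (E′-injective (+ toℕ j) (+ toℕ i + M) (trans eq (sym (E′-+M (+ toℕ i)))))

    coordinate-injective : ∀ {s t} → coordinate s ≡ coordinate t → s ≡ t
    coordinate-injective {s} {t} eq = trans (sym (Finₚ.join-splitAt (n ℕ.+ n) (n ℕ.+ n) s))
      (trans (cong (join (n ℕ.+ n) (n ℕ.+ n)) (element-injective (splitAt (n ℕ.+ n) s) (splitAt (n ℕ.+ n) t)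
        (pos-injective (C-element (splitAt (n ℕ.+ n) s)) (C-element (splitAt (n ℕ.+ n) t)) eq)))
        (Finₚ.join-splitAt (n ℕ.+ n) (n ℕ.+ n) t))

    coordinate-surjective : ∀ j → ∃ λ s → coordinate s ≡ j
    coordinate-surjective = injective⇒surjective coordinate coordinate-injective (ℕₚ.≤-reflexive N≡)

    σ : Permutation ((n ℕ.+ n) ℕ.+ (n ℕ.+ n)) N
    σ = permutation coordinate (λ j → proj₁ (coordinate-surjective j)) (λ j → proj₂ (coordinate-surjective j))
      (λ s → coordinate-injective (proj₂ (coordinate-surjective (coordinate s))))

    p r : ℤ → Bool
    p i = f (E i)
    r i = f (E′ i)

    anti-p : Antiperiodic M p
    anti-p i = trans (cong f (E-+M i)) (lookup-compl (E i) o)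

    anti-r : Antiperiodic M r
    anti-r i = trans (cong f (E′-+M i)) (lookup-compl (E′ i) o)

    E-at-E : ∀ t i → lookup (E t) (pos (E i)) ≡ p (i + t) xor p i
    E-at-E t i = trans (lookup-pos (E i) (E t)) (cong (λ w → f w xor p i) (sym (E-+ i t)))

    E-at-E′ : ∀ t i → lookup (E t) (pos (E′ i)) ≡ r (i - t) xor r i
    E-at-E′ t i = trans (lookup-pos (E′ i) (E t)) (cong (λ w → f w xor r i) (E′-E i t))

    E′-at-E : ∀ t i → lookup (E′ t) (pos (E i)) ≡ r (i + t) xor p i
    E′-at-E t i = trans (lookup-pos (E i) (E′ t)) (cong (λ w → f w xor p i) (E-E′ i t))

    E′-at-E′ : ∀ t i → lookup (E′ t) (pos (E′ i)) ≡ not (p (i - t)) xor r i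
    E′-at-E′ t i = trans (lookup-pos (E′ i) (E′ t)) (cong (_xor r i) (trans (cong f (E′-E′ i t)) (anti-p (i - t))))

    E≡𝟎∨𝟏 : ∀ t → M ∣ t → E t ≡ 𝟎 ⊎ E t ≡ 𝟏
    E≡𝟎∨𝟏 t (divides q eq) = go (halve q)
      where
      e₂ : ∀ k m → (k + k) ℤ.* m ≡ k ℤ.* (m + m)
      e₂ = solve-∀ ℤ-ring
      e₃ : ∀ k m → (+ 1 + (k + k)) ℤ.* m ≡ k ℤ.* (m + m) + m
      e₃ = solve-∀ ℤ-ring
      go : (∃ λ k → q ≡ k + k ⊎ q ≡ + 1 + (k + k)) → E t ≡ 𝟎 ⊎ E t ≡ 𝟏
      go (k , inj₁ q≡) = inj₁ (trans (cong E (trans eq (trans (cong (ℤ._* M) q≡) (e₂ k M)))) (E-period (M + M) E-2M k))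
      go (k , inj₂ q≡) = inj₂ (trans (cong E (trans eq (trans (cong (ℤ._* M) q≡) (e₃ k M))))
        (trans (E-+M (k ℤ.* (M + M))) (trans (cong compl (E-period (M + M) E-2M k)) compl-𝟎)))

    E≡𝟎∨𝟏⇒∣ : ∀ t → E t ≡ 𝟎 ⊎ E t ≡ 𝟏 → M ∣ t
    E≡𝟎∨𝟏⇒∣ t (inj₁ eq) = ∣N⇒∣M (E≡𝟎⇒∣ t eq)
    E≡𝟎∨𝟏⇒∣ t (inj₂ eq) = subst (M ∣_) (e₁ t) (cancel-M (+ 0) t (E-injective t (+ 0 + M) (trans eq (sym E-M≡𝟏))))
      where
      e₁ : ∀ t → t - + 0 ≡ t
      e₁ = solve-∀ ℤ-ring

    -- The codeword aᵗ is balanced; reading its bits at the coordinates of aⁱ and of aⁱb gives the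
    -- two autocorrelations.
    bent : ∀ t → ¬ M ∣ t → S (n ℕ.+ n) (λ i → p (i + t) xor p i) + S (n ℕ.+ n) (λ i → r (i - t) xor r i) ≡ + 0
    bent t ∤t = begin
        S K (λ i → p (i + t) xor p i) + S K (λ i → r (i - t) xor r i)
          ≡⟨ sym (cong₂ _+_ (S-sumFin (λ i → p (i + t) xor p i) K) (S-sumFin (λ i → r (i - t) xor r i) K)) ⟩
        sumFin K (λ k → sgn (p (+ toℕ k + t) xor p (+ toℕ k))) + sumFin K (λ k → sgn (r (+ toℕ k - t) xor r (+ toℕ k)))
          ≡⟨ sym (cong₂ _+_
               (sumFin-cong (λ k → cong sgn (trans (cong (λ s → lookup (E t) (pos (element s))) (Finₚ.splitAt-↑ˡ K k K)) (E-at-E t (+ toℕ k)))))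
               (sumFin-cong (λ k → cong sgn (trans (cong (λ s → lookup (E t) (pos (element s))) (Finₚ.splitAt-↑ʳ K K k)) (E-at-E′ t (+ toℕ k)))))) ⟩
        sumFin K (λ k → g (coordinate (k ↑ˡ K))) + sumFin K (λ k → g (coordinate (K ↑ʳ k)))
          ≡⟨ sym (sumFin-+ K K (λ s → g (coordinate s))) ⟩
        sumFin (K ℕ.+ K) (λ s → g (coordinate s))
          ≡⟨ sym (sumFin-permute g σ) ⟩
        sumFin N g
          ≡⟨ balanced C-𝟎 (C-E t) (λ eq → ∤t (E≡𝟎∨𝟏⇒∣ t (inj₁ eq))) (λ eq → ∤t (E≡𝟎∨𝟏⇒∣ t (inj₂ eq))) ⟩
        + 0 ∎
      where
      open ≡-Reasoning
      K = n ℕ.+ n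
      g : Fin N → ℤ
      g k = sgn (lookup (E t) k)

    pos-ext : ∀ {x y} → (∀ (k : Fin (n ℕ.+ n)) → lookup x (pos (E (+ toℕ k))) ≡ lookup y (pos (E (+ toℕ k)))) →
              (∀ (k : Fin (n ℕ.+ n)) → lookup x (pos (E′ (+ toℕ k))) ≡ lookup y (pos (E′ (+ toℕ k)))) → x ≡ y
    pos-ext {x} {y} h h′ = word-ext λ j → go j (coordinate-surjective j)
      where
      at : ∀ s → lookup x (pos (element s)) ≡ lookup y (pos (element s))
      at (inj₁ k) = h k
      at (inj₂ k) = h′ k
      go : ∀ j → (∃ λ s → coordinate s ≡ j) → lookup x j ≡ lookup y j
      go j (s , eq) = subst (λ j → lookup x j ≡ lookup y j) eq (at (splitAt (n ℕ.+ n) s))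

    pos-surjective : ∀ j → ∃ λ x → C x × pos x ≡ j
    pos-surjective j = element (splitAt (n ℕ.+ n) (proj₁ (coordinate-surjective j))) , C-element (splitAt (n ℕ.+ n) (proj₁ (coordinate-surjective j)))
      , proj₂ (coordinate-surjective j)

⊕-identityʳ : ∀ (x : Word m) → x ⊕ 𝟎 ≡ x
⊕-identityʳ x = word-ext λ i → trans (lookup-⊕ x 𝟎 i) (trans (cong (lookup x i xor_) (lookup-𝟎 i)) (xor-identityʳ (lookup x i)))

⊕-comm : ∀ (x y : Word m) → x ⊕ y ≡ y ⊕ x
⊕-comm x y = word-ext λ i → trans (lookup-⊕ x y i) (trans (xor-comm (lookup x i) (lookup y i)) (sym (lookup-⊕ y x i)))

⊕-identityˡ : ∀ (x : Word m) → 𝟎 ⊕ x ≡ x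
⊕-identityˡ x = trans (⊕-comm 𝟎 x) (⊕-identityʳ x)

⊕-self : ∀ (x : Word m) → x ⊕ x ≡ 𝟎
⊕-self x = word-ext λ i → trans (lookup-⊕ x x i) (trans (xor-same (lookup x i)) (sym (lookup-𝟎 i)))

-- The kernels of C and of the transpose code

kernel-intro : ∀ (C : Code m) z → (∀ x → C x → C (x ⊕ z)) → Kernel C z
kernel-intro C z h x = mk⇔ (h x) (λ Cxz → subst C (⊕-cancelʳ x z) (h (x ⊕ z) Cxz))

SpannedBy : (Word m → Set) → Word m → Set
SpannedBy P z₀ = ∀ z → P z → (z ≡ 𝟎 ⊎ z ≡ 𝟏) ⊎ (z ≡ z₀ ⊎ z ≡ compl z₀)

-- Whichever combination of the basis gives `𝟏`, one of the basis vectors differs from `𝟏` and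
-- completes it to a basis.
plane-through-𝟏 : ∀ (P : Word m → Set) → HasDim P 2 → P 𝟏 → 𝟎 {m} ≢ 𝟏 →
                  ∃ λ z₀ → P z₀ × z₀ ≢ 𝟎 × z₀ ≢ 𝟏 × SpannedBy P z₀
plane-through-𝟏 {m} P (v ∷ w ∷ [] , span , indep) P𝟏 𝟎≢𝟏 = go (Equivalence.to (span 𝟏) P𝟏)
  where
  comb : Bool → Bool → Word m
  comb c d = linComb (v ∷ w ∷ []) (c ∷ d ∷ [])
  comb-00 : comb false false ≡ 𝟎
  comb-00 = trans (⊕-identityˡ _) (⊕-identityˡ 𝟎)
  comb-10 : comb true false ≡ v
  comb-10 = trans (cong (v ⊕_) (⊕-identityˡ 𝟎)) (⊕-identityʳ v)
  comb-01 : comb false true ≡ w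
  comb-01 = trans (⊕-identityˡ _) (⊕-identityʳ w)
  comb-11 : comb true true ≡ v ⊕ w
  comb-11 = cong (v ⊕_) (⊕-identityʳ w)
  v∈ : P v
  v∈ = Equivalence.from (span v) (true ∷ false ∷ [] , sym comb-10)
  w∈ : P w
  w∈ = Equivalence.from (span w) (false ∷ true ∷ [] , sym comb-01)
  v≢𝟎 : v ≢ 𝟎
  v≢𝟎 eq with indep (true ∷ false ∷ []) (trans comb-10 eq)
  ... | ()
  w≢𝟎 : w ≢ 𝟎
  w≢𝟎 eq with indep (false ∷ true ∷ []) (trans comb-01 eq)
  ... | ()
  v≢w : v ≢ w
  v≢w eq with indep (true ∷ true ∷ []) (trans comb-11 (trans (cong (_⊕ w) eq) (⊕-self w)))
  ... | ()
  go : (∃ λ c → 𝟏 ≡ linComb (v ∷ w ∷ []) c) → ∃ λ z₀ → P z₀ × z₀ ≢ 𝟎 × z₀ ≢ 𝟏 × SpannedBy P z₀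
  go (false ∷ false ∷ [] , eq) = ⊥-elim (𝟎≢𝟏 (sym (trans eq comb-00)))
  go (true ∷ false ∷ [] , eq) = w , w∈ , w≢𝟎 , (λ e → v≢w (trans (sym 𝟏≡v) (sym e))) , λ z Pz → classify z (Equivalence.to (span z) Pz)
    where
    𝟏≡v : 𝟏 ≡ v
    𝟏≡v = trans eq comb-10
    classify : ∀ z → (∃ λ c → z ≡ linComb (v ∷ w ∷ []) c) → (z ≡ 𝟎 ⊎ z ≡ 𝟏) ⊎ (z ≡ w ⊎ z ≡ compl w)
    classify z (false ∷ false ∷ [] , e) = inj₁ (inj₁ (trans e comb-00))
    classify z (true ∷ false ∷ [] , e)  = inj₁ (inj₂ (trans e (sym eq)))
    classify z (false ∷ true ∷ [] , e)  = inj₂ (inj₁ (trans e comb-01))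
    classify z (true ∷ true ∷ [] , e)   = inj₂ (inj₂ (trans e (trans comb-11 (trans (cong (_⊕ w) (sym 𝟏≡v)) (⊕-comm 𝟏 w)))))
  go (false ∷ true ∷ [] , eq) = v , v∈ , v≢𝟎 , (λ e → v≢w (trans e 𝟏≡w)) , λ z Pz → classify z (Equivalence.to (span z) Pz)
    where
    𝟏≡w : 𝟏 ≡ w
    𝟏≡w = trans eq comb-01
    classify : ∀ z → (∃ λ c → z ≡ linComb (v ∷ w ∷ []) c) → (z ≡ 𝟎 ⊎ z ≡ 𝟏) ⊎ (z ≡ v ⊎ z ≡ compl v)
    classify z (false ∷ false ∷ [] , e) = inj₁ (inj₁ (trans e comb-00))
    classify z (true ∷ false ∷ [] , e)  = inj₂ (inj₁ (trans e comb-10))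
    classify z (false ∷ true ∷ [] , e)  = inj₁ (inj₂ (trans e (sym eq)))
    classify z (true ∷ true ∷ [] , e)   = inj₂ (inj₂ (trans e (trans comb-11 (cong (v ⊕_) (sym 𝟏≡w)))))
  go (true ∷ true ∷ [] , eq) = v , v∈ , v≢𝟎 , v≢𝟏 , λ z Pz → classify z (Equivalence.to (span z) Pz)
    where
    𝟏≡v⊕w : 𝟏 ≡ v ⊕ w
    𝟏≡v⊕w = trans eq comb-11
    w≡ : w ≡ compl v
    w≡ = trans (sym (⊕-cancelʳ w v)) (trans (cong (_⊕ v) (trans (⊕-comm w v) (sym 𝟏≡v⊕w))) (⊕-comm 𝟏 v))
    v≢𝟏 : v ≢ 𝟏
    v≢𝟏 e = w≢𝟎 (trans w≡ (trans (cong compl e) compl-𝟏))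
    classify : ∀ z → (∃ λ c → z ≡ linComb (v ∷ w ∷ []) c) → (z ≡ 𝟎 ⊎ z ≡ 𝟏) ⊎ (z ≡ v ⊎ z ≡ compl v)
    classify z (false ∷ false ∷ [] , e) = inj₁ (inj₁ (trans e comb-00))
    classify z (true ∷ false ∷ [] , e)  = inj₂ (inj₁ (trans e comb-10))
    classify z (false ∷ true ∷ [] , e)  = inj₂ (inj₂ (trans e (trans comb-01 w≡)))
    classify z (true ∷ true ∷ [] , e)   = inj₁ (inj₂ (trans e (sym eq)))

module Kernels (n N : ℕ) (1≤n : 1 ℕ.≤ n) (N≡ : N ≡ (n ℕ.+ n) ℕ.+ (n ℕ.+ n))
  (C : Code N) (π : Assignment N) (hfp : IsHFP N C π) (a b : Word N)
  (Ca : C a) (Cb : C b) (gen : ∀ x → C x → Gen π a b x)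
  (a^4n : pow π a N ≡ 𝟎) (a^2n : pow π a (n ℕ.+ n) ≡ pow π b 2)
  (conj : mul π (inv π b) (mul π a b) ≡ inv π a) (o : Fin N)
  where

  open Dicyclic n N 1≤n N≡ C π hfp a b Ca Cb gen a^4n a^2n conj public
  open Coordinates o public
  module B = Bent n 1≤n p r anti-p anti-r bent

  -- Since g·(y + z) = g·y + π_g(z), adding π_g(z) to x amounts to adding z to y = g⁻¹x and
  -- multiplying back by g.
  kernel-act : ∀ {g z} → C g → Kernel C z → Kernel C (act (π g) z)
  kernel-act {g} {z} Cg Kz = kernel-intro C (act (π g) z) (λ x Cx → go x Cx (inverseˡ-exists Cg))
    where
    go : ∀ x → C x → (∃ λ h → C h × h · g ≡ 𝟎) → C (x ⊕ act (π g) z)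
    go x Cx (h , Ch , hg) = subst C eq (C-· Cg (Equivalence.to (Kz y) (C-· Ch Cx)))
      where
      y = h · x
      gh : g · h ≡ 𝟎
      gh = ·-cancelˡ h (trans (sym (·-assoc h Ch Cg)) (trans (cong (_· h) hg) (trans (·-identityˡ h) (sym (·-identityʳ h)))))
      gy : g · y ≡ x
      gy = trans (sym (·-assoc x Cg Ch)) (trans (cong (_· x) gh) (·-identityˡ x))
      eq : g · (y ⊕ z) ≡ x ⊕ act (π g) z
      eq = word-ext λ i → trans (lookup-· g (y ⊕ z) i)
        (trans (cong (lookup g i xor_) (lookup-⊕ y z (π g ⟨$⟩ˡ i)))
          (trans (sym (xor-assoc (lookup g i) (lookup y (π g ⟨$⟩ˡ i)) (lookup z (π g ⟨$⟩ˡ i))))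
            (trans (cong₂ _xor_ (trans (sym (lookup-· g y i)) (cong (λ w → lookup w i) gy)) (sym (Vecₚ.lookup∘tabulate _ i)))
              (sym (lookup-⊕ x (act (π g) z) i)))))

  module _ (z₀ : Word N) (Kz₀ : Kernel C z₀) (z₀≢𝟎 : z₀ ≢ 𝟎) (z₀≢𝟏 : z₀ ≢ 𝟏) (span : SpannedBy (Kernel C) z₀) where

    private
      C-z₀ : C z₀
      C-z₀ = subst C (⊕-identityˡ z₀) (Equivalence.to (Kz₀ 𝟎) C-𝟎)

    -- The permuted z₀ is again in the kernel and not constant, which leaves z₀ and its complement.
    character : ∀ {g} → C g → ∃ λ χ → ∀ j → lookup z₀ (π g ⟨$⟩ˡ j) ≡ χ xor lookup z₀ j
    character {g} Cg = go (span (act (π g) z₀) (kernel-act Cg Kz₀))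
      where
      at : ∀ j → lookup (act (π g) z₀) j ≡ lookup z₀ (π g ⟨$⟩ˡ j)
      at j = Vecₚ.lookup∘tabulate _ j
      pull : ∀ {e} {u : Word N} → (∀ i → lookup u i ≡ e) → act (π g) z₀ ≡ u → ∀ i → lookup z₀ i ≡ e
      pull {e} {u} const eq i = trans (cong (lookup z₀) (sym (inverseˡ (π g))))
        (trans (sym (at (π g ⟨$⟩ʳ i))) (trans (cong (λ w → lookup w (π g ⟨$⟩ʳ i)) eq) (const (π g ⟨$⟩ʳ i))))
      go : _ → ∃ λ χ → ∀ j → lookup z₀ (π g ⟨$⟩ˡ j) ≡ χ xor lookup z₀ j
      go (inj₁ (inj₁ eq)) = ⊥-elim (z₀≢𝟎 (word-ext λ i → trans (pull lookup-𝟎 eq i) (sym (lookup-𝟎 i))))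
      go (inj₁ (inj₂ eq)) = ⊥-elim (z₀≢𝟏 (word-ext λ i → trans (pull lookup-𝟏 eq i) (sym (lookup-𝟏 i))))
      go (inj₂ (inj₁ eq)) = false , λ j → trans (sym (at j)) (cong (λ w → lookup w j) eq)
      go (inj₂ (inj₂ eq)) = true , λ j → trans (sym (at j)) (trans (cong (λ w → lookup w j) eq) (lookup-compl z₀ j))

    private
      α = proj₁ (character Ca)
      β = proj₁ (character Cb)

      Z : ℤ → Bool
      Z i = lookup z₀ (pos (E i))

      Z-step : ∀ i → Z (+ 1 + i) ≡ α xor Z i
      Z-step i = trans (cong (λ w → lookup z₀ (pos w)) (trans (cong E (ℤₚ.+-comm (+ 1) i))
          (trans (E-+ i (+ 1)) (cong (E i ·_) (·-identityʳ a)))))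
        (trans (cong (lookup z₀) (pos-· (C-E i) Ca)) (proj₂ (character Ca) (pos (E i))))

      Z-form : ∀ i → Z i ≡ Z (+ 0) xor (α ∧ par i)
      Z-form = ℤ-ind (λ i → Z i ≡ Z (+ 0) xor (α ∧ par i)) (base (Z (+ 0)) α) up down
        where
        base : ∀ z a → z ≡ z xor (a ∧ false)
        base = solve-∀ Bool-ring
        lem : ∀ a z x → a xor (z xor (a ∧ x)) ≡ z xor (a ∧ (true xor x))
        lem = solve-∀ Bool-ring
        next : ∀ i → Z (+ 0) xor (α ∧ par (+ 1 + i)) ≡ α xor (Z (+ 0) xor (α ∧ par i))
        next i = trans (cong (λ x → Z (+ 0) xor (α ∧ x)) (par-suc i)) (sym (lem α (Z (+ 0)) (par i)))
        up : ∀ i → Z i ≡ Z (+ 0) xor (α ∧ par i) → Z (+ 1 + i) ≡ Z (+ 0) xor (α ∧ par (+ 1 + i))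
        up i h = trans (Z-step i) (trans (cong (α xor_) h) (sym (next i)))
        xor-cancel : ∀ x {y z} → x xor y ≡ x xor z → y ≡ z
        xor-cancel false eq = eq
        xor-cancel true  eq = not-injective eq
        down : ∀ i → Z (+ 1 + i) ≡ Z (+ 0) xor (α ∧ par (+ 1 + i)) → Z i ≡ Z (+ 0) xor (α ∧ par i)
        down i h = xor-cancel α (trans (sym (Z-step i)) (trans h (next i)))

      Z′-form : ∀ i → lookup z₀ (pos (E′ i)) ≡ (β xor Z (+ 0)) xor (α ∧ par i)
      Z′-form i = trans (cong (lookup z₀) (pos-· (C-E i) Cb)) (trans (proj₂ (character Cb) (pos (E i)))
        (trans (cong (β xor_) (Z-form i)) (sym (xor-assoc β (Z (+ 0)) (α ∧ par i)))))

    module _ (2<n : 2 ℕ.< n) where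

      private
        1<n : 1 ℕ.< n
        1<n = ℕₚ.≤-trans (ℕₚ.n≤1+n 2) 2<n

      -- As `𝟎` is a codeword, so is z₀, and it has a normal form. A power of a is impossible; aᵗb
      -- supplies what `period⇒constant` assumes.
      periods-constant : ∀ w w' → B.Period w w' → B.Constant w w'
      periods-constant = go (normalForm C-z₀)
        where
        go : NormalForm z₀ → ∀ w w' → B.Period w w' → B.Constant w w'
        go (t , inj₁ eq) = ⊥-elim (B.¬rotation-kernel 1<n t (Z (+ 0)) (β xor Z (+ 0)) α
          (λ d → excluded (E≡𝟎∨𝟏 t d))
          (λ i → trans (sym (E-at-E t i)) (trans (cong (λ w → lookup w (pos (E i))) (sym eq)) (Z-form i)))
          (λ i → trans (sym (E-at-E′ t i)) (trans (cong (λ w → lookup w (pos (E′ i))) (sym eq)) (Z′-form i))))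
          where
          excluded : E t ≡ 𝟎 ⊎ E t ≡ 𝟏 → ⊥
          excluded (inj₁ e) = z₀≢𝟎 (trans eq e)
          excluded (inj₂ e) = z₀≢𝟏 (trans eq e)
        go (t , inj₂ eq) = B.period⇒constant 2<n t (Z (+ 0) xor par t) (proj₁ structure) (proj₁ (proj₂ structure)) (proj₂ (proj₂ structure))
          where
          structure = B.reflection-kernel 1<n t (Z (+ 0)) α
            (λ i → trans (sym (E′-at-E t i)) (trans (cong (λ w → lookup w (pos (E i))) (sym eq)) (Z-form i)))

    -- Modulo `𝟏` a plane has one non-zero element, whereas a and b are non-zero and distinct modulo
    -- `𝟏`.
    ¬both-in-kernel : Kernel C (E (+ 1)) → Kernel C (E′ (+ 0)) → ⊥
    ¬both-in-kernel Ka Kb = go (span (E (+ 1)) Ka) (span (E′ (+ 0)) Kb)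
      where
      ∤1 : ¬ M ∣ + 1
      ∤1 = B.small∤ 1 (ℕ.s≤s ℕ.z≤n) (ℕₚ.+-mono-≤ 1≤n 1≤n)
      complE′ : E (+ 1) ≢ compl (E′ (+ 0))
      complE′ eq = E≢E′ (+ 1) (+ 0 + M) (trans eq (sym (E′-+M (+ 0))))
      flip : ∀ {x y : Word N} → x ≡ compl y → compl x ≡ y
      flip {y = y} eq = trans (cong compl eq) (compl-involutive y)
      go : _ → _ → ⊥
      go (inj₁ h) _ = ∤1 (E≡𝟎∨𝟏⇒∣ (+ 1) h)
      go (inj₂ _) (inj₁ (inj₁ e)) = E≢E′ (+ 0) (+ 0) (sym e)
      go (inj₂ _) (inj₁ (inj₂ e)) = E≢E′ M (+ 0) (trans E-M≡𝟏 (sym e))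
      go (inj₂ (inj₁ e)) (inj₂ (inj₁ e')) = E≢E′ (+ 1) (+ 0) (trans e (sym e'))
      go (inj₂ (inj₁ e)) (inj₂ (inj₂ e')) = complE′ (trans e (sym (flip e')))
      go (inj₂ (inj₂ e)) (inj₂ (inj₁ e')) = complE′ (trans e (cong compl (sym e')))
      go (inj₂ (inj₂ e)) (inj₂ (inj₂ e')) = E≢E′ (+ 1) (+ 0) (trans e (sym e'))

  -- The transpose code as the set of left translates

  module Transposed (H : Fin N → Word N) (H-injective : ∀ i j → H i ≡ H j → i ≡ j)
    (H-rows : ∀ x → (C x × f x ≡ false) ⇔ (∃ λ i → x ≡ H i)) where

    private
      C-H : ∀ k → C (H k)
      C-H k = proj₁ (Equivalence.from (H-rows (H k)) (k , refl))

      f-H : ∀ k → f (H k) ≡ false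
      f-H k = proj₂ (Equivalence.from (H-rows (H k)) (k , refl))

      twist : Bool → Word N → Word N
      twist false x = x
      twist true  x = compl x

      C-twist : ∀ e {x} → C x → C (twist e x)
      C-twist false Cx = Cx
      C-twist true  Cx = C-compl Cx

      f-twist : ∀ e x → f (twist e x) ≡ f x xor e
      f-twist false x = sym (xor-identityʳ (f x))
      f-twist true  x = trans (lookup-compl x o) (xor-comm true (f x))

      ·-twist : ∀ e x y → x · twist e y ≡ twist e (x · y)
      ·-twist false x y = refl
      ·-twist true  x y = ·-compl x y

      twist-· : ∀ e {x} y → C x → twist e x · y ≡ twist e (x · y)
      twist-· false     y Cx = refl
      twist-· true {x} y Cx = trans (cong (_· y) (sym (𝟏-· x))) (trans (·-assoc y C-𝟏 Cx) (𝟏-· (x · y)))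

      row : ∀ {y} → C y → ∃ λ k → twist (f y) y ≡ H k
      row {y} Cy = Equivalence.to (H-rows (twist (f y) y)) (C-twist (f y) Cy , trans (f-twist (f y) y) (xor-same (f y)))

      f-row : ∀ {y} (Cy : C y) x → f (x · y) ≡ f (x · H (proj₁ (row Cy))) xor f y
      f-row {y} Cy x = trans (lem (f (x · y)) (f y)) (cong (_xor f y) (sym (trans (cong (λ w → f (x · w)) (sym (proj₂ (row Cy))))
          (trans (cong f (·-twist (f y) x y)) (f-twist (f y) (x · y))))))
        where
        lem : ∀ u v → u ≡ (u xor v) xor v
        lem = solve-∀ Bool-ring

      -- The left translate of f by x, restricted to the rows; it is the column at `pos x`,
      -- complemented when f(x) is 1.
      word-of : Word N → Word N
      word-of x = tabulate (λ k → f (x · H k))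

      column-at : ∀ x k → lookup (column H (pos x)) k ≡ f (x · H k) xor f x
      column-at x k = trans (Vecₚ.lookup∘tabulate _ k) (lookup-pos x (H k))

      into : ∀ x → TransposeCode H (word-of x)
      into x = go (f x) refl
        where
        go : ∀ e → f x ≡ e → TransposeCode H (word-of x)
        go false eq = inj₁ (pos x , word-ext λ k → trans (Vecₚ.lookup∘tabulate _ k)
          (sym (trans (column-at x k) (trans (cong (f (x · H k) xor_) eq) (xor-identityʳ _)))))
        go true eq = inj₂ (pos x , word-ext λ k → trans (Vecₚ.lookup∘tabulate _ k)
          (sym (trans (lookup-compl (column H (pos x)) k) (trans (cong not (trans (column-at x k)
            (trans (cong (f (x · H k) xor_) eq) (xor-comm (f (x · H k)) true)))) (not-involutive _)))))

      twisted : ∀ {x} → C x → ∀ e (y : Word N) → (∀ k → lookup y k ≡ f (x · H k) xor e) →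
                ∃ λ x' → C x' × (∀ k → lookup y k ≡ f (x' · H k))
      twisted {x} Cx e y h = twist e x , C-twist e Cx , λ k → trans (h k)
        (sym (trans (cong f (twist-· e (H k) Cx)) (f-twist e (x · H k))))

      out : ∀ {y} → TransposeCode H y → ∃ λ x → C x × (∀ k → lookup y k ≡ f (x · H k))
      out {y} (inj₁ (j , eq)) = go (pos-surjective j)
        where
        go : _ → ∃ λ x → C x × (∀ k → lookup y k ≡ f (x · H k))
        go (x , Cx , refl) = twisted Cx (f x) y λ k → trans (cong (λ w → lookup w k) eq) (column-at x k)
      out {y} (inj₂ (j , eq)) = go (pos-surjective j)
        where
        lem : ∀ u v → true xor (u xor v) ≡ u xor (true xor v)
        lem = solve-∀ Bool-ring
        go : _ → ∃ λ x → C x × (∀ k → lookup y k ≡ f (x · H k))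
        go (x , Cx , refl) = twisted Cx (not (f x)) y λ k → trans (cong (λ w → lookup w k) eq)
          (trans (lookup-compl (column H (pos x)) k) (trans (cong not (column-at x k)) (lem (f (x · H k)) (f x))))

      translate-of : ∀ {q q'} → B.Translate q q' → ∃ λ x → C x × (∀ i → q i ≡ f (x · E i)) × (∀ i → q' i ≡ f (x · E′ i))
      translate-of (B.rotation j h h') = E j , C-E j
        , (λ i → trans (h i) (cong f (trans (cong E (ℤₚ.+-comm i j)) (E-+ j i))))
        , (λ i → trans (h' i) (cong f (trans (cong E′ (ℤₚ.+-comm i j)) (sym (E-E′ j i)))))
      translate-of (B.reflection j h h') = E′ j , C-E′ j
        , (λ i → trans (h i) (cong f (sym (E′-E j i))))
        , (λ i → trans (h' i) (sym (trans (cong f (E′-E′ j i)) (anti-p (j - i)))))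

      of-translate : ∀ {q q' x} → C x → (∀ i → q i ≡ f (x · E i)) → (∀ i → q' i ≡ f (x · E′ i)) → B.Translate q q'
      of-translate {q} {q'} {x} Cx h h' = go (normalForm Cx)
        where
        go : NormalForm x → B.Translate q q'
        go (j , inj₁ eq) = B.rotation j
          (λ i → trans (h i) (trans (cong (λ w → f (w · E i)) eq) (cong f (trans (sym (E-+ j i)) (cong E (ℤₚ.+-comm j i))))))
          (λ i → trans (h' i) (trans (cong (λ w → f (w · E′ i)) eq) (cong f (trans (E-E′ j i) (cong E′ (ℤₚ.+-comm j i))))))
        go (j , inj₂ eq) = B.reflection j
          (λ i → trans (h i) (trans (cong (λ w → f (w · E i)) eq) (cong f (E′-E j i))))
          (λ i → trans (h' i) (trans (cong (λ w → f (w · E′ i)) eq) (trans (cong f (E′-E′ j i)) (anti-p (j - i)))))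

      -- Extends a word indexed by rows to all codewords, with equal values on complementary ones.
      at : Word N → ∀ {y} → C y → Bool
      at z Cy = lookup z (proj₁ (row Cy))

      -- On rows this is the kernel condition for `word-of x`. From a row to its complement both
      -- translates change by f(y), by `f-row`, so the identity extends to all codewords.
      kernel⇒period : ∀ z → Kernel (TransposeCode H) z → B.Period (λ i → at z (C-E i)) (λ i → at z (C-E′ i))
      kernel⇒period z Kz q q' T = go (translate-of T)
        where
        go : _ → _
        go (x , Cx , h , h') = fin (out (Equivalence.to (Kz (word-of x)) (into x)))
          where
          fin : _ → _
          fin (x' , Cx' , g) = of-translate Cx'
              (λ i → trans (cong (_xor at z (C-E i)) (h i)) (moved (C-E i)))
              (λ i → trans (cong (_xor at z (C-E′ i)) (h' i)) (moved (C-E′ i)))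
            where
            lem : ∀ u v z → (u xor v) xor z ≡ (u xor z) xor v
            lem = solve-∀ Bool-ring
            moved : ∀ {y} (Cy : C y) → f (x · y) xor at z Cy ≡ f (x' · y)
            moved {y} Cy = trans (cong (_xor at z Cy) (f-row Cy x)) (trans (lem (f (x · H k)) (f y) (at z Cy))
                (trans (cong (_xor f y) (trans (sym (trans (lookup-⊕ (word-of x) z k) (cong (_xor lookup z k) (Vecₚ.lookup∘tabulate _ k)))) (g k)))
                  (sym (f-row Cy x'))))
              where k = proj₁ (row Cy)

      kernel-𝟏 : Kernel (TransposeCode H) 𝟏
      kernel-𝟏 = kernel-intro (TransposeCode H) 𝟏 λ where
        y (inj₁ (j , eq)) → inj₂ (j , cong compl eq)
        y (inj₂ (j , eq)) → inj₁ (j , trans (cong compl eq) (compl-involutive (column H j)))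

      kernel-𝟎 : Kernel (TransposeCode H) 𝟎
      kernel-𝟎 = kernel-intro (TransposeCode H) 𝟎 λ y h → subst (TransposeCode H) (sym (⊕-identityʳ y)) h

    kernel-dimension-1 : (∀ w w' → B.Period w w' → B.Constant w w') → HasDim (Kernel (TransposeCode H)) 1
    kernel-dimension-1 constant = 𝟏 ∷ [] , (λ z → mk⇔ (λ Kz → to z (constant _ _ (kernel⇒period z Kz))) (λ where (c ∷ [] , eq) → from c eq)) , indep
      where
      comb : Bool → Word N
      comb c = linComb (𝟏 ∷ []) (c ∷ [])
      comb-at : ∀ c i → lookup (comb c) i ≡ c
      comb-at false i = trans (cong (λ w → lookup w i) (⊕-identityʳ 𝟎)) (lookup-𝟎 i)
      comb-at true  i = trans (cong (λ w → lookup w i) (⊕-identityʳ 𝟏)) (lookup-𝟏 i)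
      to : ∀ z → B.Constant (λ i → at z (C-E i)) (λ i → at z (C-E′ i)) → ∃ λ c → z ≡ linComb (𝟏 ∷ []) c
      to z (e , c , c′) = e ∷ [] , word-ext λ k → trans (value-at k (normalForm (C-H k))) (sym (comb-at e k))
        where
        -- A row has first bit 0, so `row` leaves it uncomplemented and returns its own index.
        locate : ∀ k {y} (Cy : C y) → H k ≡ y → lookup z k ≡ at z Cy
        locate k {y} Cy eq = cong (lookup z) (H-injective k (proj₁ (row Cy))
          (trans (trans eq (cong (λ e → twist e y) (sym (trans (cong f (sym eq)) (f-H k))))) (proj₂ (row Cy))))
        value-at : ∀ k → NormalForm (H k) → lookup z k ≡ e
        value-at k (i , inj₁ eq) = trans (locate k (C-E i) eq) (c i)
        value-at k (i , inj₂ eq) = trans (locate k (C-E′ i) eq) (c′ i)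
      from : ∀ c {z} → z ≡ comb c → Kernel (TransposeCode H) z
      from false eq = subst (Kernel (TransposeCode H)) (sym (trans eq (⊕-identityʳ 𝟎))) kernel-𝟎
      from true  eq = subst (Kernel (TransposeCode H)) (sym (trans eq (⊕-identityʳ 𝟏))) kernel-𝟏
      indep : ∀ c → linComb (𝟏 ∷ []) c ≡ 𝟎 → c ≡ replicate 1 false
      indep (false ∷ []) _  = refl
      indep (true ∷ [])  eq = ⊥-elim (𝟎≢𝟏 (sym (trans (sym (⊕-identityʳ 𝟏)) eq)))

  -- Lengths 4 and 8: from the finite check to the kernel

  module Finite (p̂ r̂ : ℕ → Bool) (hp : ∀ k → p (+ k) ≡ p̂ k) (hr : ∀ k → r (+ k) ≡ r̂ k) where

    private
      element′ : Bool → ℤ → Word N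
      element′ false = E
      element′ true  = E′

      C-element′ : ∀ ε i → C (element′ ε i)
      C-element′ false = C-E
      C-element′ true  = C-E′

      -- Adding N passes two antiperiods, and the two sign changes cancel.
      subtract : ∀ (h : ℤ → Bool) → Antiperiodic M h → ∀ i t → t ℕ.≤ N → h (+ i - + t) ≡ h (+ (i ℕ.+ (N ℕ.∸ t)))
      subtract h anti i t t≤N = sym (trans (cong h shifted) (trans (anti (+ i - + t + M)) (trans (cong not (anti (+ i - + t))) (not-involutive _))))
        where
        e₁ : ∀ i d t → i + d ≡ i - t + (d + t)
        e₁ = solve-∀ ℤ-ring
        e₂ : ∀ x m → x + (m + m) ≡ x + m + m
        e₂ = solve-∀ ℤ-ring
        shifted : + (i ℕ.+ (N ℕ.∸ t)) ≡ + i - + t + M + M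
        shifted = trans (e₁ (+ i) (+ (N ℕ.∸ t)) (+ t)) (trans (cong (λ x → + i - + t + + x) (ℕₚ.m∸n+n≡m t≤N))
          (trans (cong (_+_ (+ i - + t)) +N≡) (e₂ (+ i - + t) M)))

      value-correct : ∀ ε δ t i → t ℕ.≤ N → lookup (element′ ε (+ t)) (pos (element′ δ (+ i))) ≡ value N p̂ r̂ ε t δ i
      value-correct false false t i t≤N = trans (E-at-E (+ t) (+ i)) (cong₂ _xor_ (hp (i ℕ.+ t)) (hp i))
      value-correct false true  t i t≤N = trans (E-at-E′ (+ t) (+ i))
        (cong₂ _xor_ (trans (subtract r anti-r i t t≤N) (hr (i ℕ.+ (N ℕ.∸ t)))) (hr i))
      value-correct true  false t i t≤N = trans (E′-at-E (+ t) (+ i)) (cong₂ _xor_ (hr (i ℕ.+ t)) (hp i))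
      value-correct true  true  t i t≤N = trans (E′-at-E′ (+ t) (+ i))
        (cong₂ _xor_ (cong not (trans (subtract p anti-p i t t≤N) (hp (i ℕ.+ (N ℕ.∸ t))))) (hr i))

    closed⇒kernel : ∀ ε₀ t₀ → t₀ ℕ.≤ N → ShiftClosed (n ℕ.+ n) N p̂ r̂ ε₀ t₀ → Kernel C (element′ ε₀ (+ t₀))
    closed⇒kernel ε₀ t₀ t₀≤N closed = kernel-intro C _ λ x Cx → go x (normalForm Cx)
      where
      move : ∀ {x} ε (t : Fin N) → x ≡ element′ ε (+ toℕ t) → C (x ⊕ element′ ε₀ (+ t₀))
      move {x} ε t eq = fin (closed ε t)
        where
        fin : _ → C (x ⊕ element′ ε₀ (+ t₀))
        fin (ε' , t' , same) = subst C (sym (pos-ext (agree false) (agree true))) (C-element′ ε' (+ toℕ t'))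
          where
          t≤ : ∀ (t : Fin N) → toℕ t ℕ.≤ N
          t≤ t = ℕₚ.<⇒≤ (Finₚ.toℕ<n t)
          agree : ∀ δ (k : Fin (n ℕ.+ n)) → lookup (x ⊕ element′ ε₀ (+ t₀)) (pos (element′ δ (+ toℕ k))) ≡
                  lookup (element′ ε' (+ toℕ t')) (pos (element′ δ (+ toℕ k)))
          agree δ k = trans (lookup-⊕ x (element′ ε₀ (+ t₀)) (pos (element′ δ (+ toℕ k))))
            (trans (cong₂ _xor_ (trans (cong (λ w → lookup w (pos (element′ δ (+ toℕ k)))) eq) (value-correct ε δ (toℕ t) (toℕ k) (t≤ t)))
                                (value-correct ε₀ δ t₀ (toℕ k) t₀≤N))
              (trans (same δ k) (sym (value-correct ε' δ (toℕ t') (toℕ k) (t≤ t')))))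
      go : ∀ x → NormalForm x → C (x ⊕ element′ ε₀ (+ t₀))
      go x (i , inj₁ eq) = move false (proj₁ (E-mod i)) (trans eq (proj₂ (E-mod i)))
      go x (i , inj₂ eq) = move true (proj₁ (E-mod i)) (trans eq (cong (_· b) (proj₂ (E-mod i))))

    both-closed⇒kernel : BothClosed (n ℕ.+ n) N p̂ r̂ → Kernel C (E (+ 1)) × Kernel C (E′ (+ 0))
    both-closed⇒kernel (ha , hb) = closed⇒kernel false 1 1≤N ha , closed⇒kernel true 0 ℕ.z≤n hb

AlwaysClosed : ℕ → ℕ → Set
AlwaysClosed n N = ∀ p r → Antiperiodic (+ n + + n) p → Antiperiodic (+ n + + n) r →
  (∀ t → ¬ (+ n + + n) ∣ t →
    S (n ℕ.+ n) (λ i → p (i + t) xor p i) + S (n ℕ.+ n) (λ i → r (i - t) xor r i) ≡ + 0) →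
  ∃ λ p̂ → ∃ λ r̂ → (∀ k → p (+ k) ≡ p̂ k) × (∀ k → r (+ k) ≡ r̂ k) × BothClosed (n ℕ.+ n) N p̂ r̂

antiext₂-correct : ∀ (h : ℤ → Bool) → Antiperiodic (+ 2) h → ∀ k → h (+ k) ≡ antiext₂ (h (+ 0)) (h (+ 1)) k
antiext₂-correct h anti 0 = refl
antiext₂-correct h anti 1 = refl
antiext₂-correct h anti (suc (suc k)) = trans (cong (λ l → h (+ l)) (ℕₚ.+-comm 2 k))
  (trans (anti (+ k)) (cong not (antiext₂-correct h anti k)))

antiext₄-correct : ∀ (h : ℤ → Bool) → Antiperiodic (+ 4) h → ∀ k →
                   h (+ k) ≡ antiext₄ (h (+ 0)) (h (+ 1)) (h (+ 2)) (h (+ 3)) k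
antiext₄-correct h anti 0 = refl
antiext₄-correct h anti 1 = refl
antiext₄-correct h anti 2 = refl
antiext₄-correct h anti 3 = refl
antiext₄-correct h anti (suc (suc (suc (suc k)))) = trans (cong (λ l → h (+ l)) (ℕₚ.+-comm 4 k))
  (trans (anti (+ k)) (cong not (antiext₄-correct h anti k)))

alwaysClosed₁ : AlwaysClosed 1 4
alwaysClosed₁ p r anti-p anti-r _ = _ , _ , antiext₂-correct p anti-p , antiext₂-correct r anti-r
  , closed₁ (p (+ 0)) (p (+ 1)) (r (+ 0)) (r (+ 1))

alwaysClosed₂ : AlwaysClosed 2 8
alwaysClosed₂ p r anti-p anti-r bent = p̂ , r̂ , hp , antiext₄-correct r anti-r
    , closed₂ (p (+ 0)) (p (+ 1)) (p (+ 2)) (p (+ 3)) (r (+ 0)) (r (+ 1)) (r (+ 2)) (r (+ 3)) correlation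
  where
  p̂ r̂ : ℕ → Bool
  p̂ = antiext₄ (p (+ 0)) (p (+ 1)) (p (+ 2)) (p (+ 3))
  r̂ = antiext₄ (r (+ 0)) (r (+ 1)) (r (+ 2)) (r (+ 3))
  hp : ∀ k → p (+ k) ≡ p̂ k
  hp = antiext₄-correct p anti-p
  Balanced : Bool → Bool → Bool → Bool → Bool → Set
  Balanced u v w x y =
    ((((+ 0 + sgn (p (+ 1) xor p (+ 0))) + sgn (p (+ 2) xor p (+ 1))) + sgn (p (+ 3) xor p (+ 2))) + sgn (u xor p (+ 3)))
    + ((((+ 0 + sgn (v xor r (+ 0))) + sgn (w xor r (+ 1))) + sgn (x xor r (+ 2))) + sgn (y xor r (+ 3))) ≡ + 0
  balanced-resp : ∀ {u u' v v' w w' x x' y y'} → u ≡ u' → v ≡ v' → w ≡ w' → x ≡ x' → y ≡ y' →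
                  Balanced u v w x y → Balanced u' v' w' x' y'
  balanced-resp refl refl refl refl refl h = h
  correlation : Correlation₁ p̂ r̂
  correlation = balanced-resp (hp 4) r₇ (twice (r (+ 0))) (twice (r (+ 1))) (twice (r (+ 2)))
      (bent (+ 1) λ d → ℕ∣.>⇒∤ (ℕ.s≤s (ℕ.s≤s ℕ.z≤n)) (∣⇒∣ᵤ d))
    where
    twice : ∀ x → x ≡ not (not x)
    twice x = sym (not-involutive x)
    -- The index 7 is - 1 raised by two antiperiods of length 4; `r̂ 7` unfolds to the negation of
    -- r(3).
    r₇ : r (- (+ 1)) ≡ r̂ 7
    r₇ = trans (twice (r (- (+ 1)))) (cong not (sym (anti-r (- (+ 1)))))

-- Assembly for codes of type Q

module TypeQ (n : ℕ) (1≤n : 1 ℕ.≤ n) (C : Code (4 ℕ.* n)) (π : Assignment (4 ℕ.* n)) (a b : Word (4 ℕ.* n))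
  (hfp : IsHFP (4 ℕ.* n) C π) (typeQ : IsTypeQ n C π a b) where

  private
    N≡ : 4 ℕ.* n ≡ (n ℕ.+ n) ℕ.+ (n ℕ.+ n)
    N≡ = trans (cong (λ k → n ℕ.+ (n ℕ.+ (n ℕ.+ k))) (ℕₚ.+-identityʳ n)) (sym (ℕₚ.+-assoc n n (n ℕ.+ n)))

    0<N : 0 ℕ.< 4 ℕ.* n
    0<N = ℕₚ.≤-trans 1≤n (ℕₚ.m≤m+n n (3 ℕ.* n))

    o : Fin (4 ℕ.* n)
    o = fromℕ< 0<N

    a^2n : pow π a (n ℕ.+ n) ≡ pow π b 2
    a^2n = trans (cong (λ k → pow π a (n ℕ.+ k)) (sym (ℕₚ.+-identityʳ n))) (proj₁ (proj₂ (proj₂ (proj₂ (proj₂ typeQ)))))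

  open Kernels n (4 ℕ.* n) 1≤n N≡ C π hfp a b (proj₁ typeQ) (proj₁ (proj₂ typeQ)) (proj₁ (proj₂ (proj₂ typeQ)))
    (proj₁ (proj₂ (proj₂ (proj₂ typeQ)))) a^2n (proj₂ (proj₂ (proj₂ (proj₂ (proj₂ typeQ))))) o public

  private
    plane : HasDim (Kernel C) 2 → ∃ λ z₀ → Kernel C z₀ × z₀ ≢ 𝟎 × z₀ ≢ 𝟏 × SpannedBy (Kernel C) z₀
    plane dim = plane-through-𝟏 (Kernel C) dim (kernel-intro C 𝟏 (λ x Cx → C-compl Cx)) 𝟎≢𝟏

  transpose-kernel : 2 ℕ.< n → HasDim (Kernel C) 2 → ∀ H → IsZeroHeadMatrix n C H → HasDim (Kernel (TransposeCode H)) 1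
  transpose-kernel 2<n dim H (H-injective , H-rows) = go (plane dim)
    where
    toℕ-o : toℕ o ≡ 0
    toℕ-o = Finₚ.toℕ-fromℕ< 0<N
    -- `o` is the only coordinate whose number is 0, so the head condition is that f vanishes.
    rows : ∀ x → (C x × f x ≡ false) ⇔ (∃ λ i → x ≡ H i)
    rows x = mk⇔
      (λ where (Cx , fx) → Equivalence.to (H-rows x) (Cx , λ k k≡0 →
                 trans (cong (lookup x) (Finₚ.toℕ-injective (trans k≡0 (sym toℕ-o)))) fx))
      (λ h → proj₁ (Equivalence.from (H-rows x) h) , proj₂ (Equivalence.from (H-rows x) h) o toℕ-o)
    go : _ → HasDim (Kernel (TransposeCode H)) 1
    go (z₀ , Kz₀ , z₀≢𝟎 , z₀≢𝟏 , span) = Transposed.kernel-dimension-1 H H-injective rows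
      (periods-constant z₀ Kz₀ z₀≢𝟎 z₀≢𝟏 span 2<n)

  alwaysClosed⇒¬dim-2 : AlwaysClosed n (4 ℕ.* n) → HasDim (Kernel C) 2 → ⊥
  alwaysClosed⇒¬dim-2 closed dim = go (plane dim) (closed p r anti-p anti-r bent)
    where
    go : (∃ λ z₀ → Kernel C z₀ × z₀ ≢ 𝟎 × z₀ ≢ 𝟏 × SpannedBy (Kernel C) z₀) →
         (∃ λ p̂ → ∃ λ r̂ → (∀ k → p (+ k) ≡ p̂ k) × (∀ k → r (+ k) ≡ r̂ k) × BothClosed (n ℕ.+ n) (4 ℕ.* n) p̂ r̂) → ⊥
    go (z₀ , Kz₀ , z₀≢𝟎 , z₀≢𝟏 , span) (p̂ , r̂ , hp , hr , both) = ¬both-in-kernel z₀ Kz₀ z₀≢𝟎 z₀≢𝟏 span (proj₁ K) (proj₂ K)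
      where
      K : Kernel C (E (+ 1)) × Kernel C (E′ (+ 0))
      K = Finite.both-closed⇒kernel p̂ r̂ hp hr both

¬dim-2-length-0 : ∀ (P : Word 0 → Set) → HasDim P 2 → ⊥
¬dim-2-length-0 P (B , _ , indep) = distinct (indep (true ∷ true ∷ []) (empty (linComb B (true ∷ true ∷ []))))
  where
  empty : ∀ (x : Word 0) → x ≡ 𝟎
  empty [] = refl
  distinct : true ∷ true ∷ [] ≢ replicate 2 false
  distinct ()

theorem2 : (n : ℕ) (C : Code (4 * n)) (π : Assignment (4 * n)) (a b : Word (4 * n))
    → IsHFP (4 * n) C π
    → IsTypeQ n C π a b
    → HasDim (Kernel C) 2
    → (H : Fin (4 * n) → Word (4 * n))
    → IsZeroHeadMatrix n C H
    → HasDim (Kernel (TransposeCode H)) 1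
-- There is a single word of length 0, so no two vectors are independent.
theorem2 0 C π a b hfp typeQ dim H zh = ⊥-elim (¬dim-2-length-0 (Kernel C) dim)
theorem2 n@(suc _) C π a b hfp typeQ dim H zh = by-size (ℕₚ.<-cmp n 2)
  where
  open TypeQ n (ℕ.s≤s ℕ.z≤n) C π a b hfp typeQ
  by-size : Tri (n ℕ.< 2) (n ≡ 2) (2 ℕ.< n) → HasDim (Kernel (TransposeCode H)) 1
  by-size (tri< n<2 _ _) = ⊥-elim (alwaysClosed⇒¬dim-2 (subst (λ k → AlwaysClosed k (4 * k)) (ℕₚ.≤-antisym (ℕ.s≤s ℕ.z≤n) (ℕ.s≤s⁻¹ n<2)) alwaysClosed₁) dim)
  by-size (tri≈ _ n≡2 _) = ⊥-elim (alwaysClosed⇒¬dim-2 (subst (λ k → AlwaysClosed k (4 * k)) (sym n≡2) alwaysClosed₂) dim)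
  by-size (tri> _ _ 2<n) = transpose-kernel 2<n dim H zh
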